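{- Fix integers $r\ge 4$ and $k\ge 2$. For every real $1<a<3/2$ and every $C_0>0$, every graph $G$ of sufficiently large chromatic number (depending on $r,k,a,C_0$) satisfying $$e(G)\le \exp\bigl(C_0(\log\chi(G))^a\bigr)$$ contains a subgraph $H$ with $\operatorname{girth}(H)\ge r$ and $\chi(H)\ge k$.
   Context: All graphs are finite and simple; subgraphs need not be induced. $\chi$ is the chromatic number, $e(G)$ the number of edges; the girth of a forest is $\infty$; $\log$ is natural. -}

module Defs where

open import Data.Empty using (⊥)
open import Data.Fin using (Fin; toℕ; fromℕ<; inject₁; finToFun; funToFin) renaming (fromℕ to last; zero to fzero; suc to fsuc)
open import Data.Fin.Properties using (any?; all?; toℕ-injective; toℕ<n; toℕ-fromℕ<; finToFun-funToFin; injective⇒≤) renaming (_≟_ to _≟ᶠ_; _<?_ to _<ᶠ?_)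
open import Data.Fin.Subset using (Subset; _∈_; _⊆_)
open import Data.Fin.Subset.Properties using (_∈?_)
open import Data.Integer using (+_)
import Data.Integer as ℤ
import Data.Integer.Properties as ℤP
open import Data.List using (length; filter; allFin; cartesianProduct)
open import Data.Nat as ℕ using (ℕ; zero; suc; _!; z≤n; s≤s)
import Data.Nat.Properties as ℕP
open import Data.Product using (Σ; ∃; ∃-syntax; _×_; _,_; proj₁; proj₂)
open import Data.Rational using (ℚ; 0ℚ; 1ℚ; ½; _+_; _*_; _-_; -_; _/_; _÷_; 1/_; ∣_∣; _≤_; _<_; positive; nonNegative; >-nonZero; toℚᵘ; *≤*; mkℚ; +-*-rawSemiring)
open import Data.Rational.Properties
open import Data.Rational.Solver using (module +-*-Solver)
import Data.Rational.Unnormalised as ℚᵘ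
import Data.Rational.Unnormalised.Properties as ℚᵘP
open import Data.Sum using (inj₁; inj₂)
open import Function using (_∘_)
open import Function.Definitions using (Injective)
open import Level using (0ℓ)
open import Relation.Binary.Core using (Rel)
open import Relation.Binary.Definitions using (Symmetric; Irreflexive; Decidable)
open import Relation.Binary.PropositionalEquality
open import Relation.Nullary using (Dec; yes; no; contradiction)
open import Relation.Nullary.Construct.Add.Supremum using (_⁺; ⊤⁺; [_])
open import Relation.Nullary.Decidable using (map′; _×-dec_; _→-dec_; ¬?)
import Relation.Unary as U

open import Algebra.Definitions.RawSemiring +-*-rawSemiring using () renaming (_^_ to _^ℚ_) public

open +-*-Solver using (solve; _:+_; _:*_; _:-_; :-_; _:=_; con)

ℚfromℕ : ℕ → ℚ
ℚfromℕ n = + n / 1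

module RationalLemmas where

  mulˡ : ∀ {r p q} → 0ℚ ≤ r → p ≤ q → r * p ≤ r * q
  mulˡ {r} h = *-monoˡ-≤-nonNeg r {{nonNegative h}}

  mulʳ : ∀ {r p q} → 0ℚ ≤ r → p ≤ q → p * r ≤ q * r
  mulʳ {r} h = *-monoʳ-≤-nonNeg r {{nonNegative h}}

  mul : ∀ {p q r s} → 0ℚ ≤ r → 0ℚ ≤ q → p ≤ q → r ≤ s → p * r ≤ q * s
  mul hr hq hp hs = ≤-trans (mulʳ hr hp) (mulˡ hq hs)

  0≤mul : ∀ {p q} → 0ℚ ≤ p → 0ℚ ≤ q → 0ℚ ≤ p * q
  0≤mul {p} hp hq = subst (_≤ p * _) (*-zeroʳ p) (mulˡ hp hq)

  0≤add : ∀ {p q} → 0ℚ ≤ p → 0ℚ ≤ q → 0ℚ ≤ p + q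
  0≤add hp hq = +-mono-≤ hp hq

  0<mul : ∀ {p q} → 0ℚ < p → 0ℚ < q → 0ℚ < p * q
  0<mul {p} {q} hp hq = positive⁻¹ (p * q) {{pos*pos⇒pos p {{positive hp}} q {{positive hq}}}}

  0≤1 : 0ℚ ≤ 1ℚ
  0≤1 = nonNegative⁻¹ 1ℚ

  0<1 : 0ℚ < 1ℚ
  0<1 = positive⁻¹ 1ℚ

  2ℚ : ℚ
  2ℚ = + 2 / 1

  0≤2 : 0ℚ ≤ 2ℚ
  0≤2 = nonNegative⁻¹ 2ℚ

  cancelʳ : ∀ {r p q} → 0ℚ < r → p * r ≤ q * r → p ≤ q
  cancelʳ {r} h = *-cancelʳ-≤-pos r {{positive h}}

  sub-mono : ∀ {p q r} → p + r ≤ q → p ≤ q - r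
  sub-mono {p} {q} {r} h = subst (_≤ q - r) (solve 2 (λ p r → (p :+ r) :- r := p) refl p r) (+-monoˡ-≤ (- r) h)

  ∣-∣-comm : ∀ p q → ∣ p - q ∣ ≡ ∣ q - p ∣
  ∣-∣-comm p q = trans (sym (∣-p∣≡∣p∣ (p - q))) (cong ∣_∣ (solve 2 (λ p q → :- (p :- q) := q :- p) refl p q))

  p≤∣p∣ : ∀ p → p ≤ ∣ p ∣
  p≤∣p∣ p with ≤-total 0ℚ p
  ... | inj₁ h = ≤-reflexive (sym (0≤p⇒∣p∣≡p h))
  ... | inj₂ h = ≤-trans h (0≤∣p∣ p)

  ∣∣≤ : ∀ {p q} → p ≤ q → - p ≤ q → ∣ p ∣ ≤ q
  ∣∣≤ {p} {q} h₁ h₂ with ∣p∣≡p∨∣p∣≡-p p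
  ... | inj₁ e = subst (_≤ q) (sym e) h₁
  ... | inj₂ e = subst (_≤ q) (sym e) h₂

  tri : ∀ p q r → ∣ p - r ∣ ≤ ∣ p - q ∣ + ∣ q - r ∣
  tri p q r = subst (λ z → ∣ z ∣ ≤ ∣ p - q ∣ + ∣ q - r ∣)
    (solve 3 (λ p q r → (p :- q) :+ (q :- r) := p :- r) refl p q r) (∣p+q∣≤∣p∣+∣q∣ (p - q) (q - r))

  private
    ≃ᵘ : ∀ n → toℚᵘ (ℚfromℕ n) ℚᵘ.≃ (+ n ℚᵘ./ 1)
    ≃ᵘ n = toℚᵘ-fromℚᵘ (+ n ℚᵘ./ 1)

  fromℕ-* : ∀ m n → ℚfromℕ (m ℕ.* n) ≡ ℚfromℕ m * ℚfromℕ n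
  fromℕ-* m n = toℚᵘ-injective (begin
    toℚᵘ (ℚfromℕ (m ℕ.* n))                  ≈⟨ ≃ᵘ (m ℕ.* n) ⟩
    (+ (m ℕ.* n) ℚᵘ./ 1)                     ≈⟨ ℚᵘ.*≡* (cong (ℤ._* + 1) (ℤP.pos-* m n)) ⟩
    (+ m ℚᵘ./ 1) ℚᵘ.* (+ n ℚᵘ./ 1)           ≈⟨ ℚᵘP.*-cong (≃ᵘ m) (≃ᵘ n) ⟨
    toℚᵘ (ℚfromℕ m) ℚᵘ.* toℚᵘ (ℚfromℕ n)     ≈⟨ toℚᵘ-homo-* (ℚfromℕ m) (ℚfromℕ n) ⟨
    toℚᵘ (ℚfromℕ m * ℚfromℕ n)               ∎)
    where open ℚᵘP.≃-Reasoning

  fromℕ-+ : ∀ m n → ℚfromℕ (m ℕ.+ n) ≡ ℚfromℕ m + ℚfromℕ n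
  fromℕ-+ m n = toℚᵘ-injective (begin
    toℚᵘ (ℚfromℕ (m ℕ.+ n))                  ≈⟨ ≃ᵘ (m ℕ.+ n) ⟩
    (+ (m ℕ.+ n) ℚᵘ./ 1)                     ≈⟨ ℚᵘ.*≡* (cong (ℤ._* + 1) (trans (ℤP.pos-+ m n) (sym (cong₂ ℤ._+_ (ℤP.*-identityʳ (+ m)) (ℤP.*-identityʳ (+ n)))))) ⟩
    (+ m ℚᵘ./ 1) ℚᵘ.+ (+ n ℚᵘ./ 1)           ≈⟨ ℚᵘP.+-cong (≃ᵘ m) (≃ᵘ n) ⟨
    toℚᵘ (ℚfromℕ m) ℚᵘ.+ toℚᵘ (ℚfromℕ n)     ≈⟨ toℚᵘ-homo-+ (ℚfromℕ m) (ℚfromℕ n) ⟨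
    toℚᵘ (ℚfromℕ m + ℚfromℕ n)               ∎)
    where open ℚᵘP.≃-Reasoning

  fromℕ-suc : ∀ n → ℚfromℕ (suc n) ≡ 1ℚ + ℚfromℕ n
  fromℕ-suc n = fromℕ-+ 1 n

  fromℕ-≥0 : ∀ n → 0ℚ ≤ ℚfromℕ n
  fromℕ-≥0 n = nonNegative⁻¹ _ {{normalize-nonNeg n 1}}

  fromℕ-mono : ∀ {m n} → m ℕ.≤ n → ℚfromℕ m ≤ ℚfromℕ n
  fromℕ-mono {m} {n} h = subst₂ _≤_ (+-identityʳ _) (sym (trans (cong ℚfromℕ (sym (ℕP.m+[n∸m]≡n h))) (fromℕ-+ m (n ℕ.∸ m))))
    (+-monoʳ-≤ (ℚfromℕ m) (fromℕ-≥0 (n ℕ.∸ m)))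

  fromℕ-^ : ∀ m n → ℚfromℕ (m ℕ.^ n) ≡ ℚfromℕ m ^ℚ n
  fromℕ-^ m zero = refl
  fromℕ-^ m (suc n) = trans (fromℕ-* m (m ℕ.^ n)) (cong (ℚfromℕ m *_) (fromℕ-^ m n))

  n*[k/n]≡k : ∀ k n .{{_ : ℕ.NonZero n}} → ℚfromℕ n * (+ k / n) ≡ ℚfromℕ k
  n*[k/n]≡k k n@(suc n-1) = toℚᵘ-injective (begin
    toℚᵘ (ℚfromℕ n * (+ k / n))              ≈⟨ toℚᵘ-homo-* (ℚfromℕ n) (+ k / n) ⟩
    toℚᵘ (ℚfromℕ n) ℚᵘ.* toℚᵘ (+ k / n)      ≈⟨ ℚᵘP.*-cong (≃ᵘ n) (toℚᵘ-fromℚᵘ (+ k ℚᵘ./ n)) ⟩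
    (+ n ℚᵘ./ 1) ℚᵘ.* (+ k ℚᵘ./ n)           ≈⟨ ℚᵘ.*≡* (trans (ℤP.*-identityʳ _) (trans (ℤP.*-comm (+ n) (+ k)) (cong (λ z → + k ℤ.* + suc z) (sym (ℕP.+-identityʳ n-1))))) ⟩
    (+ k ℚᵘ./ 1)                             ≈⟨ ≃ᵘ k ⟨
    toℚᵘ (ℚfromℕ k)                          ∎)
    where open ℚᵘP.≃-Reasoning

  k/n≥0 : ∀ k n .{{_ : ℕ.NonZero n}} → 0ℚ ≤ + k / n
  k/n≥0 k n = nonNegative⁻¹ _ {{normalize-nonNeg k n}}

  archimedean : ∀ p → ∃[ n ] p ≤ ℚfromℕ n
  archimedean p = ℤ.∣ ℚ.numerator p ∣ , ≤-trans (p≤∣p∣ p) (bound ∣ p ∣ (ℤ.∣ ℚ.numerator p ∣) (num p))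
    where
    num : ∀ p → ℤ.∣ ℚ.numerator ∣ p ∣ ∣ ≡ ℤ.∣ ℚ.numerator p ∣
    num (mkℚ (+ n) d c) = refl
    num (mkℚ (ℤ.-[1+ n ]) d c) = refl
    bound : ∀ q n → ℤ.∣ ℚ.numerator q ∣ ≡ n → q ≤ ℚfromℕ n
    bound q@(mkℚ (+ m) d c) .m refl = toℚᵘ-cancel-≤ (ℚᵘP.≤-respʳ-≃ (ℚᵘP.≃-sym (≃ᵘ m))
      (ℚᵘ.*≤* (subst₂ ℤ._≤_ (ℤP.pos-* m 1) (ℤP.pos-* m (suc d)) (ℤ.+≤+ (ℕP.*-monoʳ-≤ m (s≤s z≤n))))))
    bound q@(mkℚ (ℤ.-[1+ m ]) d c) n e = ≤-trans (nonPositive⁻¹ q) (fromℕ-≥0 n)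

  shrink : ∀ C {ε} → 0ℚ < ε → ∃[ δ ] 0ℚ < δ × C * δ ≤ ε
  shrink C {ε} 0<ε with archimedean C
  ... | n , C≤n = ε * v , 0<δ , (begin
    C * (ε * v)              ≤⟨ mulʳ (<⇒≤ 0<δ) (≤-trans C≤n (fromℕ-mono (ℕP.n≤1+n n))) ⟩
    w * (ε * v)              ≡⟨ solve 3 (λ w ε v → w :* (ε :* v) := (w :* v) :* ε) refl w ε v ⟩
    (w * v) * ε              ≡⟨ cong (_* ε) (n*[k/n]≡k 1 (suc n)) ⟩
    1ℚ * ε                   ≡⟨ *-identityˡ ε ⟩
    ε                        ∎)
    where
    open ≤-Reasoning
    w = ℚfromℕ (suc n)
    v = + 1 / suc n
    0<δ : 0ℚ < ε * v
    0<δ = 0<mul 0<ε (positive⁻¹ v {{normalize-pos 1 (suc n)}})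

  enlarge : ∀ C {ε} → 0ℚ < ε → ∃[ n ] C ≤ ℚfromℕ n * ε
  enlarge C {ε} 0<ε with archimedean (C * (1/ ε) {{>-nonZero 0<ε}})
  ... | n , h = n , subst (_≤ ℚfromℕ n * ε)
    (trans (*-assoc C _ ε) (trans (cong (C *_) (*-inverseˡ ε {{>-nonZero 0<ε}})) (*-identityʳ C)))
    (mulʳ (<⇒≤ 0<ε) h)

open RationalLemmas

-- Reals are Cauchy sequences of rationals, not quotiented; _≤ᴿ_ and _<ᴿ_ respect
-- the equality of reals x ≤ᴿ y × y ≤ᴿ x.

IsCauchy : (ℕ → ℚ) → Set
IsCauchy x = ∀ ε → 0ℚ < ε → ∃[ N ] ∀ m n → N ℕ.≤ m → N ℕ.≤ n → ∣ x m - x n ∣ ≤ ε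

record ℝ : Set where
  constructor mkℝ
  field
    seq    : ℕ → ℚ
    cauchy : IsCauchy seq

open ℝ public

infix 4 _≤ᴿ_ _<ᴿ_

_≤ᴿ_ : ℝ → ℝ → Set
x ≤ᴿ y = ∀ ε → 0ℚ < ε → ∃[ N ] ∀ n → N ℕ.≤ n → seq x n ≤ seq y n + ε

_<ᴿ_ : ℝ → ℝ → Set
x <ᴿ y = ∃[ ε ] 0ℚ < ε × ∃[ N ] ∀ n → N ℕ.≤ n → seq x n + ε ≤ seq y n

fromℚ : ℚ → ℝ
fromℚ q = mkℝ (λ _ → q) λ ε 0<ε → 0 , λ _ _ _ _ → subst (_≤ ε) (cong ∣_∣ (sym (+-inverseʳ q))) (<⇒≤ 0<ε)

fromℕ : ℕ → ℝ
fromℕ n = fromℚ (ℚfromℕ n)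

module CauchyLemmas where

  bounded : ∀ x → IsCauchy x → ∃[ b ] ∃[ N ] ∀ n → N ℕ.≤ n → ∣ x n ∣ ≤ ℚfromℕ (suc b)
  bounded x c = b , N , λ n N≤n → begin
    ∣ x n ∣                    ≡⟨ cong ∣_∣ (solve 2 (λ p q → p := (p :- q) :+ q) refl (x n) (x N)) ⟩
    ∣ (x n - x N) + x N ∣      ≤⟨ ∣p+q∣≤∣p∣+∣q∣ (x n - x N) (x N) ⟩
    ∣ x n - x N ∣ + ∣ x N ∣    ≤⟨ +-mono-≤ (proj₂ (c 1ℚ 0<1) n N N≤n ℕP.≤-refl) (proj₂ (archimedean ∣ x N ∣)) ⟩
    1ℚ + ℚfromℕ b              ≡⟨ fromℕ-suc b ⟨
    ℚfromℕ (suc b)             ∎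
    where
    open ≤-Reasoning
    N = proj₁ (c 1ℚ 0<1)
    b = proj₁ (archimedean ∣ x N ∣)

  -- It is enough to control x m - x n for m ≤ n, up to a constant factor.
  cauchy-from : ∀ x C → (∀ δ → 0ℚ < δ → ∃[ N ] ∀ m n → N ℕ.≤ m → m ℕ.≤ n → ∣ x m - x n ∣ ≤ C * δ) → IsCauchy x
  cauchy-from x C H ε 0<ε = N , go
    where
    δ = proj₁ (shrink C 0<ε)
    Cδ≤ε = proj₂ (proj₂ (shrink C 0<ε))
    N = proj₁ (H δ (proj₁ (proj₂ (shrink C 0<ε))))
    h = proj₂ (H δ (proj₁ (proj₂ (shrink C 0<ε))))
    go : ∀ m n → N ℕ.≤ m → N ℕ.≤ n → ∣ x m - x n ∣ ≤ ε
    go m n N≤m N≤n with ℕP.≤-total m n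
    ... | inj₁ m≤n = ≤-trans (h m n N≤m m≤n) Cδ≤ε
    ... | inj₂ n≤m = subst (_≤ ε) (∣-∣-comm (x n) (x m)) (≤-trans (h n m N≤n n≤m) Cδ≤ε)

  *-cauchy : ∀ x y → IsCauchy x → IsCauchy y → IsCauchy (λ n → x n * y n)
  *-cauchy x y cx cy = cauchy-from (λ n → x n * y n) (A + B) λ δ 0<δ →
    let Nx , hx = cx δ 0<δ
        Ny , hy = cy δ 0<δ
    in (Na ℕ.⊔ Nb) ℕ.⊔ (Nx ℕ.⊔ Ny) , λ m n le m≤n →
      let le₁ = ℕP.≤-trans (ℕP.m≤m⊔n (Na ℕ.⊔ Nb) (Nx ℕ.⊔ Ny)) le
          le₂ = ℕP.≤-trans (ℕP.m≤n⊔m (Na ℕ.⊔ Nb) (Nx ℕ.⊔ Ny)) le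
          xm = ha m (ℕP.≤-trans (ℕP.m≤m⊔n Na Nb) le₁)
          yn = hb n (ℕP.≤-trans (ℕP.≤-trans (ℕP.m≤n⊔m Na Nb) le₁) m≤n)
          Nx≤m = ℕP.≤-trans (ℕP.m≤m⊔n Nx Ny) le₂
          Ny≤m = ℕP.≤-trans (ℕP.m≤n⊔m Nx Ny) le₂
      in begin
        ∣ x m * y m - x n * y n ∣
          ≡⟨ cong ∣_∣ (solve 4 (λ p q r s → p :* q :- r :* s := p :* (q :- s) :+ (p :- r) :* s) refl (x m) (y m) (x n) (y n)) ⟩
        ∣ x m * (y m - y n) + (x m - x n) * y n ∣
          ≤⟨ ∣p+q∣≤∣p∣+∣q∣ (x m * (y m - y n)) ((x m - x n) * y n) ⟩
        ∣ x m * (y m - y n) ∣ + ∣ (x m - x n) * y n ∣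
          ≡⟨ cong₂ _+_ (∣p*q∣≡∣p∣*∣q∣ (x m) (y m - y n)) (∣p*q∣≡∣p∣*∣q∣ (x m - x n) (y n)) ⟩
        ∣ x m ∣ * ∣ y m - y n ∣ + ∣ x m - x n ∣ * ∣ y n ∣
          ≤⟨ +-mono-≤ (mul (0≤∣p∣ (y m - y n)) (fromℕ-≥0 (suc a)) xm (hy m n Ny≤m (ℕP.≤-trans Ny≤m m≤n)))
                      (mul (0≤∣p∣ (y n)) (<⇒≤ 0<δ) (hx m n Nx≤m (ℕP.≤-trans Nx≤m m≤n)) yn) ⟩
        A * δ + δ * B ≡⟨ solve 3 (λ a b d → a :* d :+ d :* b := (a :+ b) :* d) refl A B δ ⟩
        (A + B) * δ ∎
    where
    open ≤-Reasoning
    Na = proj₁ (proj₂ (bounded x cx))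
    Nb = proj₁ (proj₂ (bounded y cy))
    ha = proj₂ (proj₂ (bounded x cx))
    hb = proj₂ (proj₂ (bounded y cy))
    a = proj₁ (bounded x cx)
    b = proj₁ (bounded y cy)
    A = ℚfromℕ (suc a)
    B = ℚfromℕ (suc b)

open CauchyLemmas

infixl 7 _*ᴿ_

_*ᴿ_ : ℝ → ℝ → ℝ
x *ᴿ y = mkℝ (λ n → seq x n * seq y n) (*-cauchy (seq x) (seq y) (cauchy x) (cauchy y))

∑ : ℕ → (ℕ → ℚ) → ℚ
∑ zero    g = 0ℚ
∑ (suc n) g = ∑ n g + g n

module GeometricLemmas where

  ∑-- : ∀ n f g → ∑ n (λ j → f j - g j) ≡ ∑ n f - ∑ n g
  ∑-- zero f g = refl
  ∑-- (suc n) f g = trans (cong (_+ (f n - g n)) (∑-- n f g))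
    (solve 4 (λ a b c d → (a :- b) :+ (c :- d) := (a :+ c) :- (b :+ d)) refl (∑ n f) (∑ n g) (f n) (g n))

  -- Geometric series with ratio 0 ≤ t < 1; s = 1 / (1 - t).
  module Geometric (t : ℚ) (0≤t : 0ℚ ≤ t) (t<1 : t < 1ℚ) where

    0<1-t : 0ℚ < 1ℚ - t
    0<1-t = subst (_< 1ℚ - t) (+-inverseʳ t) (+-monoˡ-< (- t) t<1)

    s : ℚ
    s = (1/ (1ℚ - t)) {{>-nonZero 0<1-t}}

    s[1-t]≡1 : s * (1ℚ - t) ≡ 1ℚ
    s[1-t]≡1 = *-inverseˡ (1ℚ - t) {{>-nonZero 0<1-t}}

    0≤s : 0ℚ ≤ s
    0≤s = <⇒≤ (positive⁻¹ s {{1/pos⇒pos (1ℚ - t) {{positive 0<1-t}}}})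

    ^≥0 : ∀ n → 0ℚ ≤ t ^ℚ n
    ^≥0 zero    = 0≤1
    ^≥0 (suc n) = 0≤mul 0≤t (^≥0 n)

    ^≤1 : ∀ n → t ^ℚ n ≤ 1ℚ
    ^≤1 zero    = ≤-refl
    ^≤1 (suc n) = subst (t * t ^ℚ n ≤_) (*-identityˡ 1ℚ) (mul (^≥0 n) 0≤1 (<⇒≤ t<1) (^≤1 n))

    n*tⁿ≤ : ∀ n → ℚfromℕ n * t ^ℚ n ≤ s * (1ℚ - t ^ℚ n)
    n*tⁿ≤ zero = ≤-reflexive (trans (*-zeroˡ 1ℚ) (sym (trans (cong (s *_) (+-inverseʳ 1ℚ)) (*-zeroʳ s))))
    n*tⁿ≤ (suc n) = begin
      ℚfromℕ (suc n) * (t * u)        ≡⟨ cong (_* (t * u)) (fromℕ-suc n) ⟩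
      (1ℚ + ℚfromℕ n) * (t * u)       ≡⟨ solve 4 (λ o n t u → (o :+ n) :* (t :* u) := t :* (n :* u) :+ o :* (t :* u)) refl 1ℚ (ℚfromℕ n) t u ⟩
      t * (ℚfromℕ n * u) + 1ℚ * (t * u) ≤⟨ +-mono-≤ (mulˡ 0≤t (n*tⁿ≤ n)) (≤-trans (≤-reflexive (*-identityˡ (t * u))) (^≤1 (suc n))) ⟩
      t * (s * (1ℚ - u)) + 1ℚ         ≡⟨ cong (λ z → t * (s * (1ℚ - u)) + z) s[1-t]≡1 ⟨
      t * (s * (1ℚ - u)) + s * (1ℚ - t) ≡⟨ solve 3 (λ t s u → t :* (s :* (con 1ℚ :- u)) :+ s :* (con 1ℚ :- t) := s :* (con 1ℚ :- t :* u)) refl t s u ⟩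
      s * (1ℚ - t * u)                ∎
      where
      open ≤-Reasoning
      u = t ^ℚ n

    tail : ∀ K g → (∀ j → ∣ g j ∣ ≤ K * t ^ℚ j) → ∀ m d → ∣ ∑ m g - ∑ (m ℕ.+ d) g ∣ ≤ K * s * (t ^ℚ m - t ^ℚ (m ℕ.+ d))
    tail K g b m zero = ≤-reflexive (trans (cong (λ k → ∣ ∑ m g - ∑ k g ∣) (ℕP.+-identityʳ m))
      (trans (cong ∣_∣ (+-inverseʳ (∑ m g)))
        (sym (trans (cong (λ k → K * s * (t ^ℚ m - t ^ℚ k)) (ℕP.+-identityʳ m)) (trans (cong ((K * s) *_) (+-inverseʳ (t ^ℚ m))) (*-zeroʳ (K * s)))))))
    tail K g b m (suc d) = subst (λ k → ∣ ∑ m g - ∑ k g ∣ ≤ K * s * (t ^ℚ m - t ^ℚ k)) (sym (ℕP.+-suc m d)) (begin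
      ∣ ∑ m g - (∑ e g + g e) ∣           ≡⟨ cong ∣_∣ (solve 3 (λ a b c → a :- (b :+ c) := (a :- b) :+ :- c) refl (∑ m g) (∑ e g) (g e)) ⟩
      ∣ (∑ m g - ∑ e g) + - g e ∣         ≤⟨ ∣p+q∣≤∣p∣+∣q∣ (∑ m g - ∑ e g) (- g e) ⟩
      ∣ ∑ m g - ∑ e g ∣ + ∣ - g e ∣       ≡⟨ cong (λ z → ∣ ∑ m g - ∑ e g ∣ + z) (∣-p∣≡∣p∣ (g e)) ⟩
      ∣ ∑ m g - ∑ e g ∣ + ∣ g e ∣         ≤⟨ +-mono-≤ (tail K g b m d) (b e) ⟩
      K * s * (t ^ℚ m - v) + K * v        ≡⟨ cong (λ z → K * s * (t ^ℚ m - v) + K * z) (trans (sym (*-identityˡ v)) (trans (cong (_* v) (sym s[1-t]≡1)) refl)) ⟩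
      K * s * (t ^ℚ m - v) + K * (s * (1ℚ - t) * v) ≡⟨ solve 6 (λ K s a v t o → K :* s :* (a :- v) :+ K :* (s :* (o :- t) :* v) := K :* s :* (a :- v :+ (o :* v :- t :* v))) refl K s (t ^ℚ m) v t 1ℚ ⟩
      K * s * (t ^ℚ m - v + (1ℚ * v - t * v)) ≡⟨ cong (λ z → K * s * (t ^ℚ m - v + (z - t * v))) (*-identityˡ v) ⟩
      K * s * (t ^ℚ m - v + (v - t * v))  ≡⟨ cong ((K * s) *_) (solve 3 (λ a v w → a :- v :+ (v :- w) := a :- w) refl (t ^ℚ m) v (t * v)) ⟩
      K * s * (t ^ℚ m - t * v) ∎)
      where
      open ≤-Reasoning
      e = m ℕ.+ d
      v = t ^ℚ e

    tail′ : ∀ K g → 0ℚ ≤ K → (∀ j → ∣ g j ∣ ≤ K * t ^ℚ j) → ∀ m n → m ℕ.≤ n → ∣ ∑ m g - ∑ n g ∣ ≤ K * s * t ^ℚ m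
    tail′ K g 0≤K b m n m≤n = begin
      ∣ ∑ m g - ∑ n g ∣             ≡⟨ cong (λ k → ∣ ∑ m g - ∑ k g ∣) (ℕP.m+[n∸m]≡n m≤n) ⟨
      ∣ ∑ m g - ∑ (m ℕ.+ d) g ∣     ≤⟨ tail K g b m d ⟩
      K * s * (t ^ℚ m - w)          ≤⟨ mulˡ (0≤mul 0≤K 0≤s) (+-monoʳ-≤ (t ^ℚ m) (neg-antimono-≤ (^≥0 (m ℕ.+ d)))) ⟩
      K * s * (t ^ℚ m + 0ℚ)         ≡⟨ cong ((K * s) *_) (+-identityʳ (t ^ℚ m)) ⟩
      K * s * t ^ℚ m                ∎
      where
      open ≤-Reasoning
      d = n ℕ.∸ m
      w = t ^ℚ (m ℕ.+ d)

    sum-bound : ∀ K g → 0ℚ ≤ K → (∀ j → ∣ g j ∣ ≤ K * t ^ℚ j) → ∀ n → ∣ ∑ n g ∣ ≤ K * s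
    sum-bound K g 0≤K b n = subst₂ _≤_
      (trans (cong ∣_∣ (+-identityˡ (- ∑ n g))) (∣-p∣≡∣p∣ (∑ n g))) (*-identityʳ (K * s)) (tail′ K g 0≤K b 0 n z≤n)

    -- Diagonal sums ∑_{j<n} fⱼ(xₙ) of a series which, for |p| ≤ B, is dominated
    -- together with its Lipschitz constants by a geometric series.
    diagonal : ∀ (f : ℕ → ℚ → ℚ) x → IsCauchy x → ∀ K B → 0ℚ ≤ K →
      (∃[ N ] ∀ n → N ℕ.≤ n → ∣ x n ∣ ≤ B) →
      (∀ j p → ∣ p ∣ ≤ B → ∣ f j p ∣ ≤ K * t ^ℚ j) →
      (∀ j p q → ∣ p ∣ ≤ B → ∣ q ∣ ≤ B → ∣ f j p - f j q ∣ ≤ K * t ^ℚ j * ∣ p - q ∣) →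
      IsCauchy (λ n → ∑ n (λ j → f j (x n)))
    diagonal f x cx K B 0≤K (N₀ , x≤B) bnd lip = cauchy-from (λ n → ∑ n (λ j → f j (x n))) (K * s + K * s) λ δ 0<δ →
      let N₁ , h = cx δ 0<δ
          N₂ , small = enlarge s 0<δ
      in N₀ ℕ.⊔ N₁ ℕ.⊔ suc N₂ , λ m n le m≤n →
      let le₀₁ = ℕP.≤-trans (ℕP.m≤m⊔n (N₀ ℕ.⊔ N₁) (suc N₂)) le
          N₀≤m = ℕP.≤-trans (ℕP.m≤m⊔n N₀ N₁) le₀₁
          N₁≤m = ℕP.≤-trans (ℕP.m≤n⊔m N₀ N₁) le₀₁
          N₂<m = ℕP.≤-trans (ℕP.m≤n⊔m (N₀ ℕ.⊔ N₁) (suc N₂)) le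
      in step δ 0<δ m n m≤n (x≤B m N₀≤m) (x≤B n (ℕP.≤-trans N₀≤m m≤n)) (h m n N₁≤m (ℕP.≤-trans N₁≤m m≤n)) N₂ N₂<m small
      where
      open ≤-Reasoning
      tᵐ-small : ∀ δ → 0ℚ < δ → ∀ N m → N ℕ.< m → s ≤ ℚfromℕ N * δ → t ^ℚ m ≤ δ
      tᵐ-small δ 0<δ N m N<m sm = cancelʳ {ℚfromℕ m} 0<m (begin
        t ^ℚ m * ℚfromℕ m             ≡⟨ *-comm (t ^ℚ m) (ℚfromℕ m) ⟩
        ℚfromℕ m * t ^ℚ m             ≤⟨ n*tⁿ≤ m ⟩
        s * (1ℚ - t ^ℚ m)             ≤⟨ mulˡ 0≤s (≤-trans (+-monoʳ-≤ 1ℚ (neg-antimono-≤ (^≥0 m))) (≤-reflexive (+-identityʳ 1ℚ))) ⟩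
        s * 1ℚ                        ≡⟨ *-identityʳ s ⟩
        s                             ≤⟨ sm ⟩
        ℚfromℕ N * δ                  ≤⟨ mulʳ (<⇒≤ 0<δ) (fromℕ-mono (ℕP.<⇒≤ N<m)) ⟩
        ℚfromℕ m * δ                  ≡⟨ *-comm (ℚfromℕ m) δ ⟩
        δ * ℚfromℕ m                  ∎)
        where
        0<m : 0ℚ < ℚfromℕ m
        0<m = <-≤-trans 0<1 (fromℕ-mono (ℕP.≤-trans (s≤s z≤n) N<m))
      step : ∀ δ → 0ℚ < δ → ∀ m n → m ℕ.≤ n → ∣ x m ∣ ≤ B → ∣ x n ∣ ≤ B → ∣ x m - x n ∣ ≤ δ →
        ∀ N → N ℕ.< m → s ≤ ℚfromℕ N * δ →
        ∣ ∑ m (λ j → f j (x m)) - ∑ n (λ j → f j (x n)) ∣ ≤ (K * s + K * s) * δ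
      step δ 0<δ m n m≤n p≤B q≤B pq N N<m sm = begin
        ∣ ∑ m (λ j → f j p) - ∑ n (λ j → f j q) ∣
          ≤⟨ tri (∑ m (λ j → f j p)) (∑ m (λ j → f j q)) (∑ n (λ j → f j q)) ⟩
        ∣ ∑ m (λ j → f j p) - ∑ m (λ j → f j q) ∣ + ∣ ∑ m (λ j → f j q) - ∑ n (λ j → f j q) ∣
          ≡⟨ cong (λ z → ∣ z ∣ + ∣ ∑ m (λ j → f j q) - ∑ n (λ j → f j q) ∣) (∑-- m (λ j → f j p) (λ j → f j q)) ⟨
        ∣ ∑ m (λ j → f j p - f j q) ∣ + ∣ ∑ m (λ j → f j q) - ∑ n (λ j → f j q) ∣
          ≤⟨ +-mono-≤ (sum-bound (K * d) (λ j → f j p - f j q) (0≤mul 0≤K (0≤∣p∣ (p - q)))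
                        (λ j → ≤-trans (lip j p q p≤B q≤B) (≤-reflexive (solve 3 (λ a b c → a :* b :* c := a :* c :* b) refl K (t ^ℚ j) d))) m)
                      (tail′ K (λ j → f j q) 0≤K (λ j → bnd j q q≤B) m n m≤n) ⟩
        K * d * s + K * s * t ^ℚ m
          ≡⟨ cong (_+ (K * s * t ^ℚ m)) (solve 3 (λ a b c → a :* b :* c := a :* c :* b) refl K d s) ⟩
        K * s * d + K * s * t ^ℚ m
          ≤⟨ +-mono-≤ (mulˡ (0≤mul 0≤K 0≤s) pq) (mulˡ (0≤mul 0≤K 0≤s) (tᵐ-small δ 0<δ N m N<m sm)) ⟩
        K * s * δ + K * s * δ
          ≡⟨ *-distribʳ-+ δ (K * s) (K * s) ⟨
        (K * s + K * s) * δ ∎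
        where
        p = x m
        q = x n
        d = ∣ p - q ∣

  ∣^∣ : ∀ p n → ∣ p ^ℚ n ∣ ≡ ∣ p ∣ ^ℚ n
  ∣^∣ p zero    = refl
  ∣^∣ p (suc n) = trans (∣p*q∣≡∣p∣*∣q∣ p (p ^ℚ n)) (cong (∣ p ∣ *_) (∣^∣ p n))

  ^≥0 : ∀ {p} → 0ℚ ≤ p → ∀ n → 0ℚ ≤ p ^ℚ n
  ^≥0 h zero    = 0≤1
  ^≥0 h (suc n) = 0≤mul h (^≥0 h n)

  ^-mono : ∀ {p q} → 0ℚ ≤ p → p ≤ q → ∀ n → p ^ℚ n ≤ q ^ℚ n
  ^-mono h₀ h zero    = ≤-refl
  ^-mono h₀ h (suc n) = mul (^≥0 h₀ n) (≤-trans h₀ h) h (^-mono h₀ h n)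

  ∣p∣≤⇒∣^∣≤ : ∀ {p B} n → ∣ p ∣ ≤ B → ∣ p ^ℚ n ∣ ≤ B ^ℚ n
  ∣p∣≤⇒∣^∣≤ {p} {B} n h = subst (_≤ B ^ℚ n) (sym (∣^∣ p n)) (^-mono (0≤∣p∣ p) h n)

  ^-lipschitz : ∀ B p q → ∣ p ∣ ≤ B → ∣ q ∣ ≤ B → ∀ n →
    ∣ p ^ℚ suc n - q ^ℚ suc n ∣ ≤ ℚfromℕ (suc n) * B ^ℚ n * ∣ p - q ∣
  ^-lipschitz B p q hp hq zero = ≤-reflexive (trans (cong ∣_∣ (cong₂ _-_ (*-identityʳ p) (*-identityʳ q)))
    (sym (trans (cong (_* ∣ p - q ∣) (*-identityˡ 1ℚ)) (*-identityˡ ∣ p - q ∣))))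
  ^-lipschitz B p q hp hq (suc n) = begin
    ∣ p * P - q * Q ∣                     ≡⟨ cong ∣_∣ (solve 4 (λ p P q Q → p :* P :- q :* Q := p :* (P :- Q) :+ Q :* (p :- q)) refl p P q Q) ⟩
    ∣ p * (P - Q) + Q * (p - q) ∣         ≤⟨ ∣p+q∣≤∣p∣+∣q∣ (p * (P - Q)) (Q * (p - q)) ⟩
    ∣ p * (P - Q) ∣ + ∣ Q * (p - q) ∣     ≡⟨ cong₂ _+_ (∣p*q∣≡∣p∣*∣q∣ p (P - Q)) (∣p*q∣≡∣p∣*∣q∣ Q (p - q)) ⟩
    ∣ p ∣ * ∣ P - Q ∣ + ∣ Q ∣ * d          ≤⟨ +-mono-≤ (mul (0≤∣p∣ (P - Q)) 0≤B hp (^-lipschitz B p q hp hq n)) (mulʳ (0≤∣p∣ (p - q)) (∣p∣≤⇒∣^∣≤ (suc n) hq)) ⟩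
    B * (N * b * d) + B * b * d           ≡⟨ solve 4 (λ B N b d → B :* (N :* b :* d) :+ B :* b :* d := (con 1ℚ :+ N) :* (B :* b) :* d) refl B N b d ⟩
    (1ℚ + N) * (B * b) * d                ≡⟨ cong (λ z → z * (B * b) * d) (fromℕ-suc (suc n)) ⟨
    ℚfromℕ (suc (suc n)) * (B * b) * d    ∎
    where
    open ≤-Reasoning
    0≤B = ≤-trans (0≤∣p∣ p) hp
    P = p ^ℚ suc n
    Q = q ^ℚ suc n
    N = ℚfromℕ (suc n)
    b = B ^ℚ n
    d = ∣ p - q ∣

open GeometricLemmas

inv! : ℕ → ℚ
inv! j = _/_ (+ 1) (j !) {{j ℕP.!≢0}}

expTerm : ℕ → ℚ → ℚ
expTerm j p = inv! j * p ^ℚ j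

module ExpLemmas where

  inv!≥0 : ∀ j → 0ℚ ≤ inv! j
  inv!≥0 j = k/n≥0 1 (j !) {{j ℕP.!≢0}}

  j!*inv!≡1 : ∀ j → ℚfromℕ (j !) * inv! j ≡ 1ℚ
  j!*inv!≡1 j = n*[k/n]≡k 1 (j !) {{j ℕP.!≢0}}

  ^≤^*! : ∀ r .{{_ : ℕ.NonZero r}} j → r ℕ.^ j ℕ.≤ r ℕ.^ r ℕ.* (j !)
  ^≤^*! r zero = ℕP.≤-trans (ℕP.m^n>0 r r) (ℕP.≤-reflexive (sym (ℕP.*-identityʳ (r ℕ.^ r))))
  ^≤^*! r (suc j) with ℕP.≤-total (suc j) r
  ... | inj₁ j<r = ℕP.≤-trans (ℕP.^-monoʳ-≤ r j<r) (ℕP.m≤m*n (r ℕ.^ r) (suc j !) {{suc j ℕP.!≢0}})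
  ... | inj₂ r≤j = ℕP.≤-trans (ℕP.*-mono-≤ r≤j (^≤^*! r j)) (ℕP.≤-reflexive (begin
    suc j ℕ.* (r ℕ.^ r ℕ.* (j !)) ≡⟨ ℕP.*-assoc (suc j) (r ℕ.^ r) (j !) ⟨
    suc j ℕ.* r ℕ.^ r ℕ.* (j !)   ≡⟨ cong (ℕ._* (j !)) (ℕP.*-comm (suc j) (r ℕ.^ r)) ⟩
    r ℕ.^ r ℕ.* suc j ℕ.* (j !)   ≡⟨ ℕP.*-assoc (r ℕ.^ r) (suc j) (j !) ⟩
    r ℕ.^ r ℕ.* (suc j ℕ.* (j !)) ∎))
    where open ≡-Reasoning

  module Exp (b : ℕ) where

    B ρ M : ℚ
    B = ℚfromℕ (suc b)
    r : ℕ
    r = suc b ℕ.+ suc b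
    ρ = ℚfromℕ r
    M = ℚfromℕ (r ℕ.^ r)

    ρ½≡B : ρ * ½ ≡ B
    ρ½≡B = trans (cong (_* ½) (fromℕ-+ (suc b) (suc b))) (trans (solve 2 (λ B h → (B :+ B) :* h := B :* (h :+ h)) refl B ½) (*-identityʳ B))

    B^≡ : ∀ j → B ^ℚ j ≡ ρ ^ℚ j * ½ ^ℚ j
    B^≡ zero    = sym (*-identityˡ 1ℚ)
    B^≡ (suc j) = trans (cong₂ _*_ (sym ρ½≡B) (B^≡ j)) (solve 4 (λ a b c d → a :* b :* (c :* d) := a :* c :* (b :* d)) refl ρ ½ (ρ ^ℚ j) (½ ^ℚ j))

    Bʲ/j!≤ : ∀ j → inv! j * B ^ℚ j ≤ M * ½ ^ℚ j
    Bʲ/j!≤ j = begin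
      v * B ^ℚ j                        ≡⟨ cong (v *_) (B^≡ j) ⟩
      v * (ρ ^ℚ j * ½ ^ℚ j)             ≡⟨ *-assoc v (ρ ^ℚ j) (½ ^ℚ j) ⟨
      v * ρ ^ℚ j * ½ ^ℚ j               ≤⟨ mulʳ (^≥0 (nonNegative⁻¹ ½) j) (begin
        v * ρ ^ℚ j                        ≡⟨ cong (v *_) (fromℕ-^ r j) ⟨
        v * ℚfromℕ (r ℕ.^ j)              ≤⟨ mulˡ (inv!≥0 j) (fromℕ-mono (^≤^*! r j)) ⟩
        v * ℚfromℕ (r ℕ.^ r ℕ.* (j !))    ≡⟨ cong (v *_) (fromℕ-* (r ℕ.^ r) (j !)) ⟩
        v * (M * ℚfromℕ (j !))            ≡⟨ solve 3 (λ v M n → v :* (M :* n) := M :* (n :* v)) refl v M (ℚfromℕ (j !)) ⟩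
        M * (ℚfromℕ (j !) * v)            ≡⟨ cong (M *_) (j!*inv!≡1 j) ⟩
        M * 1ℚ                            ≡⟨ *-identityʳ M ⟩
        M                                 ∎) ⟩
      M * ½ ^ℚ j                        ∎
      where
      open ≤-Reasoning
      v = inv! j

    K : ℚ
    K = M * 2ℚ

    0≤M : 0ℚ ≤ M
    0≤M = fromℕ-≥0 (r ℕ.^ r)

    0≤K : 0ℚ ≤ K
    0≤K = 0≤mul 0≤M 0≤2

    M≤K : M ≤ K
    M≤K = subst (_≤ K) (*-identityʳ M) (mulˡ 0≤M (fromℕ-mono {1} {2} (s≤s z≤n)))

    bnd : ∀ j p → ∣ p ∣ ≤ B → ∣ expTerm j p ∣ ≤ K * ½ ^ℚ j
    bnd j p h = begin
      ∣ v * p ^ℚ j ∣     ≡⟨ ∣p*q∣≡∣p∣*∣q∣ v (p ^ℚ j) ⟩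
      ∣ v ∣ * ∣ p ^ℚ j ∣  ≡⟨ cong (_* ∣ p ^ℚ j ∣) (0≤p⇒∣p∣≡p (inv!≥0 j)) ⟩
      v * ∣ p ^ℚ j ∣     ≤⟨ mulˡ (inv!≥0 j) (∣p∣≤⇒∣^∣≤ j h) ⟩
      v * B ^ℚ j         ≤⟨ Bʲ/j!≤ j ⟩
      M * ½ ^ℚ j         ≤⟨ mulʳ (^≥0 (nonNegative⁻¹ ½) j) M≤K ⟩
      K * ½ ^ℚ j         ∎
      where
      open ≤-Reasoning
      v = inv! j

    1/[1+j]! : ∀ j → inv! (suc j) * ℚfromℕ (suc j) ≡ inv! j
    1/[1+j]! j = begin
      A * N             ≡⟨ *-identityʳ (A * N) ⟨
      A * N * 1ℚ        ≡⟨ cong (λ z → A * N * z) (j!*inv!≡1 j) ⟨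
      A * N * (F * V)   ≡⟨ solve 4 (λ A N F V → A :* N :* (F :* V) := (N :* F) :* A :* V) refl A N F V ⟩
      N * F * A * V     ≡⟨ cong (λ z → z * A * V) (fromℕ-* (suc j) (j !)) ⟨
      ℚfromℕ (suc j !) * A * V ≡⟨ cong (_* V) (j!*inv!≡1 (suc j)) ⟩
      1ℚ * V            ≡⟨ *-identityˡ V ⟩
      V                 ∎
      where
      open ≡-Reasoning
      A = inv! (suc j)
      N = ℚfromℕ (suc j)
      F = ℚfromℕ (j !)
      V = inv! j

    lip : ∀ j p q → ∣ p ∣ ≤ B → ∣ q ∣ ≤ B → ∣ expTerm j p - expTerm j q ∣ ≤ K * ½ ^ℚ j * ∣ p - q ∣
    lip zero p q hp hq = subst (_≤ K * 1ℚ * ∣ p - q ∣) (cong ∣_∣ (sym (+-inverseʳ (1ℚ * 1ℚ)))) (0≤mul (0≤mul 0≤K 0≤1) (0≤∣p∣ (p - q)))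
    lip (suc j) p q hp hq = begin
      ∣ A * p ^ℚ suc j - A * q ^ℚ suc j ∣
        ≡⟨ cong ∣_∣ (solve 3 (λ a p q → a :* p :- a :* q := a :* (p :- q)) refl A (p ^ℚ suc j) (q ^ℚ suc j)) ⟩
      ∣ A * (p ^ℚ suc j - q ^ℚ suc j) ∣
        ≡⟨ trans (∣p*q∣≡∣p∣*∣q∣ A (p ^ℚ suc j - q ^ℚ suc j)) (cong (_* ∣ p ^ℚ suc j - q ^ℚ suc j ∣) (0≤p⇒∣p∣≡p (inv!≥0 (suc j)))) ⟩
      A * ∣ p ^ℚ suc j - q ^ℚ suc j ∣
        ≤⟨ mulˡ (inv!≥0 (suc j)) (^-lipschitz B p q hp hq j) ⟩
      A * (N * B ^ℚ j * d)
        ≡⟨ solve 4 (λ A N b d → A :* (N :* b :* d) := A :* N :* b :* d) refl A N (B ^ℚ j) d ⟩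
      A * N * B ^ℚ j * d
        ≡⟨ cong (λ z → z * B ^ℚ j * d) (1/[1+j]! j) ⟩
      inv! j * B ^ℚ j * d
        ≤⟨ mulʳ (0≤∣p∣ (p - q)) (Bʲ/j!≤ j) ⟩
      M * ½ ^ℚ j * d
        ≡⟨ cong (_* d) (trans (cong (_* ½ ^ℚ j) (sym (*-identityʳ M))) (solve 4 (λ M t h x → M :* (t :* h) :* x := M :* t :* (h :* x)) refl M 2ℚ ½ (½ ^ℚ j))) ⟩
      K * ½ ^ℚ suc j * d ∎
      where
      open ≤-Reasoning
      A = inv! (suc j)
      N = ℚfromℕ (suc j)
      d = ∣ p - q ∣

  0≤½ : 0ℚ ≤ ½
  0≤½ = nonNegative⁻¹ ½

  ½<1 : ½ < 1ℚ
  ½<1 = subst₂ _<_ (+-identityʳ ½) refl (+-monoʳ-< ½ (positive⁻¹ ½))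

  exp-cauchy : ∀ x → IsCauchy x → IsCauchy (λ n → ∑ n (λ j → expTerm j (x n)))
  exp-cauchy x cx = Geometric.diagonal ½ 0≤½ ½<1 expTerm x cx (Exp.K b) (Exp.B b) (Exp.0≤K b) (proj₂ (bounded x cx)) (Exp.bnd b) (Exp.lip b)
    where b = proj₁ (bounded x cx)

open ExpLemmas

-- exp x = ∑ⱼ xʲ / j!; the n-th entry is the n-term partial sum at the n-th entry of x.
exp : ℝ → ℝ
exp x = mkℝ (λ n → ∑ n (λ j → expTerm j (seq x n))) (exp-cauchy (seq x) (cauchy x))

-- φ q = (q - 1) / (q + 1). The value at q ≤ 0 is irrelevant: the entries of a
-- positive real are eventually positive.
φ : ℚ → ℚ
φ q with 0ℚ <? q
... | yes 0<q = _÷_ (q - 1ℚ) (q + 1ℚ) {{>-nonZero (+-mono-< 0<q 0<1)}}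
... | no  _   = 0ℚ

logTerm : ℕ → ℚ → ℚ
logTerm i u = (+ 2 / suc (2 ℕ.* i)) * u ^ℚ suc (2 ℕ.* i)

module LogLemmas where

  φ-spec : ∀ q → 0ℚ < q → φ q * (q + 1ℚ) ≡ q - 1ℚ
  φ-spec q 0<q with 0ℚ <? q
  ... | no  h = contradiction 0<q h
  ... | yes h = trans (*-assoc (q - 1ℚ) _ (q + 1ℚ))
    (trans (cong ((q - 1ℚ) *_) (*-inverseˡ (q + 1ℚ) {{>-nonZero (+-mono-< h 0<1)}})) (*-identityʳ (q - 1ℚ)))

  0<q+1 : ∀ {q} → 0ℚ < q → 0ℚ < q + 1ℚ
  0<q+1 h = +-mono-< h 0<1

  1≤q+1 : ∀ {q} → 0ℚ < q → 1ℚ ≤ q + 1ℚ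
  1≤q+1 {q} h = subst (_≤ q + 1ℚ) (+-identityˡ 1ℚ) (+-monoˡ-≤ 1ℚ (<⇒≤ h))

  φ-lipschitz : ∀ p q → 0ℚ < p → 0ℚ < q → ∣ φ p - φ q ∣ ≤ 2ℚ * ∣ p - q ∣
  φ-lipschitz p q 0<p 0<q = begin
    ∣ d ∣                         ≡⟨ trans (*-identityʳ (∣ d ∣ * 1ℚ)) (*-identityʳ ∣ d ∣) ⟨
    ∣ d ∣ * 1ℚ * 1ℚ               ≤⟨ mul 0≤1 (0≤mul (0≤∣p∣ d) (<⇒≤ (0<q+1 0<p))) (mulˡ (0≤∣p∣ d) (1≤q+1 0<p)) (1≤q+1 0<q) ⟩
    ∣ d ∣ * p′ * q′               ≡⟨ cong₂ (λ a b → ∣ d ∣ * a * b) (0≤p⇒∣p∣≡p (<⇒≤ (0<q+1 0<p))) (0≤p⇒∣p∣≡p (<⇒≤ (0<q+1 0<q))) ⟨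
    ∣ d ∣ * ∣ p′ ∣ * ∣ q′ ∣       ≡⟨ trans (∣p*q∣≡∣p∣*∣q∣ (d * p′) q′) (cong (_* ∣ q′ ∣) (∣p*q∣≡∣p∣*∣q∣ d p′)) ⟨
    ∣ d * p′ * q′ ∣               ≡⟨ cong ∣_∣ eq ⟩
    ∣ 2ℚ * (p - q) ∣              ≡⟨ ∣p*q∣≡∣p∣*∣q∣ 2ℚ (p - q) ⟩
    2ℚ * ∣ p - q ∣                ∎
    where
    open ≤-Reasoning
    d = φ p - φ q
    p′ = p + 1ℚ
    q′ = q + 1ℚ
    eq : d * p′ * q′ ≡ 2ℚ * (p - q)
    eq = trans (solve 4 (λ a b p q → (a :- b) :* p :* q := a :* p :* q :- b :* q :* p) refl (φ p) (φ q) p′ q′)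
      (trans (cong₂ (λ a b → a * q′ - b * p′) (φ-spec p 0<p) (φ-spec q 0<q))
        (solve 2 (λ p q → (p :- con 1ℚ) :* (q :+ con 1ℚ) :- (q :- con 1ℚ) :* (p :+ con 1ℚ) := con 2ℚ :* (p :- q)) refl p q))

  φ-cauchy : ∀ x → IsCauchy x → ∀ ε → 0ℚ < ε → ∀ N → (∀ n → N ℕ.≤ n → 0ℚ + ε ≤ x n) → IsCauchy (λ n → φ (x n))
  φ-cauchy x cx ε 0<ε N h = cauchy-from (λ n → φ (x n)) 2ℚ λ δ 0<δ →
    let Nx , hx = cx δ 0<δ
    in N ℕ.⊔ Nx , λ m n le m≤n →
    let N≤m  = ℕP.≤-trans (ℕP.m≤m⊔n N Nx) le
        Nx≤m = ℕP.≤-trans (ℕP.m≤n⊔m N Nx) le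
    in ≤-trans (φ-lipschitz (x m) (x n) (pos m N≤m) (pos n (ℕP.≤-trans N≤m m≤n)))
         (mulˡ 0≤2 (hx m n Nx≤m (ℕP.≤-trans Nx≤m m≤n)))
    where
    pos : ∀ n → N ℕ.≤ n → 0ℚ < x n
    pos n le = <-≤-trans 0<ε (subst (_≤ x n) (+-identityˡ ε) (h n le))

  min1 : ∀ ε → 0ℚ < ε → ∃[ ε′ ] 0ℚ < ε′ × ε′ ≤ ε × ε′ ≤ 1ℚ
  min1 ε 0<ε with ≤-total ε 1ℚ
  ... | inj₁ h = ε , 0<ε , ≤-refl , h
  ... | inj₂ h = 1ℚ , 0<1 , h , ≤-refl

  φ-bound : ∀ q C ε τ → 0ℚ < τ → 0ℚ < ε → ε ≤ q → q ≤ C → (C + 1ℚ) * τ ≤ ε → (C + 1ℚ) * τ ≤ 1ℚ → ∣ φ q ∣ ≤ 1ℚ - τ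
  φ-bound q C ε τ 0<τ 0<ε ε≤q q≤C h₁ h₂ = ∣∣≤ (cancelʳ 0<q′ upper) (cancelʳ 0<q′ lower)
    where
    open ≤-Reasoning
    0<q = <-≤-trans 0<ε ε≤q
    q′ = q + 1ℚ
    0<q′ = 0<q+1 0<q
    τq′≤ : q′ * τ ≤ (C + 1ℚ) * τ
    τq′≤ = mulʳ (<⇒≤ 0<τ) (+-monoˡ-≤ 1ℚ q≤C)
    upper : φ q * q′ ≤ (1ℚ - τ) * q′
    upper = begin
      φ q * q′          ≡⟨ φ-spec q 0<q ⟩
      q - 1ℚ            ≡⟨ solve 1 (λ q → q :- con 1ℚ := (q :+ con 1ℚ) :- con 2ℚ) refl q ⟩
      q′ - 2ℚ           ≤⟨ +-monoʳ-≤ q′ (neg-antimono-≤ (≤-trans τq′≤ (≤-trans h₂ (fromℕ-mono {1} {2} (s≤s z≤n))))) ⟩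
      q′ - q′ * τ       ≡⟨ solve 2 (λ q t → q :- q :* t := (con 1ℚ :- t) :* q) refl q′ τ ⟩
      (1ℚ - τ) * q′     ∎
    lower : - φ q * q′ ≤ (1ℚ - τ) * q′
    lower = begin
      - φ q * q′        ≡⟨ trans (sym (neg-distribˡ-* (φ q) q′)) (cong -_ (φ-spec q 0<q)) ⟩
      - (q - 1ℚ)        ≡⟨ solve 1 (λ q → :- (q :- con 1ℚ) := (q :+ con 1ℚ) :- (q :+ q)) refl q ⟩
      q′ - (q + q)      ≤⟨ +-monoʳ-≤ q′ (neg-antimono-≤ (≤-trans τq′≤ (≤-trans h₁ (≤-trans ε≤q (subst (_≤ q + q) (+-identityˡ q) (+-monoˡ-≤ q (<⇒≤ 0<q))))))) ⟩
      q′ - q′ * τ       ≡⟨ solve 2 (λ q t → q :- q :* t := (con 1ℚ :- t) :* q) refl q′ τ ⟩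
      (1ℚ - τ) * q′     ∎

  module Log (t : ℚ) (0≤t : 0ℚ ≤ t) (t<1 : t < 1ℚ) where

    open Geometric t 0≤t t<1 using (^≤1) renaming (^≥0 to t^≥0)

    ^-anti : ∀ i k → t ^ℚ (i ℕ.+ k) ≤ t ^ℚ i
    ^-anti zero    k = ^≤1 k
    ^-anti (suc i) k = mulˡ 0≤t (^-anti i k)

    lip : ∀ i p q → ∣ p ∣ ≤ t → ∣ q ∣ ≤ t → ∣ logTerm i p - logTerm i q ∣ ≤ 2ℚ * t ^ℚ i * ∣ p - q ∣
    lip i p q hp hq = begin
      ∣ c * P - c * Q ∣             ≡⟨ cong ∣_∣ (solve 3 (λ a p q → a :* p :- a :* q := a :* (p :- q)) refl c P Q) ⟩
      ∣ c * (P - Q) ∣               ≡⟨ trans (∣p*q∣≡∣p∣*∣q∣ c (P - Q)) (cong (_* ∣ P - Q ∣) (0≤p⇒∣p∣≡p 0≤c)) ⟩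
      c * ∣ P - Q ∣                 ≤⟨ mulˡ 0≤c (^-lipschitz t p q hp hq m) ⟩
      c * (N * t ^ℚ m * d)          ≡⟨ solve 4 (λ c N b d → c :* (N :* b :* d) := N :* c :* b :* d) refl c N (t ^ℚ m) d ⟩
      N * c * t ^ℚ m * d            ≡⟨ cong (λ z → z * t ^ℚ m * d) (n*[k/n]≡k 2 (suc m)) ⟩
      2ℚ * t ^ℚ m * d               ≤⟨ mulʳ (0≤∣p∣ (p - q)) (mulˡ 0≤2 (^-anti i (i ℕ.+ 0))) ⟩
      2ℚ * t ^ℚ i * d               ∎
      where
      open ≤-Reasoning
      m = 2 ℕ.* i
      c = + 2 / suc m
      0≤c = k/n≥0 2 (suc m)
      P = p ^ℚ suc m
      Q = q ^ℚ suc m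
      N = ℚfromℕ (suc m)
      d = ∣ p - q ∣

    logTerm-0 : ∀ i → logTerm i 0ℚ ≡ 0ℚ
    logTerm-0 i = trans (cong (c *_) (*-zeroˡ (0ℚ ^ℚ (2 ℕ.* i)))) (*-zeroʳ c)
      where c = + 2 / suc (2 ℕ.* i)

    bnd : ∀ i p → ∣ p ∣ ≤ t → ∣ logTerm i p ∣ ≤ 2ℚ * t ^ℚ i
    bnd i p h = begin
      ∣ logTerm i p ∣                   ≡⟨ cong ∣_∣ (trans (cong (λ z → logTerm i p - z) (logTerm-0 i)) (+-identityʳ (logTerm i p))) ⟨
      ∣ logTerm i p - logTerm i 0ℚ ∣    ≤⟨ lip i p 0ℚ h 0≤t ⟩
      2ℚ * t ^ℚ i * ∣ p - 0ℚ ∣          ≡⟨ cong (λ z → 2ℚ * t ^ℚ i * ∣ z ∣) (+-identityʳ p) ⟩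
      2ℚ * t ^ℚ i * ∣ p ∣               ≤⟨ mulˡ (0≤mul 0≤2 (t^≥0 i)) (≤-trans h (<⇒≤ t<1)) ⟩
      2ℚ * t ^ℚ i * 1ℚ                  ≡⟨ *-identityʳ (2ℚ * t ^ℚ i) ⟩
      2ℚ * t ^ℚ i                       ∎
      where open ≤-Reasoning

  log-cauchy : ∀ x → IsCauchy x → ∀ ε → 0ℚ < ε → ∀ N → (∀ n → N ℕ.≤ n → 0ℚ + ε ≤ x n) →
    IsCauchy (λ n → ∑ n (λ i → logTerm i (φ (x n))))
  log-cauchy x cx ε 0<ε N h =
    Geometric.diagonal t 0≤t t<1 logTerm (λ n → φ (x n)) (φ-cauchy x cx ε 0<ε N h) 2ℚ t 0≤2 (N′ , φ≤t) (Log.bnd t 0≤t t<1) (Log.lip t 0≤t t<1)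
    where
    C = ℚfromℕ (suc (proj₁ (bounded x cx)))
    Nb = proj₁ (proj₂ (bounded x cx))
    hb = proj₂ (proj₂ (bounded x cx))
    m = min1 ε 0<ε
    sh = shrink (C + 1ℚ) (proj₁ (proj₂ m))
    τ = proj₁ sh
    0<τ = proj₁ (proj₂ sh)
    t = 1ℚ - τ
    N′ = N ℕ.⊔ Nb
    φ≤t : ∀ n → N′ ℕ.≤ n → ∣ φ (x n) ∣ ≤ t
    φ≤t n le = φ-bound (x n) C ε τ 0<τ 0<ε (subst (_≤ x n) (+-identityˡ ε) (h n (ℕP.≤-trans (ℕP.m≤m⊔n N Nb) le)))
      (≤-trans (p≤∣p∣ (x n)) (hb n (ℕP.≤-trans (ℕP.m≤n⊔m N Nb) le)))
      (≤-trans (proj₂ (proj₂ sh)) (proj₁ (proj₂ (proj₂ m)))) (≤-trans (proj₂ (proj₂ sh)) (proj₂ (proj₂ (proj₂ m))))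
    0≤t : 0ℚ ≤ t
    0≤t = ≤-trans (0≤∣p∣ (φ (x N′))) (φ≤t N′ ℕP.≤-refl)
    t<1 : t < 1ℚ
    t<1 = subst (t <_) (+-identityʳ 1ℚ) (+-monoʳ-< 1ℚ (neg-antimono-< 0<τ))

open LogLemmas

-- log x = 2 artanh u = ∑ᵢ 2 u²ⁱ⁺¹ / (2i + 1) with u = (x - 1) / (x + 1), which
-- converges for every x > 0.
log : (x : ℝ) → fromℕ 0 <ᴿ x → ℝ
log x (ε , 0<ε , N , h) = mkℝ (λ n → ∑ n (λ i → logTerm i (φ (seq x n)))) (log-cauchy (seq x) (cauchy x) ε 0<ε N h)

1<⇒0< : ∀ {x} → fromℕ 1 <ᴿ x → fromℕ 0 <ᴿ x
1<⇒0< (ε , 0<ε , N , h) = ε , 0<ε , N , λ n le → ≤-trans (+-monoˡ-≤ ε 0≤1) (h n le)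

module SumLemmas where

  first≤∑ : ∀ g → (∀ i → 0ℚ ≤ g i) → ∀ n → 0 ℕ.< n → g 0 ≤ ∑ n g
  first≤∑ g h (suc zero)    _ = ≤-reflexive (sym (+-identityˡ (g 0)))
  first≤∑ g h (suc (suc n)) _ = subst (_≤ ∑ (suc (suc n)) g) (+-identityʳ (g 0)) (+-mono-≤ (first≤∑ g h (suc n) (s≤s z≤n)) (h (suc n)))

open SumLemmas

log-pos : ∀ {x} (1<x : fromℕ 1 <ᴿ x) → fromℕ 0 <ᴿ log x (1<⇒0< {x} 1<x)
log-pos {x} (ε , 0<ε , N , h) = δ , 0<δ , N′ , λ n le → subst (_≤ ∑ n (λ i → logTerm i (φ (seq x n)))) (sym (+-identityˡ δ)) (positive-sum n le)
  where
  open ≤-Reasoning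
  bd = bounded (seq x) (cauchy x)
  C = ℚfromℕ (suc (proj₁ bd))
  sh = shrink (C + 1ℚ) 0<ε
  δ = proj₁ sh
  0<δ = proj₁ (proj₂ sh)
  N′ = suc (N ℕ.⊔ proj₁ (proj₂ bd))
  δ≤φ : ∀ q → 1ℚ + ε ≤ q → q ≤ C → δ ≤ φ q
  δ≤φ q l u = cancelʳ (0<q+1 0<q) (begin
    δ * (q + 1ℚ)      ≤⟨ mulˡ (<⇒≤ 0<δ) (+-monoˡ-≤ 1ℚ u) ⟩
    δ * (C + 1ℚ)      ≡⟨ *-comm δ (C + 1ℚ) ⟩
    (C + 1ℚ) * δ      ≤⟨ proj₂ (proj₂ sh) ⟩
    ε                 ≤⟨ sub-mono (subst (_≤ q) (+-comm 1ℚ ε) l) ⟩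
    q - 1ℚ            ≡⟨ φ-spec q 0<q ⟨
    φ q * (q + 1ℚ)    ∎)
    where
    0<q : 0ℚ < q
    0<q = <-≤-trans (+-mono-< 0<1 0<ε) l
  positive-sum : ∀ n → N′ ℕ.≤ n → δ ≤ ∑ n (λ i → logTerm i (φ (seq x n)))
  positive-sum n le = begin
    δ                 ≤⟨ δ≤u ⟩
    u                 ≡⟨ trans (*-identityˡ (u * 1ℚ)) (*-identityʳ u) ⟨
    1ℚ * (u * 1ℚ)     ≤⟨ mulʳ (0≤mul 0≤u 0≤1) (fromℕ-mono {1} {2} (s≤s z≤n)) ⟩
    logTerm 0 u       ≤⟨ first≤∑ (λ i → logTerm i u) (λ i → 0≤mul (k/n≥0 2 (suc (2 ℕ.* i))) (^≥0 0≤u (suc (2 ℕ.* i)))) n (ℕP.≤-trans (s≤s z≤n) le) ⟩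
    ∑ n (λ i → logTerm i u) ∎
    where
    u = φ (seq x n)
    δ≤u = δ≤φ (seq x n) (h n (ℕP.≤-trans (ℕP.m≤m⊔n N (proj₁ (proj₂ bd))) (ℕP.≤-trans (ℕP.n≤1+n _) le)))
      (≤-trans (p≤∣p∣ (seq x n)) (proj₂ (proj₂ bd) n (ℕP.≤-trans (ℕP.m≤n⊔m N (proj₁ (proj₂ bd))) (ℕP.≤-trans (ℕP.n≤1+n _) le))))
    0≤u = ≤-trans (<⇒≤ 0<δ) δ≤u

pow : (x : ℝ) → fromℕ 0 <ᴿ x → ℝ → ℝ
pow x 0<x a = exp (a *ᴿ log x 0<x)

1<fromℕ : ∀ n → 2 ℕ.≤ n → fromℕ 1 <ᴿ fromℕ n
1<fromℕ n 2≤n = 1ℚ , 0<1 , 0 , λ _ _ → fromℕ-mono 2≤n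

-- (log n)ᵃ; n ≥ 2 makes log n > 0.
log-pow : (n : ℕ) → 2 ℕ.≤ n → ℝ → ℝ
log-pow n 2≤n a = pow (log (fromℕ n) (1<⇒0< {fromℕ n} 1<n)) (log-pos {fromℕ n} 1<n) a
  where
  1<n : fromℕ 1 <ᴿ fromℕ n
  1<n = 1<fromℕ n 2≤n

-- The vertex set is a subset of Fin n, so that a graph and its subgraphs
-- (on fewer vertices) live on the same labels.
record Graph (n : ℕ) : Set₁ where
  field
    vertices : Subset n
    Adj      : Rel (Fin n) 0ℓ
    adj?     : Decidable Adj
    symm     : Symmetric Adj
    irrefl   : Irreflexive _≡_ Adj
    incident : ∀ {u v} → Adj u v → u ∈ vertices

open Graph public

infix 4 _⊆ᴳ_

_⊆ᴳ_ : ∀ {n} → Graph n → Graph n → Set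
H ⊆ᴳ G = (vertices H ⊆ vertices G) × (∀ {u v} → Adj H u v → Adj G u v)

-- Each edge {u, v} is counted once, as the pair with u < v.
e : ∀ {n} → Graph n → ℕ
e {n} G = length (filter (λ (u , v) → (u <ᶠ? v) ×-dec adj? G u v) (cartesianProduct (allFin n) (allFin n)))

Colourable : ∀ {n} → Graph n → ℕ → Set
Colourable {n} G k = Σ (Fin n → ℕ) λ c →
  (∀ v → v ∈ vertices G → c v ℕ.< k) × (∀ {u v} → Adj G u v → c u ≢ c v)

-- HasCycle G (m + 1): there are distinct c 0, …, c m (m ≥ 2) with
-- c i ~ c (i + 1) and c m ~ c 0.
HasCycle : ∀ {n} → Graph n → ℕ → Set
HasCycle     G zero    = ⊥
HasCycle {n} G (suc m) = 2 ℕ.≤ m × (Σ (Fin (suc m) → Fin n) λ c → Injective _≡_ _≡_ c ×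
  (∀ (i : Fin m) → Adj G (c (inject₁ i)) (c (fsuc i))) × Adj G (c (last m)) (c fzero))

module GraphDecidability where

  anyFun? : ∀ {m n} {P : (Fin m → Fin n) → Set} → U.Decidable P → (∀ {f g} → f ≗ g → P f → P g) → Dec (∃ P)
  anyFun? P? resp = map′ (λ (i , p) → finToFun i , p)
    (λ (f , p) → funToFin f , resp (λ x → sym (finToFun-funToFin f x)) p) (any? (P? ∘ finToFun))

  hasCycle? : ∀ {n} (G : Graph n) → U.Decidable (HasCycle G)
  hasCycle? G zero    = no λ ()
  hasCycle? G (suc m) = (2 ℕP.≤? m) ×-dec anyFun?
    (λ c → map′ (λ h {x} {y} → h x y) (λ h x y → h {x} {y}) (all? λ x → all? λ y → (c x ≟ᶠ c y) →-dec (x ≟ᶠ y))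
      ×-dec (all? λ i → adj? G (c (inject₁ i)) (c (fsuc i))) ×-dec adj? G (c (last m)) (c fzero))
    (λ f≗g (inj , path , close) →
      (λ {x} {y} eq → inj (trans (f≗g x) (trans eq (sym (f≗g y))))) ,
      (λ i → subst₂ (Adj G) (f≗g _) (f≗g _) (path i)) , subst₂ (Adj G) (f≗g _) (f≗g _) close)

  colourable? : ∀ {n} (G : Graph n) → U.Decidable (Colourable G)
  colourable? {n} G k = map′ to from (anyFun? {P = P}
      (λ f → (all? λ v → (v ∈? vertices G) →-dec (toℕ (f v) ℕP.<? k)) ×-dec
             (all? λ u → all? λ v → adj? G u v →-dec ¬? (toℕ (f u) ℕP.≟ toℕ (f v))))
      (λ f≗g (b , p) → (λ v h → subst (ℕ._< k) (cong toℕ (f≗g v)) (b v h)) ,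
        (λ u v h → subst₂ (λ x y → toℕ x ≢ toℕ y) (f≗g u) (f≗g v) (p u v h))))
    where
    P : (Fin n → Fin (suc k)) → Set
    P f = (∀ v → v ∈ vertices G → toℕ (f v) ℕ.< k) × (∀ u v → Adj G u v → toℕ (f u) ≢ toℕ (f v))
    to : ∃ P → Colourable G k
    to (f , b , p) = toℕ ∘ f , b , λ {u} {v} → p u v
    from : Colourable G k → ∃ P
    from (c , b , p) = f ,
      (λ v h → subst (ℕ._< k) (sym (f≡c v h)) (b v h)) ,
      (λ u v h → subst₂ _≢_ (sym (f≡c u (incident G h))) (sym (f≡c v (incident G (symm G h)))) (p h))
      where
      f : Fin n → Fin (suc k)
      f v = fromℕ< (s≤s (ℕP.m⊓n≤n (c v) k))
      f≡c : ∀ v → v ∈ vertices G → toℕ (f v) ≡ c v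
      f≡c v h = trans (toℕ-fromℕ< _) (ℕP.m≤n⇒m⊓n≡m (ℕP.<⇒≤ (b v h)))

  n-colourable : ∀ {n} (G : Graph n) → Colourable G n
  n-colourable G = toℕ , (λ v _ → toℕ<n v) , λ h eq → irrefl G (toℕ-injective eq) h

  cycle≤n : ∀ {n} (G : Graph n) ℓ → HasCycle G ℓ → ℓ ℕ.≤ n
  cycle≤n G (suc m) (_ , _ , inj , _) = injective⇒≤ inj

  hasSomeCycle? : ∀ {n} (G : Graph n) → Dec (∃ (HasCycle G))
  hasSomeCycle? {n} G = map′ (λ (ℓ , _ , c) → ℓ , c) (λ (ℓ , c) → ℓ , s≤s (cycle≤n G ℓ c) , c)
    (ℕP.anyUpTo? (hasCycle? G) (suc n))

open GraphDecidability

least : ∀ {P : ℕ → Set} → U.Decidable P → ∀ n → P n → ∃[ m ] P m × (∀ j → P j → m ℕ.≤ j)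
least P? zero    p = zero , p , λ _ _ → z≤n
least P? (suc n) p with P? zero
... | yes p₀ = zero , p₀ , λ _ _ → z≤n
... | no ¬p₀ with least (P? ∘ suc) n p
... | m , pm , min = suc m , pm , λ where
  zero    p₀ → contradiction p₀ ¬p₀
  (suc j) pj → s≤s (min j pj)

χ : ∀ {n} → Graph n → ℕ
χ {n} G = proj₁ (least (colourable? G) n (n-colourable G))

girth : ∀ {n} → Graph n → ℕ ⁺
girth G with hasSomeCycle? G
... | yes (ℓ , c) = [ proj₁ (least (hasCycle? G) ℓ c) ]
... | no  _       = ⊤⁺

{-# OPTIONS --safe #-}
module Submission where

-- Let N be the number of non-isolated vertices, so N ≤ 2e(G), and put K = 2^w with w = t⁴,
-- where χ(G) ≈ 2^(Rt⁴) and R = 3r + 4. Bounding (log χ)^(3/2) by a multiple of t⁷, the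
-- hypothesis gives N ≤ 2^(Ct⁷).
--
-- Let A be a vertex set of maximum degree at most Δ′K in which every subset of size |A|/k
-- spans average degree at least Δ′/2. Add edges of G[A] to an initially empty graph, one at
-- a time, never joining vertices at distance ≤ r and never exceeding a degree cap polynomial in
-- K. While Δ′ is a larger power of K, few edges are forbidden, so by averaging some
-- allowed edge lies in at least a fraction 1/Q, Q = 8kK, of those sets of size at least |A|/k that
-- still span no chosen edge. There are at most 2^|A| such sets, so after Q(|A| + 1) steps none is
-- left: no set of size |A|/k is independent in the new graph, which has girth greater than r and
-- chromatic number at least k.
--
-- If A is not of this kind, then it contains a set of size at least |A|/2k and of maximum degree at
-- most Δ′. Remove it and repeat: O(k log N) such pieces exhaust A, so one of them keeps
-- chromatic number at least χ(A)/O(k log N), while the degree dropped by a factor K. There are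
-- at most log N / log K = Ct³ rounds, which together cost a factor t^O(t³) = 2^o(w), so the
-- chromatic number stays above the final degree bound, which is absurd.

-- The edge hypothesis turned into a bound on natural numbers.

module Estimates where

  open import Algebra using (CommutativeRing)
  open import Data.Integer using (+_)
  open import Data.Nat as ℕ using (ℕ; zero; suc; z≤n; s≤s)
  import Data.Nat.Properties as ℕP
  open import Data.Product using (∃-syntax; _×_; _,_; proj₁; proj₂)
  open import Data.Rational using (ℚ; 0ℚ; 1ℚ; _+_; _*_; _-_; -_; _/_; ½; _≤_; _<_)
  open import Data.Rational.Properties
  open import Data.Rational.Solver using (module +-*-Solver)
  open import Relation.Binary.PropositionalEquality
  open import Relation.Nullary using (yes; no)
  open import Relation.Nullary.Decidable using (from-yes)
  open import Defs
  open RationalLemmas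
  open GeometricLemmas using (^≥0; ^-mono)
  open ExpLemmas using (inv!≥0; module Exp)
  open SumLemmas using (first≤∑)
  open LogLemmas using (φ-spec; 0<q+1)
  open +-*-Solver using (solve; _:+_; _:*_; _:-_; :-_; _:=_; con)
  open import Algebra.Properties.CommutativeSemiring.Exp (CommutativeRing.commutativeSemiring +-*-commutativeRing) using (^-assocʳ; ^-distrib-*)
  open ≤-Reasoning

  ∑-mono-ℚ : ∀ n {f g : ℕ → ℚ} → (∀ i → f i ≤ g i) → ∑ n f ≤ ∑ n g
  ∑-mono-ℚ zero    h = ≤-refl
  ∑-mono-ℚ (suc n) h = +-mono-≤ (∑-mono-ℚ n h) (h n)

  ∑-+ℚ : ∀ n (f g : ℕ → ℚ) → ∑ n (λ i → f i + g i) ≡ ∑ n f + ∑ n g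
  ∑-+ℚ zero    f g = refl
  ∑-+ℚ (suc n) f g = trans (cong (_+ (f n + g n)) (∑-+ℚ n f g))
    (solve 4 (λ a b c d → a :+ b :+ (c :+ d) := a :+ c :+ (b :+ d)) refl (∑ n f) (∑ n g) (f n) (g n))

  ∑-*ˡℚ : ∀ n c (f : ℕ → ℚ) → ∑ n (λ i → c * f i) ≡ c * ∑ n f
  ∑-*ˡℚ zero    c f = sym (*-zeroʳ c)
  ∑-*ˡℚ (suc n) c f = trans (cong (_+ c * f n) (∑-*ˡℚ n c f)) (sym (*-distribˡ-+ c (∑ n f) (f n)))

  p≤p+q : ∀ {p q} → 0ℚ ≤ q → p ≤ p + q
  p≤p+q {p} {q} h = subst (_≤ p + q) (+-identityʳ p) (+-monoʳ-≤ p h)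

  ^≥1 : ∀ {p} → 1ℚ ≤ p → ∀ n → 1ℚ ≤ p ^ℚ n
  ^≥1 1≤p zero        = ≤-refl
  ^≥1 {p} 1≤p (suc n) = ≤-trans 1≤p (subst (_≤ p * p ^ℚ n) (*-identityʳ p) (mulˡ (≤-trans 0≤1 1≤p) (^≥1 1≤p n)))

  -- The mean value inequality for powers, with the derivative taken at the larger end. It is the
  -- termwise input for both `expSum-step` and `logSum-step`.
  ^-step : ∀ {u d} → 0ℚ ≤ u → 0ℚ ≤ d → ∀ n → (u + d) ^ℚ suc n ≤ u ^ℚ suc n + ℚfromℕ (suc n) * (u + d) ^ℚ n * d
  ^-step {u} {d} 0≤u 0≤d zero = ≤-reflexive (solve 2 (λ u d → (u :+ d) :* con 1ℚ := u :* con 1ℚ :+ con 1ℚ :* con 1ℚ :* d) refl u d)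
  ^-step {u} {d} 0≤u 0≤d (suc n) = begin
    w * w ^ℚ suc n                                        ≡⟨ *-distribʳ-+ (w ^ℚ suc n) u d ⟩
    u * w ^ℚ suc n + d * w ^ℚ suc n                       ≤⟨ +-monoˡ-≤ (d * w ^ℚ suc n) (mulˡ 0≤u (^-step 0≤u 0≤d n)) ⟩
    u * (u ^ℚ suc n + N * w ^ℚ n * d) + d * w ^ℚ suc n    ≡⟨ solve 5 (λ u d U N x → u :* (U :+ N :* x :* d) :+ d :* ((u :+ d) :* x) := (u :* U :+ d :* ((u :+ d) :* x)) :+ u :* (N :* x :* d)) refl u d (u ^ℚ suc n) N (w ^ℚ n) ⟩
    (u ^ℚ suc (suc n) + d * w ^ℚ suc n) + u * (N * w ^ℚ n * d) ≤⟨ +-monoʳ-≤ (u ^ℚ suc (suc n) + d * w ^ℚ suc n) (mulʳ (0≤mul (0≤mul (fromℕ-≥0 (suc n)) (^≥0 0≤w n)) 0≤d) (p≤p+q {u} 0≤d)) ⟩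
    (u ^ℚ suc (suc n) + d * w ^ℚ suc n) + w * (N * w ^ℚ n * d) ≡⟨ solve 5 (λ u d U N x → (u :* U :+ d :* ((u :+ d) :* x)) :+ (u :+ d) :* (N :* x :* d) := u :* U :+ (con 1ℚ :+ N) :* ((u :+ d) :* x) :* d) refl u d (u ^ℚ suc n) N (w ^ℚ n) ⟩
    u ^ℚ suc (suc n) + (1ℚ + N) * w ^ℚ suc n * d          ≡⟨ cong (λ M → u ^ℚ suc (suc n) + M * w ^ℚ suc n * d) (fromℕ-suc (suc n)) ⟨
    u ^ℚ suc (suc n) + ℚfromℕ (suc (suc n)) * w ^ℚ suc n * d ∎
    where
    w = u + d
    N = ℚfromℕ (suc n)
    0≤w = 0≤add 0≤u 0≤d

  -- The entries of `exp` and `log` are such truncated series, so all analytic bounds are proved at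
  -- a fixed truncation `n`.
  expSum logSum : ℕ → ℚ → ℚ
  expSum n x = ∑ n (λ j → expTerm j x)
  logSum n u = ∑ n (λ i → logTerm i u)

  expTerm≥0 : ∀ {x} → 0ℚ ≤ x → ∀ j → 0ℚ ≤ expTerm j x
  expTerm≥0 0≤x j = 0≤mul (inv!≥0 j) (^≥0 0≤x j)

  ∑≥0 : ∀ n {f : ℕ → ℚ} → (∀ i → 0ℚ ≤ f i) → 0ℚ ≤ ∑ n f
  ∑≥0 zero    h = ≤-refl
  ∑≥0 (suc n) h = 0≤add (∑≥0 n h) (h n)

  expSum-mono : ∀ n {x y} → 0ℚ ≤ x → x ≤ y → expSum n x ≤ expSum n y
  expSum-mono n 0≤x x≤y = ∑-mono-ℚ n λ j → mulˡ (inv!≥0 j) (^-mono 0≤x x≤y j)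

  -- A discrete form of (eˣ)′ ≤ eˣ.
  expSum-step : ∀ n {x δ} → 0ℚ ≤ x → 0ℚ ≤ δ → expSum n (x + δ) ≤ expSum n x + δ * expSum n (x + δ)
  expSum-step zero {x} {δ} 0≤x 0≤δ = ≤-reflexive (solve 1 (λ d → con 0ℚ := con 0ℚ :+ d :* con 0ℚ) refl δ)
  expSum-step (suc n) {x} {δ} 0≤x 0≤δ = begin
    expSum (suc n) w                             ≤⟨ shifted n ⟩
    expSum (suc n) x + δ * expSum n w            ≤⟨ +-monoʳ-≤ (expSum (suc n) x) (mulˡ 0≤δ (p≤p+q (expTerm≥0 0≤w n))) ⟩
    expSum (suc n) x + δ * expSum (suc n) w      ∎
    where
    w = x + δ
    0≤w = 0≤add 0≤x 0≤δ
    term : ∀ j → expTerm (suc j) w ≤ expTerm (suc j) x + δ * expTerm j w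
    term j = begin
      v * w ^ℚ suc j                                   ≤⟨ mulˡ (inv!≥0 (suc j)) (^-step 0≤x 0≤δ j) ⟩
      v * (x ^ℚ suc j + N * w ^ℚ j * δ)                ≡⟨ solve 5 (λ v X N W d → v :* (X :+ N :* W :* d) := v :* X :+ d :* ((v :* N) :* W)) refl v (x ^ℚ suc j) N (w ^ℚ j) δ ⟩
      v * x ^ℚ suc j + δ * (v * N * w ^ℚ j)            ≡⟨ cong (λ z → v * x ^ℚ suc j + δ * (z * w ^ℚ j)) (Exp.1/[1+j]! 0 j) ⟩
      v * x ^ℚ suc j + δ * (inv! j * w ^ℚ j)           ∎
      where
      v = inv! (suc j)
      N = ℚfromℕ (suc j)
    -- Differentiation lowers the index: term `suc j` is paid for by δ times term `j` at w, so the
    -- correction is one term shorter than the sum.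
    shifted : ∀ n → expSum (suc n) w ≤ expSum (suc n) x + δ * expSum n w
    shifted zero = ≤-reflexive (solve 2 (λ c d → con 0ℚ :+ c :* con 1ℚ := (con 0ℚ :+ c :* con 1ℚ) :+ d :* con 0ℚ) refl (inv! 0) δ)
    shifted (suc n) = begin
      expSum (suc n) w + expTerm (suc n) w                                     ≤⟨ +-mono-≤ (shifted n) (term n) ⟩
      expSum (suc n) x + δ * expSum n w + (expTerm (suc n) x + δ * expTerm n w) ≡⟨ solve 5 (λ a d b c e → a :+ d :* b :+ (c :+ d :* e) := a :+ c :+ d :* (b :+ e)) refl (expSum (suc n) x) δ (expSum n w) (expTerm (suc n) x) (expTerm n w) ⟩
      expSum (suc (suc n)) x + δ * expSum (suc n) w                            ∎

  0^ : ∀ j → 0ℚ ^ℚ suc j ≡ 0ℚ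
  0^ j = *-zeroˡ (0ℚ ^ℚ j)

  expSum-0 : ∀ n → expSum n 0ℚ ≤ 1ℚ
  expSum-0 zero          = 0≤1
  expSum-0 (suc zero)    = ≤-refl
  expSum-0 (suc (suc n)) = begin
    expSum (suc n) 0ℚ + expTerm (suc n) 0ℚ ≡⟨ cong (λ z → expSum (suc n) 0ℚ + inv! (suc n) * z) (0^ n) ⟩
    expSum (suc n) 0ℚ + inv! (suc n) * 0ℚ  ≡⟨ trans (cong (λ z → expSum (suc n) 0ℚ + z) (*-zeroʳ (inv! (suc n)))) (+-identityʳ (expSum (suc n) 0ℚ)) ⟩
    expSum (suc n) 0ℚ                      ≤⟨ expSum-0 (suc n) ⟩
    1ℚ                                     ∎

  -- With δ = 1 / (1 + g) this is exp (m / (1 + g)) ≤ ((1 + g) / g)ᵐ, cleared of denominators.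
  expSum-≤ : ∀ g δ → ℚfromℕ (suc g) * δ ≡ 1ℚ → 0ℚ ≤ δ → ∀ n m →
    ℚfromℕ (g ℕ.^ m) * expSum n (ℚfromℕ m * δ) ≤ ℚfromℕ (suc g ℕ.^ m)
  expSum-≤ g δ gδ 0≤δ n zero = begin
    1ℚ * expSum n (0ℚ * δ)   ≡⟨ trans (*-identityˡ _) (cong (expSum n) (*-zeroˡ δ)) ⟩
    expSum n 0ℚ              ≤⟨ expSum-0 n ⟩
    1ℚ                       ∎
  expSum-≤ g δ gδ 0≤δ n (suc m) = begin
    ℚfromℕ (g ℕ.^ suc m) * expSum n (ℚfromℕ (suc m) * δ)
      ≡⟨ cong₂ _*_ (fromℕ-* g (g ℕ.^ m)) (cong (expSum n) (trans (cong (_* δ) (fromℕ-suc m)) (solve 2 (λ m d → (con 1ℚ :+ m) :* d := m :* d :+ d) refl (ℚfromℕ m) δ))) ⟩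
    ℚfromℕ g * gᵐ * E′                   ≡⟨ solve 3 (λ g p e → g :* p :* e := p :* (g :* e)) refl (ℚfromℕ g) gᵐ E′ ⟩
    gᵐ * (ℚfromℕ g * E′)                 ≤⟨ mulˡ (fromℕ-≥0 (g ℕ.^ m)) one-step ⟩
    gᵐ * (ℚfromℕ (suc g) * E)            ≡⟨ solve 3 (λ p g e → p :* (g :* e) := g :* (p :* e)) refl gᵐ (ℚfromℕ (suc g)) E ⟩
    ℚfromℕ (suc g) * (gᵐ * E)            ≤⟨ mulˡ (fromℕ-≥0 (suc g)) (expSum-≤ g δ gδ 0≤δ n m) ⟩
    ℚfromℕ (suc g) * ℚfromℕ (suc g ℕ.^ m) ≡⟨ fromℕ-* (suc g) (suc g ℕ.^ m) ⟨
    ℚfromℕ (suc g ℕ.^ suc m)             ∎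
    where
    gᵐ = ℚfromℕ (g ℕ.^ m)
    x  = ℚfromℕ m * δ
    E  = expSum n x
    E′ = expSum n (x + δ)
    -- Multiplying E′ ≤ E + δ E′ by 1 + g turns δ into 1, after which one copy of E′ cancels.
    one-step : ℚfromℕ g * E′ ≤ ℚfromℕ (suc g) * E
    one-step = +-cancelˡ-≤ℚ E′ (begin
      E′ + ℚfromℕ g * E′                     ≡⟨ solve 2 (λ g e → e :+ g :* e := (con 1ℚ :+ g) :* e) refl (ℚfromℕ g) E′ ⟩
      (1ℚ + ℚfromℕ g) * E′                   ≡⟨ cong (_* E′) (fromℕ-suc g) ⟨
      ℚfromℕ (suc g) * E′                    ≤⟨ mulˡ (fromℕ-≥0 (suc g)) (expSum-step n (0≤mul (fromℕ-≥0 m) 0≤δ) 0≤δ) ⟩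
      ℚfromℕ (suc g) * (E + δ * E′)          ≡⟨ solve 4 (λ g e d f → g :* (e :+ d :* f) := (g :* d) :* f :+ g :* e) refl (ℚfromℕ (suc g)) E δ E′ ⟩
      ℚfromℕ (suc g) * δ * E′ + ℚfromℕ (suc g) * E ≡⟨ cong (_+ ℚfromℕ (suc g) * E) (trans (cong (_* E′) gδ) (*-identityˡ E′)) ⟩
      E′ + ℚfromℕ (suc g) * E                ∎)
      where
      +-cancelˡ-≤ℚ : ∀ r {p q} → r + p ≤ r + q → p ≤ q
      +-cancelˡ-≤ℚ r {p} {q} h = subst₂ _≤_ (lemma r p) (lemma r q) (+-monoʳ-≤ (- r) h)
        where
        lemma : ∀ r p → - r + (r + p) ≡ p
        lemma = solve 2 (λ r p → :- r :+ (r :+ p) := p) refl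

  φ≥0 : ∀ {y} → 1ℚ ≤ y → 0ℚ ≤ φ y
  φ≥0 {y} 1≤y = cancelʳ (0<q+1 0<y) (begin
    0ℚ * (y + 1ℚ)       ≡⟨ *-zeroˡ (y + 1ℚ) ⟩
    0ℚ                  ≡⟨ +-inverseʳ 1ℚ ⟨
    1ℚ - 1ℚ             ≤⟨ +-monoˡ-≤ (- 1ℚ) 1≤y ⟩
    y - 1ℚ              ≡⟨ φ-spec y 0<y ⟨
    φ y * (y + 1ℚ)      ∎)
    where
    0<y : 0ℚ < y
    0<y = <-≤-trans 0<1 1≤y

  φ-mono : ∀ {p q} → 0ℚ < p → p ≤ q → φ p ≤ φ q
  φ-mono {p} {q} 0<p p≤q = cancelʳ (0<mul (0<q+1 0<p) (0<q+1 0<q)) (begin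
    φ p * ((p + 1ℚ) * (q + 1ℚ))     ≡⟨ *-assoc (φ p) (p + 1ℚ) (q + 1ℚ) ⟨
    φ p * (p + 1ℚ) * (q + 1ℚ)       ≡⟨ cong (_* (q + 1ℚ)) (φ-spec p 0<p) ⟩
    (p - 1ℚ) * (q + 1ℚ)             ≡⟨ solve 2 (λ p q → (p :- con 1ℚ) :* (q :+ con 1ℚ) := (p :* q :- con 1ℚ) :+ (p :- q)) refl p q ⟩
    (p * q - 1ℚ) + (p - q)          ≤⟨ +-monoʳ-≤ (p * q - 1ℚ) (+-mono-≤ p≤q (neg-antimono-≤ p≤q)) ⟩
    (p * q - 1ℚ) + (q - p)          ≡⟨ solve 2 (λ p q → (p :* q :- con 1ℚ) :+ (q :- p) := (q :- con 1ℚ) :* (p :+ con 1ℚ)) refl p q ⟩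
    (q - 1ℚ) * (p + 1ℚ)             ≡⟨ cong (_* (p + 1ℚ)) (φ-spec q 0<q) ⟨
    φ q * (q + 1ℚ) * (p + 1ℚ)       ≡⟨ solve 3 (λ f p q → f :* q :* p := f :* (p :* q)) refl (φ q) (p + 1ℚ) (q + 1ℚ) ⟩
    φ q * ((p + 1ℚ) * (q + 1ℚ))     ∎)
    where
    0<q : 0ℚ < q
    0<q = <-≤-trans 0<p p≤q

  logSum-mono : ∀ n {u v} → 0ℚ ≤ u → u ≤ v → logSum n u ≤ logSum n v
  logSum-mono n 0≤u u≤v = ∑-mono-ℚ n λ i → mulˡ (k/n≥0 2 (suc (2 ℕ.* i))) (^-mono 0≤u u≤v (suc (2 ℕ.* i)))

  logSum≥0 : ∀ n {u} → 0ℚ ≤ u → 0ℚ ≤ logSum n u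
  logSum≥0 n 0≤u = ∑≥0 n λ i → 0≤mul (k/n≥0 2 (suc (2 ℕ.* i))) (^≥0 0≤u (suc (2 ℕ.* i)))

  logSum-0 : ∀ n → logSum n 0ℚ ≡ 0ℚ
  logSum-0 zero    = refl
  logSum-0 (suc n) = trans (cong₂ _+_ (logSum-0 n) (trans (cong (c *_) (0^ (2 ℕ.* n))) (*-zeroʳ c))) (+-identityˡ 0ℚ)
    where c = + 2 / suc (2 ℕ.* n)

  geometric : ℕ → ℚ → ℚ
  geometric n t = ∑ n (λ i → t ^ℚ i)

  geometric-sum : ∀ n t → geometric n t + t ^ℚ n ≡ 1ℚ + t * geometric n t
  geometric-sum zero    t = solve 1 (λ t → con 0ℚ :+ con 1ℚ := con 1ℚ :+ t :* con 0ℚ) refl t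
  geometric-sum (suc n) t = trans (cong (_+ t * t ^ℚ n) (geometric-sum n t))
    (solve 3 (λ t g p → con 1ℚ :+ t :* g :+ t :* p := con 1ℚ :+ t :* (g :+ p)) refl t (geometric n t) (t ^ℚ n))

  -- The coefficient 2 / (2i + 1) cancels the factor 2i + 1 produced by `^-step`, so the derivative
  -- is twice a geometric series in the square of the larger end.
  logSum-step : ∀ n {u d} → 0ℚ ≤ u → 0ℚ ≤ d →
    logSum n (u + d) ≤ logSum n u + 2ℚ * d * geometric n ((u + d) ^ℚ 2)
  logSum-step n {u} {d} 0≤u 0≤d = begin
    logSum n w                                                   ≤⟨ ∑-mono-ℚ n term ⟩
    ∑ n (λ i → logTerm i u + 2ℚ * d * (w ^ℚ 2) ^ℚ i)             ≡⟨ ∑-+ℚ n _ _ ⟩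
    logSum n u + ∑ n (λ i → 2ℚ * d * (w ^ℚ 2) ^ℚ i)              ≡⟨ cong (λ z → logSum n u + z) (∑-*ˡℚ n (2ℚ * d) _) ⟩
    logSum n u + 2ℚ * d * geometric n (w ^ℚ 2)                   ∎
    where
    w = u + d
    term : ∀ i → logTerm i w ≤ logTerm i u + 2ℚ * d * (w ^ℚ 2) ^ℚ i
    term i = begin
      c * w ^ℚ suc m                               ≤⟨ mulˡ (k/n≥0 2 (suc m)) (^-step 0≤u 0≤d m) ⟩
      c * (u ^ℚ suc m + N * w ^ℚ m * d)            ≡⟨ solve 5 (λ c U N W d → c :* (U :+ N :* W :* d) := c :* U :+ (N :* c) :* d :* W) refl c (u ^ℚ suc m) N (w ^ℚ m) d ⟩
      c * u ^ℚ suc m + N * c * d * w ^ℚ m          ≡⟨ cong₂ (λ a b → c * u ^ℚ suc m + a * d * b) (n*[k/n]≡k 2 (suc m)) (sym (^-assocʳ w 2 i)) ⟩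
      c * u ^ℚ suc m + 2ℚ * d * (w ^ℚ 2) ^ℚ i      ∎
      where
      m = 2 ℕ.* i
      c = + 2 / suc m
      N = ℚfromℕ (suc m)

  -- log (y (1 + 1 / h)) ≤ log y + 1 / h: the mean value theorem in the variable φ y,
  -- where the derivative of the series is at most 2 / (1 - φ²).
  logSum-ratio : ∀ n h {y y′} → 1ℚ ≤ y → ℚfromℕ h * y′ ≡ ℚfromℕ (suc h) * y → y ≤ y′ →
    ℚfromℕ h * logSum n (φ y′) ≤ ℚfromℕ h * logSum n (φ y) + 1ℚ
  logSum-ratio n h {y} {y′} 1≤y ratio y≤y′ = begin
    H * logSum n v                       ≡⟨ cong (λ z → H * logSum n z) v≡ ⟨
    H * logSum n (u + d)                 ≤⟨ mulˡ (fromℕ-≥0 h) (logSum-step n (φ≥0 1≤y) 0≤d) ⟩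
    H * (logSum n u + 2ℚ * d * Γ)        ≡⟨ solve 4 (λ H l d g → H :* (l :+ con 2ℚ :* d :* g) := H :* l :+ con 2ℚ :* H :* d :* g) refl H (logSum n u) d Γ ⟩
    H * logSum n u + 2ℚ * H * d * Γ      ≤⟨ +-monoʳ-≤ (H * logSum n u) small ⟩
    H * logSum n u + 1ℚ                  ∎
    where
    H  = ℚfromℕ h
    u  = φ y
    v  = φ y′
    d  = v - u
    0<y : 0ℚ < y
    0<y = <-≤-trans 0<1 1≤y
    0<y′ : 0ℚ < y′
    0<y′ = <-≤-trans 0<y y≤y′
    s  = y + 1ℚ
    s′ = y′ + 1ℚ
    v≡ : u + d ≡ v
    v≡ = solve 2 (λ u v → u :+ (v :- u) := v) refl u v
    0≤d : 0ℚ ≤ d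
    0≤d = subst (_≤ d) (+-inverseʳ u) (+-monoˡ-≤ (- u) (φ-mono 0<y y≤y′))
    W Γ : ℚ
    W = (u + d) ^ℚ 2
    Γ = geometric n W
    0≤W : 0ℚ ≤ W
    0≤W = ^≥0 (0≤add (φ≥0 1≤y) 0≤d) 2
    -- Dropping the remainder W^n from the geometric identity leaves what is needed of Γ ≤ 1 / (1 -
    -- W), without dividing.
    Γ≤ : Γ ≤ 1ℚ + W * Γ
    Γ≤ = ≤-trans (p≤p+q (^≥0 0≤W n)) (≤-reflexive (geometric-sum n W))
    Γ[1-W]≤1 : Γ * (1ℚ - W) ≤ 1ℚ
    Γ[1-W]≤1 = begin
      Γ * (1ℚ - W)            ≡⟨ solve 2 (λ g w → g :* (con 1ℚ :- w) := g :- w :* g) refl Γ W ⟩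
      Γ - W * Γ               ≤⟨ +-monoˡ-≤ (- (W * Γ)) Γ≤ ⟩
      1ℚ + W * Γ - W * Γ      ≡⟨ solve 1 (λ x → con 1ℚ :+ x :- x := con 1ℚ) refl (W * Γ) ⟩
      1ℚ                      ∎
    4y′ : (1ℚ - W) * (s′ * s′) ≡ 2ℚ * 2ℚ * y′
    4y′ = begin-equality
      (1ℚ - W) * (s′ * s′)                     ≡⟨ cong (λ z → (1ℚ - z ^ℚ 2) * (s′ * s′)) v≡ ⟩
      (1ℚ - v * (v * 1ℚ)) * (s′ * s′)          ≡⟨ solve 2 (λ v s → (con 1ℚ :- v :* (v :* con 1ℚ)) :* (s :* s) := s :* s :- (v :* s) :* (v :* s)) refl v s′ ⟩
      s′ * s′ - (v * s′) * (v * s′)            ≡⟨ cong (λ z → s′ * s′ - z * z) (φ-spec y′ 0<y′) ⟩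
      s′ * s′ - (y′ - 1ℚ) * (y′ - 1ℚ)          ≡⟨ solve 1 (λ y → (y :+ con 1ℚ) :* (y :+ con 1ℚ) :- (y :- con 1ℚ) :* (y :- con 1ℚ) := con 2ℚ :* con 2ℚ :* y) refl y′ ⟩
      2ℚ * 2ℚ * y′                             ∎
    -- Cross-multiplied form of φ y′ - φ y = 2 (y′ - y) / ((y + 1)(y′ + 1)), where `ratio` gives h
    -- (y′ - y) = y.
    dss′ : H * (d * (s * s′)) ≡ 2ℚ * y
    dss′ = begin-equality
      H * (d * (s * s′))                       ≡⟨ solve 5 (λ H v u s t → H :* ((v :- u) :* (s :* t)) := H :* ((v :* t) :* s :- (u :* s) :* t)) refl H v u s s′ ⟩
      H * ((v * s′) * s - (u * s) * s′)        ≡⟨ cong₂ (λ a b → H * (a * s - b * s′)) (φ-spec y′ 0<y′) (φ-spec y 0<y) ⟩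
      H * ((y′ - 1ℚ) * s - (y - 1ℚ) * s′)      ≡⟨ solve 3 (λ H y z → H :* ((z :- con 1ℚ) :* (y :+ con 1ℚ) :- (y :- con 1ℚ) :* (z :+ con 1ℚ)) := con 2ℚ :* (H :* z :- H :* y)) refl H y y′ ⟩
      2ℚ * (H * y′ - H * y)                    ≡⟨ cong (λ z → 2ℚ * (z - H * y)) (trans ratio (cong (_* y) (fromℕ-suc h))) ⟩
      2ℚ * ((1ℚ + H) * y - H * y)              ≡⟨ solve 2 (λ H y → con 2ℚ :* ((con 1ℚ :+ H) :* y :- H :* y) := con 2ℚ :* y) refl H y ⟩
      2ℚ * y                                   ∎
    0<s = 0<q+1 0<y
    0<s′ = 0<q+1 0<y′
    -- After multiplication by 2 y′ (y + 1) the left side is at most 2 y (y′ + 1) and the right side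
    -- is 2 y′ (y + 1); they compare because y ≤ y′.
    small : 2ℚ * H * d * Γ ≤ 1ℚ
    small = cancelʳ (0<mul (0<mul {2ℚ} (positive⁻¹ 2ℚ) 0<y′) 0<s) (begin
      2ℚ * H * d * Γ * (2ℚ * y′ * s)                 ≡⟨ solve 5 (λ H d g z s → con 2ℚ :* H :* d :* g :* (con 2ℚ :* z :* s) := H :* d :* s :* (g :* (con 2ℚ :* con 2ℚ :* z))) refl H d Γ y′ s ⟩
      H * d * s * (Γ * (2ℚ * 2ℚ * y′))               ≡⟨ cong (λ z → H * d * s * (Γ * z)) 4y′ ⟨
      H * d * s * (Γ * ((1ℚ - W) * (s′ * s′)))       ≡⟨ cong (H * d * s *_) (*-assoc Γ (1ℚ - W) (s′ * s′)) ⟨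
      H * d * s * (Γ * (1ℚ - W) * (s′ * s′))         ≤⟨ mulˡ (0≤mul (0≤mul (fromℕ-≥0 h) 0≤d) (<⇒≤ 0<s)) (mulʳ (0≤mul (<⇒≤ 0<s′) (<⇒≤ 0<s′)) Γ[1-W]≤1) ⟩
      H * d * s * (1ℚ * (s′ * s′))                   ≡⟨ solve 4 (λ H d s t → H :* d :* s :* (con 1ℚ :* (t :* t)) := H :* (d :* (s :* t)) :* t) refl H d s s′ ⟩
      H * (d * (s * s′)) * s′                        ≡⟨ cong (_* s′) dss′ ⟩
      2ℚ * y * s′                                    ≡⟨ solve 2 (λ y z → con 2ℚ :* y :* (z :+ con 1ℚ) := con 2ℚ :* (y :* z) :+ con 2ℚ :* y) refl y y′ ⟩
      2ℚ * (y * y′) + 2ℚ * y                         ≤⟨ +-monoʳ-≤ (2ℚ * (y * y′)) (mulˡ 0≤2 y≤y′) ⟩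
      2ℚ * (y * y′) + 2ℚ * y′                        ≡⟨ solve 2 (λ y z → con 2ℚ :* (y :* z) :+ con 2ℚ :* z := con 1ℚ :* (con 2ℚ :* z :* (y :+ con 1ℚ))) refl y y′ ⟩
      1ℚ * (2ℚ * y′ * s)                             ∎)

  -- Here ρ = 1 + 1 / h, so each factor ρ adds at most 1 / h to the logarithm by `logSum-ratio`,
  -- starting from φ 1 = 0.
  logSum-power : ∀ n h ρ → ℚfromℕ h * ρ ≡ ℚfromℕ (suc h) → 1ℚ ≤ ρ → ∀ j → ℚfromℕ h * logSum n (φ (ρ ^ℚ j)) ≤ ℚfromℕ j
  logSum-power n h ρ hρ 1≤ρ zero = ≤-reflexive (trans (cong (ℚfromℕ h *_) (logSum-0 n)) (*-zeroʳ (ℚfromℕ h)))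
  logSum-power n h ρ hρ 1≤ρ (suc j) = begin
    ℚfromℕ h * logSum n (φ (ρ * ρ ^ℚ j))         ≤⟨ logSum-ratio n h 1≤ρʲ (trans (sym (*-assoc (ℚfromℕ h) ρ (ρ ^ℚ j))) (cong (_* ρ ^ℚ j) hρ)) increasing ⟩
    ℚfromℕ h * logSum n (φ (ρ ^ℚ j)) + 1ℚ        ≤⟨ +-monoˡ-≤ 1ℚ (logSum-power n h ρ hρ 1≤ρ j) ⟩
    ℚfromℕ j + 1ℚ                                ≡⟨ trans (+-comm (ℚfromℕ j) 1ℚ) (sym (fromℕ-suc j)) ⟩
    ℚfromℕ (suc j)                               ∎
    where
    1≤ρʲ = ^≥1 1≤ρ j
    increasing : ρ ^ℚ j ≤ ρ * ρ ^ℚ j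
    increasing = subst (_≤ ρ * ρ ^ℚ j) (*-identityˡ (ρ ^ℚ j)) (mulʳ (≤-trans 0≤1 1≤ρʲ) 1≤ρ)

  -- The base in which logarithms are measured: log (ρʲ) ≤ j / 7 and exp (j / 7) ≤ (7 / 6)ʲ,
  -- so (7 / 6)⁶ ≤ ρ⁷ gives exp (3/2 log y) ≤ y^(7/4) at powers y of ρ⁴.
  ρ : ℚ
  ρ = + 8 / 7

  1≤ρ : 1ℚ ≤ ρ
  1≤ρ = from-yes (1ℚ ≤? ρ)

  ρ≤2 : ρ ≤ 2ℚ
  ρ≤2 = from-yes (ρ ≤? 2ℚ)

  -- Bernoulli's inequality for ρ = 1 + 1/7, multiplied by 7. It shows that the exponent 7T is large
  -- enough to start the search for a power of ρ near T.
  ρ^≥ : ∀ i → ℚfromℕ (7 ℕ.+ i) ≤ ℚfromℕ 7 * ρ ^ℚ i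
  ρ^≥ zero    = ≤-refl
  ρ^≥ (suc i) = begin
    ℚfromℕ (7 ℕ.+ suc i)                   ≡⟨ trans (cong ℚfromℕ (ℕP.+-suc 7 i)) (fromℕ-suc (7 ℕ.+ i)) ⟩
    1ℚ + ℚfromℕ (7 ℕ.+ i)                  ≤⟨ +-mono-≤ (^≥1 1≤ρ i) (ρ^≥ i) ⟩
    ρ ^ℚ i + ℚfromℕ 7 * ρ ^ℚ i             ≡⟨ solve 2 (λ r s → r :+ s :* r := (con 1ℚ :+ s) :* r) refl (ρ ^ℚ i) (ℚfromℕ 7) ⟩
    ℚfromℕ 7 * ρ * ρ ^ℚ i                  ≡⟨ *-assoc (ℚfromℕ 7) ρ (ρ ^ℚ i) ⟩
    ℚfromℕ 7 * ρ ^ℚ suc i                  ∎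

  -- The exponent is lowered until one more step would fall below x; the overshoot is then at most a
  -- factor ρ ≤ 2.
  power-near : ∀ x → 1ℚ ≤ x → ∀ i → x ≤ ρ ^ℚ i → ∃[ i ] x ≤ ρ ^ℚ i × ρ ^ℚ i ≤ 2ℚ * x
  power-near x 1≤x zero    h = 0 , h , ≤-trans 1≤x (subst (_≤ 2ℚ * x) (*-identityˡ x) (mulʳ (≤-trans 0≤1 1≤x) (fromℕ-mono {1} {2} (s≤s z≤n))))
  power-near x 1≤x (suc i) h with x ≤? ρ ^ℚ i
  ... | yes x≤ = power-near x 1≤x i x≤
  ... | no x≰  = suc i , h , mul (^≥0 (≤-trans 0≤1 1≤ρ) i) 0≤2 ρ≤2 (<⇒≤ (≰⇒> x≰))

  power-near-ℕ : ∀ T → 1 ℕ.≤ T → ∃[ i ] ℚfromℕ T ≤ ρ ^ℚ i × ρ ^ℚ i ≤ 2ℚ * ℚfromℕ T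
  power-near-ℕ T 1≤T = power-near (ℚfromℕ T) (fromℕ-mono 1≤T) (7 ℕ.* T) (cancelʳ {ℚfromℕ 7} (positive⁻¹ (ℚfromℕ 7)) (begin
    ℚfromℕ T * ℚfromℕ 7                ≡⟨ trans (*-comm (ℚfromℕ T) (ℚfromℕ 7)) (sym (fromℕ-* 7 T)) ⟩
    ℚfromℕ (7 ℕ.* T)                   ≤⟨ fromℕ-mono (ℕP.m≤n+m (7 ℕ.* T) 7) ⟩
    ℚfromℕ (7 ℕ.+ 7 ℕ.* T)             ≤⟨ ρ^≥ (7 ℕ.* T) ⟩
    ℚfromℕ 7 * ρ ^ℚ (7 ℕ.* T)          ≡⟨ *-comm (ℚfromℕ 7) (ρ ^ℚ (7 ℕ.* T)) ⟩
    ρ ^ℚ (7 ℕ.* T) * ℚfromℕ 7          ∎))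

  7⁶≤6⁶ρ⁷ : ℚfromℕ 7 ^ℚ 6 ≤ ℚfromℕ 6 ^ℚ 6 * ρ ^ℚ 7
  7⁶≤6⁶ρ⁷ = from-yes ((ℚfromℕ 7 ^ℚ 6) ≤? (ℚfromℕ 6 ^ℚ 6 * ρ ^ℚ 7))

  -- For c ≥ 3 the leading term 2 (c - 1) / (c + 1) is already at least 1. Applied to χ, it puts log
  -- χ in the range where the outer logarithm has a nonnegative argument φ.
  1≤logSum : ∀ n {c} → 1 ℕ.≤ n → ℚfromℕ 3 ≤ c → 1ℚ ≤ logSum n (φ c)
  1≤logSum n {c} 1≤n 3≤c = begin
    1ℚ                        ≤⟨ cancelʳ (0<q+1 0<c) first ⟩
    logTerm 0 (φ c)           ≤⟨ first≤∑ (λ i → logTerm i (φ c)) (λ i → 0≤mul (k/n≥0 2 (suc (2 ℕ.* i))) (^≥0 (φ≥0 1≤c) (suc (2 ℕ.* i)))) n 1≤n ⟩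
    logSum n (φ c)            ∎
    where
    1≤c : 1ℚ ≤ c
    1≤c = ≤-trans (fromℕ-mono {1} {3} (s≤s z≤n)) 3≤c
    0<c : 0ℚ < c
    0<c = <-≤-trans 0<1 1≤c
    first : 1ℚ * (c + 1ℚ) ≤ logTerm 0 (φ c) * (c + 1ℚ)
    first = begin
      1ℚ * (c + 1ℚ)                        ≡⟨ solve 2 (λ c t → con 1ℚ :* (c :+ con 1ℚ) := (c :+ con 1ℚ :- t) :+ t) refl c (ℚfromℕ 3) ⟩
      (c + 1ℚ - ℚfromℕ 3) + ℚfromℕ 3       ≤⟨ +-monoʳ-≤ (c + 1ℚ - ℚfromℕ 3) 3≤c ⟩
      (c + 1ℚ - ℚfromℕ 3) + c              ≡⟨ solve 1 (λ c → c :+ con 1ℚ :- con (ℚfromℕ 3) :+ c := con 2ℚ :* (c :- con 1ℚ)) refl c ⟩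
      2ℚ * (c - 1ℚ)                        ≡⟨ cong (2ℚ *_) (φ-spec c 0<c) ⟨
      2ℚ * (φ c * (c + 1ℚ))                ≡⟨ solve 2 (λ f c → con 2ℚ :* (f :* (c :+ con 1ℚ)) := con 2ℚ :* (f :* con 1ℚ) :* (c :+ con 1ℚ)) refl (φ c) c ⟩
      2ℚ * (φ c * 1ℚ) * (c + 1ℚ)           ∎

  -- `y`, `L` and `E` are truncations of log χ, log log χ and (log χ)^a. Since ρ^i lies between T
  -- and 2T, the bound y ≤ T⁴ ≤ ρ^(4i) reduces everything to integer exponents.
  module PowerOfLog (n χ T : ℕ) (1≤n : 1 ℕ.≤ n) (3≤χ : 3 ℕ.≤ χ) (1≤T : 1 ℕ.≤ T) (χ≤ : χ ℕ.≤ 2 ℕ.^ (T ℕ.^ 4))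
                    (a : ℚ) (0≤a : 0ℚ ≤ a) (a≤ : a ≤ + 3 / 2) where

    i : ℕ
    i = proj₁ (power-near-ℕ T 1≤T)
    y L δ E : ℚ
    y = logSum n (φ (ℚfromℕ χ))
    L = logSum n (φ y)
    δ = + 1 / 7
    E = expSum n (a * L)

    1≤y : 1ℚ ≤ y
    1≤y = 1≤logSum n 1≤n (fromℕ-mono 3≤χ)

    0<y : 0ℚ < y
    0<y = <-≤-trans 0<1 1≤y

    y≤ : y ≤ ρ ^ℚ (i ℕ.* 4)
    y≤ = begin
      y                                           ≤⟨ logSum-mono n (φ≥0 (fromℕ-mono (ℕP.≤-trans (s≤s z≤n) 3≤χ))) (φ-mono (<-≤-trans 0<1 (fromℕ-mono (ℕP.≤-trans (s≤s z≤n) 3≤χ))) (≤-trans (fromℕ-mono χ≤) (≤-reflexive (fromℕ-^ 2 (T ℕ.^ 4))))) ⟩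
      logSum n (φ (2ℚ ^ℚ (T ℕ.^ 4)))              ≡⟨ *-identityˡ _ ⟨
      ℚfromℕ 1 * logSum n (φ (2ℚ ^ℚ (T ℕ.^ 4)))   ≤⟨ logSum-power n 1 2ℚ (*-identityˡ 2ℚ) (fromℕ-mono {1} {2} (s≤s z≤n)) (T ℕ.^ 4) ⟩
      ℚfromℕ (T ℕ.^ 4)                            ≡⟨ fromℕ-^ T 4 ⟩
      ℚfromℕ T ^ℚ 4                               ≤⟨ ^-mono (fromℕ-≥0 T) (proj₁ (proj₂ (power-near-ℕ T 1≤T))) 4 ⟩
      (ρ ^ℚ i) ^ℚ 4                               ≡⟨ ^-assocʳ ρ i 4 ⟩
      ρ ^ℚ (i ℕ.* 4)                              ∎

    0≤L : 0ℚ ≤ L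
    0≤L = logSum≥0 n (φ≥0 1≤y)

    -- log y ≤ 4i log ρ ≤ 4i / 7, and the factor 3/2 makes this 6i / 7.
    aL≤ : a * L ≤ ℚfromℕ (6 ℕ.* i) * δ
    aL≤ = begin
      a * L                                     ≤⟨ mulʳ 0≤L a≤ ⟩
      (+ 3 / 2) * L                             ≡⟨ solve 1 (λ l → con (+ 3 / 2) :* l := con (+ 3 / 2) :* con δ :* (con (ℚfromℕ 7) :* l)) refl L ⟩
      (+ 3 / 2) * δ * (ℚfromℕ 7 * L)            ≤⟨ mulˡ (nonNegative⁻¹ ((+ 3 / 2) * δ)) (begin
        ℚfromℕ 7 * L                              ≤⟨ mulˡ (fromℕ-≥0 7) (logSum-mono n (φ≥0 1≤y) (φ-mono 0<y y≤)) ⟩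
        ℚfromℕ 7 * logSum n (φ (ρ ^ℚ (i ℕ.* 4)))  ≤⟨ logSum-power n 7 ρ refl 1≤ρ (i ℕ.* 4) ⟩
        ℚfromℕ (i ℕ.* 4)                          ∎) ⟩
      (+ 3 / 2) * δ * ℚfromℕ (i ℕ.* 4)          ≡⟨ cong ((+ 3 / 2) * δ *_) (fromℕ-* i 4) ⟩
      (+ 3 / 2) * δ * (ℚfromℕ i * ℚfromℕ 4)     ≡⟨ solve 1 (λ i → con (+ 3 / 2) :* con δ :* (i :* con (ℚfromℕ 4)) := con (ℚfromℕ 6) :* i :* con δ) refl (ℚfromℕ i) ⟩
      ℚfromℕ 6 * ℚfromℕ i * δ                   ≡⟨ cong (_* δ) (fromℕ-* 6 i) ⟨
      ℚfromℕ (6 ℕ.* i) * δ                      ∎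

    0≤E : 0ℚ ≤ E
    0≤E = ∑≥0 n (expTerm≥0 (0≤mul 0≤a 0≤L))

    -- exp (6i / 7) ≤ (7/6)^(6i) ≤ ρ^(7i) ≤ (2T)⁷. The second inequality is `7⁶≤6⁶ρ⁷` raised to the
    -- power i, and the denominator 6^(6i) is kept multiplied out.
    E≤ : E ≤ ℚfromℕ ((2 ℕ.* T) ℕ.^ 7)
    E≤ = ≤-trans (cancelʳ {(ℚfromℕ 6 ^ℚ 6) ^ℚ i} 0<6⁶ⁱ (begin
      E * (ℚfromℕ 6 ^ℚ 6) ^ℚ i                                        ≡⟨ *-comm E _ ⟩
      (ℚfromℕ 6 ^ℚ 6) ^ℚ i * E                                        ≡⟨ cong (_* E) (trans (^-assocʳ (ℚfromℕ 6) 6 i) (sym (fromℕ-^ 6 (6 ℕ.* i)))) ⟩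
      ℚfromℕ (6 ℕ.^ (6 ℕ.* i)) * E                                    ≤⟨ mulˡ (fromℕ-≥0 (6 ℕ.^ (6 ℕ.* i))) (expSum-mono n (0≤mul 0≤a 0≤L) aL≤) ⟩
      ℚfromℕ (6 ℕ.^ (6 ℕ.* i)) * expSum n (ℚfromℕ (6 ℕ.* i) * δ)      ≤⟨ expSum-≤ 6 δ refl (nonNegative⁻¹ δ) n (6 ℕ.* i) ⟩
      ℚfromℕ (7 ℕ.^ (6 ℕ.* i))                                        ≡⟨ trans (fromℕ-^ 7 (6 ℕ.* i)) (sym (^-assocʳ (ℚfromℕ 7) 6 i)) ⟩
      (ℚfromℕ 7 ^ℚ 6) ^ℚ i                                            ≤⟨ ^-mono (^≥0 (fromℕ-≥0 7) 6) 7⁶≤6⁶ρ⁷ i ⟩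
      (ℚfromℕ 6 ^ℚ 6 * ρ ^ℚ 7) ^ℚ i                                   ≡⟨ ^-distrib-* (ℚfromℕ 6 ^ℚ 6) (ρ ^ℚ 7) i ⟩
      (ℚfromℕ 6 ^ℚ 6) ^ℚ i * (ρ ^ℚ 7) ^ℚ i                            ≡⟨ *-comm ((ℚfromℕ 6 ^ℚ 6) ^ℚ i) ((ρ ^ℚ 7) ^ℚ i) ⟩
      (ρ ^ℚ 7) ^ℚ i * (ℚfromℕ 6 ^ℚ 6) ^ℚ i                            ∎)) (begin
      (ρ ^ℚ 7) ^ℚ i                     ≡⟨ trans (^-assocʳ ρ 7 i) (trans (cong (ρ ^ℚ_) (ℕP.*-comm 7 i)) (sym (^-assocʳ ρ i 7))) ⟩
      (ρ ^ℚ i) ^ℚ 7                     ≤⟨ ^-mono (^≥0 (≤-trans 0≤1 1≤ρ) i) (proj₂ (proj₂ (power-near-ℕ T 1≤T))) 7 ⟩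
      (2ℚ * ℚfromℕ T) ^ℚ 7              ≡⟨ trans (cong (_^ℚ 7) (sym (fromℕ-* 2 T))) (sym (fromℕ-^ (2 ℕ.* T) 7)) ⟩
      ℚfromℕ ((2 ℕ.* T) ℕ.^ 7)          ∎)
      where
      0<6⁶ⁱ : 0ℚ < (ℚfromℕ 6 ^ℚ 6) ^ℚ i
      0<6⁶ⁱ = subst (0ℚ <_) (trans (fromℕ-^ 6 (6 ℕ.* i)) (sym (^-assocʳ (ℚfromℕ 6) 6 i)))
        (<-≤-trans 0<1 (fromℕ-mono (ℕP.m^n>0 6 (6 ℕ.* i))))

    -- The case g = 1 of `expSum-≤` amounts to exp (1/2) ≤ 2, hence exp m ≤ 2^(2m). This is the
    -- source of the final factor 2 in the exponent.
    exp-tower≤ : ∀ {C} c → 0ℚ ≤ C → C ≤ ℚfromℕ c → expSum n (C * E) ≤ ℚfromℕ (2 ℕ.^ (c ℕ.* (2 ℕ.* T) ℕ.^ 7 ℕ.* 2))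
    exp-tower≤ {C} c 0≤C C≤c = begin
      expSum n (C * E)                                      ≤⟨ expSum-mono n (0≤mul 0≤C 0≤E) (begin
        C * E                                                 ≤⟨ mul 0≤E (fromℕ-≥0 c) C≤c E≤ ⟩
        ℚfromℕ c * ℚfromℕ ((2 ℕ.* T) ℕ.^ 7)                   ≡⟨ fromℕ-* c ((2 ℕ.* T) ℕ.^ 7) ⟨
        ℚfromℕ m                                              ≡⟨ solve 1 (λ m → m := m :* con 2ℚ :* con ½) refl (ℚfromℕ m) ⟩
        ℚfromℕ m * 2ℚ * ½                                     ≡⟨ cong (_* ½) (fromℕ-* m 2) ⟨
        ℚfromℕ (m ℕ.* 2) * ½                                  ∎) ⟩
      expSum n (ℚfromℕ (m ℕ.* 2) * ½)                       ≡⟨ *-identityˡ _ ⟨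
      1ℚ * expSum n (ℚfromℕ (m ℕ.* 2) * ½)                  ≡⟨ cong (λ z → ℚfromℕ z * expSum n (ℚfromℕ (m ℕ.* 2) * ½)) (ℕP.^-zeroˡ (m ℕ.* 2)) ⟨
      ℚfromℕ (1 ℕ.^ (m ℕ.* 2)) * expSum n (ℚfromℕ (m ℕ.* 2) * ½) ≤⟨ expSum-≤ 1 ½ refl (nonNegative⁻¹ ½) n (m ℕ.* 2) ⟩
      ℚfromℕ (2 ℕ.^ (m ℕ.* 2))                              ∎
      where
      m = c ℕ.* (2 ℕ.* T) ℕ.^ 7

  fromℕ-cancel-≤ : ∀ {m n} → ℚfromℕ m ≤ ℚfromℕ n → m ℕ.≤ n
  fromℕ-cancel-≤ {m} {n} h = ℕP.≮⇒≥ λ n<m → <-irrefl refl (begin-strict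
    ℚfromℕ n            ≡⟨ +-identityˡ (ℚfromℕ n) ⟨
    0ℚ + ℚfromℕ n       <⟨ +-monoˡ-< (ℚfromℕ n) 0<1 ⟩
    1ℚ + ℚfromℕ n       ≡⟨ fromℕ-suc n ⟨
    ℚfromℕ (suc n)      ≤⟨ fromℕ-mono n<m ⟩
    ℚfromℕ m            ≤⟨ h ⟩
    ℚfromℕ n            ∎)

  -- An inequality of reals holds up to an error 1 at all late indices, so one index past every
  -- modulus suffices; there a and C₀ are rationals within their bounds. The error 1 becomes the
  -- `suc`, and `c` depends on C₀ alone.
  edge-bound : ∀ (a C₀ : ℝ) → fromℕ 1 <ᴿ a → a <ᴿ fromℚ (+ 3 / 2) → fromℕ 0 <ᴿ C₀ →
    ∃[ c ] ∀ m χ T (2≤χ : 2 ℕ.≤ χ) → 3 ℕ.≤ χ → 1 ℕ.≤ T → χ ℕ.≤ 2 ℕ.^ (T ℕ.^ 4) →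
    fromℕ m ≤ᴿ exp (C₀ *ᴿ log-pow χ 2≤χ a) → m ℕ.≤ suc (2 ℕ.^ (c ℕ.* (2 ℕ.* T) ℕ.^ 7 ℕ.* 2))
  edge-bound a C₀ (ε₁ , 0<ε₁ , N₁ , 1<a) (ε₂ , 0<ε₂ , N₂ , a<3/2) (ε₃ , 0<ε₃ , N₃ , 0<C₀) = suc b , bound
    where
    b = proj₁ (CauchyLemmas.bounded (seq C₀) (cauchy C₀))
    N₄ = proj₁ (proj₂ (CauchyLemmas.bounded (seq C₀) (cauchy C₀)))
    C₀≤ = proj₂ (proj₂ (CauchyLemmas.bounded (seq C₀) (cauchy C₀)))
    bound : ∀ m χ T (2≤χ : 2 ℕ.≤ χ) → 3 ℕ.≤ χ → 1 ℕ.≤ T → χ ℕ.≤ 2 ℕ.^ (T ℕ.^ 4) →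
      fromℕ m ≤ᴿ exp (C₀ *ᴿ log-pow χ 2≤χ a) → m ℕ.≤ suc (2 ℕ.^ (suc b ℕ.* (2 ℕ.* T) ℕ.^ 7 ℕ.* 2))
    bound m χ T 2≤χ 3≤χ 1≤T χ≤ hyp = fromℕ-cancel-≤ (begin
      ℚfromℕ m                                 ≤⟨ proj₂ (hyp 1ℚ 0<1) n N₅≤n ⟩
      expSum n (seq C₀ n * E) + 1ℚ             ≤⟨ +-monoˡ-≤ 1ℚ (exp-tower≤ (suc b) 0≤C (≤-trans (p≤∣p∣ (seq C₀ n)) (C₀≤ n N₄≤n))) ⟩
      ℚfromℕ (2 ℕ.^ M) + 1ℚ                    ≡⟨ trans (+-comm (ℚfromℕ (2 ℕ.^ M)) 1ℚ) (sym (fromℕ-suc (2 ℕ.^ M))) ⟩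
      ℚfromℕ (suc (2 ℕ.^ M))                   ∎)
      where
      M = suc b ℕ.* (2 ℕ.* T) ℕ.^ 7 ℕ.* 2
      N₅ = proj₁ (hyp 1ℚ 0<1)
      -- The `suc` makes the truncation nonempty, as `1≤logSum` requires.
      n = suc (N₁ ℕ.+ (N₂ ℕ.+ (N₃ ℕ.+ (N₄ ℕ.+ N₅))))
      open ℕP using () renaming (m≤m+n to left; m≤n+m to right)
      N₁≤n : N₁ ℕ.≤ n
      N₁≤n = ℕP.m≤n⇒m≤1+n (left N₁ _)
      N₂≤n : N₂ ℕ.≤ n
      N₂≤n = ℕP.m≤n⇒m≤1+n (ℕP.≤-trans (left N₂ _) (right _ N₁))
      N₃≤n : N₃ ℕ.≤ n
      N₃≤n = ℕP.m≤n⇒m≤1+n (ℕP.≤-trans (left N₃ _) (ℕP.≤-trans (right _ N₂) (right _ N₁)))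
      N₄≤n : N₄ ℕ.≤ n
      N₄≤n = ℕP.m≤n⇒m≤1+n (ℕP.≤-trans (left N₄ N₅) (ℕP.≤-trans (right _ N₃) (ℕP.≤-trans (right _ N₂) (right _ N₁))))
      N₅≤n : N₅ ℕ.≤ n
      N₅≤n = ℕP.m≤n⇒m≤1+n (ℕP.≤-trans (right N₅ N₄) (ℕP.≤-trans (right _ N₃) (ℕP.≤-trans (right _ N₂) (right _ N₁))))
      0≤a : 0ℚ ≤ seq a n
      0≤a = ≤-trans (≤-trans 0≤1 (p≤p+q (<⇒≤ 0<ε₁))) (1<a n N₁≤n)
      0≤C : 0ℚ ≤ seq C₀ n
      0≤C = ≤-trans (p≤p+q (<⇒≤ 0<ε₃)) (0<C₀ n N₃≤n)
      a≤3/2 : seq a n ≤ + 3 / 2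
      a≤3/2 = ≤-trans (p≤p+q (<⇒≤ 0<ε₂)) (a<3/2 n N₂≤n)
      open PowerOfLog n χ T (s≤s z≤n) 3≤χ 1≤T χ≤ (seq a n) 0≤a a≤3/2 using (E; exp-tower≤)

open import Data.Bool using (Bool; true; false; _∧_; _∨_; not; T?)
open import Data.Bool.Properties using (T-≡)
open import Data.Empty using (⊥; ⊥-elim)
open import Data.Fin using (Fin; toℕ; fromℕ<; inject₁) renaming (zero to fzero; suc to fsuc; fromℕ to last)
import Data.Fin.Properties as Fin
import Data.Fin.Subset as Subset
open import Data.List using (List; []; _∷_; _++_; length; filter; filterᵇ; concatMap; map; allFin; upTo; lookup; cartesianProduct)
open import Data.List.Membership.Propositional using (_∈_; lose)
open import Data.List.Membership.Propositional.Properties using (∈-filter⁺; ∈-filter⁻; ∈-++⁺ˡ; ∈-++⁺ʳ; ∈-map⁺; ∈-upTo⁺; ∈-allFin; ∈-cartesianProduct⁺)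
import Data.List.Membership.DecPropositional as DecMembership
open import Data.List.Properties using (length-++; length-map; length-upTo)
open import Data.List.Relation.Unary.All using (All; []; _∷_)
open import Data.List.Relation.Unary.AllPairs using ([]; _∷_)
open import Data.List.Relation.Unary.Any using (here; there; any?; index; satisfied)
open import Data.List.Relation.Unary.Any.Properties using (lookup-index)
open import Data.List.Relation.Unary.Unique.Propositional using (Unique)
open import Data.List.Relation.Unary.Unique.Propositional.Properties using (allFin⁺)
open import Data.Nat renaming (_/_ to _div_)
open import Data.Nat.DivMod using (_mod_; m%n<n; m≡m%n+[m/n]*n; [m+kn]%n≡m%n; [m+n]%n≡m%n; m<n⇒m%n≡m; n%n≡0)
open import Data.Nat.Properties
open import Data.Nat.Tactic.RingSolver using (solve-∀)
open import Data.Product using (Σ; ∃; ∃-syntax; _×_; _,_; proj₁; proj₂)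
open import Data.Product.Properties using (≡-dec)
open import Data.Sum using (_⊎_; inj₁; inj₂; [_,_]′)
open import Function using (_∘_)
open import Function.Bundles using (Equivalence)
open import Function.Definitions using (Injective)
open import Relation.Binary.Construct.Add.Supremum.NonStrict _≤_ using (_≤⁺_; _≤⊤⁺) renaming ([_] to finite≤)
open import Relation.Binary.Definitions using (tri<; tri≈; tri>)
open import Relation.Binary.PropositionalEquality hiding ([_])
open import Relation.Nullary using (¬_; yes; no; contradiction; ⌊_⌋)
open import Relation.Nullary.Construct.Add.Supremum using ([_])
open import Relation.Nullary.Decidable using (_⊎-dec_; _×-dec_; ¬?; decidable-stable; toWitness; fromWitness)
open import Defs

private variable
  X Y : Set
  n : ℕ

-- Finite sums and counting

⟦_⟧ : Bool → ℕ
⟦ true ⟧  = 1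
⟦ false ⟧ = 0

⟦⟧*≤ : ∀ b {m} → ⟦ b ⟧ * m ≤ m
⟦⟧*≤ true  = ≤-reflexive (*-identityˡ _)
⟦⟧*≤ false = z≤n

⟦∧⟧ : ∀ a b → ⟦ a ∧ b ⟧ ≡ ⟦ a ⟧ * ⟦ b ⟧
⟦∧⟧ true  b = sym (+-identityʳ ⟦ b ⟧)
⟦∧⟧ false b = refl

sumOver : List X → (X → ℕ) → ℕ
sumOver []       f = 0
sumOver (x ∷ xs) f = f x + sumOver xs f

infix 2 sumOver
syntax sumOver xs (λ x → t) = ∑[ x ← xs ] t

count : List X → (X → Bool) → ℕ
count xs p = ∑[ x ← xs ] ⟦ p x ⟧

∑-mono : ∀ (xs : List X) {f g} → (∀ x → x ∈ xs → f x ≤ g x) → sumOver xs f ≤ sumOver xs g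
∑-mono []       h = z≤n
∑-mono (x ∷ xs) h = +-mono-≤ (h x (here refl)) (∑-mono xs λ y m → h y (there m))

∑-cong : ∀ (xs : List X) {f g} → (∀ x → f x ≡ g x) → sumOver xs f ≡ sumOver xs g
∑-cong []       h = refl
∑-cong (x ∷ xs) h = cong₂ _+_ (h x) (∑-cong xs h)

∑-+ : ∀ (xs : List X) (f g : X → ℕ) → (∑[ x ← xs ] (f x + g x)) ≡ sumOver xs f + sumOver xs g
∑-+ []       f g = refl
∑-+ (x ∷ xs) f g = trans (cong (f x + g x +_) (∑-+ xs f g)) (interchange (f x) (g x) (sumOver xs f) (sumOver xs g))
  where
  interchange : ∀ a b c d → a + b + (c + d) ≡ a + c + (b + d)
  interchange = solve-∀

∑-*ˡ : ∀ (xs : List X) c f → (∑[ x ← xs ] c * f x) ≡ c * sumOver xs f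
∑-*ˡ []       c f = sym (*-zeroʳ c)
∑-*ˡ (x ∷ xs) c f = trans (cong (c * f x +_) (∑-*ˡ xs c f)) (sym (*-distribˡ-+ c (f x) (sumOver xs f)))

∑-const : ∀ (xs : List X) c → (∑[ x ← xs ] c) ≡ length xs * c
∑-const []       c = refl
∑-const (x ∷ xs) c = cong (c +_) (∑-const xs c)

∑-swap : ∀ (xs : List X) (ys : List Y) (f : X → Y → ℕ) → (∑[ x ← xs ] ∑[ y ← ys ] f x y) ≡ (∑[ y ← ys ] ∑[ x ← xs ] f x y)
∑-swap []       ys f = sym (trans (∑-const ys 0) (*-zeroʳ (length ys)))
∑-swap (x ∷ xs) ys f = trans (cong (sumOver ys (f x) +_) (∑-swap xs ys f)) (sym (∑-+ ys (f x) _))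

-- The averaging principle behind both the popular edge and the popular colour class.
∑-< : ∀ (xs : List X) f g → sumOver xs g < sumOver xs f → ∃[ x ] x ∈ xs × g x < f x
∑-< (x ∷ xs) f g h with g x <? f x
... | yes l = x , here refl , l
... | no ¬l with ∑-< xs f g (≰⇒> λ le → <⇒≱ h (+-mono-≤ (≮⇒≥ ¬l) le))
...   | y , m , l = y , there m , l

term≤∑ : ∀ {xs : List X} f {x} → x ∈ xs → f x ≤ sumOver xs f
term≤∑ f (here refl) = m≤m+n _ _
term≤∑ f (there m)   = ≤-trans (term≤∑ f m) (m≤n+m _ _)

∑-filter : ∀ (xs : List X) p f → sumOver (filterᵇ p xs) f ≡ (∑[ x ← xs ] ⟦ p x ⟧ * f x)
∑-filter []       p f = refl
∑-filter (x ∷ xs) p f with p x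
... | true  = cong₂ _+_ (sym (+-identityʳ (f x))) (∑-filter xs p f)
... | false = ∑-filter xs p f

length-filter : ∀ (xs : List X) p → length (filterᵇ p xs) ≡ count xs p
length-filter []       p = refl
length-filter (x ∷ xs) p with p x
... | true  = cong suc (length-filter xs p)
... | false = length-filter xs p

length≡∑1 : ∀ (xs : List X) → length xs ≡ (∑[ x ← xs ] 1)
length≡∑1 xs = sym (trans (∑-const xs 1) (*-identityʳ (length xs)))

count-not : ∀ (xs : List X) p → count xs (not ∘ p) + count xs p ≡ length xs
count-not xs p = trans (sym (∑-+ xs _ _)) (trans (∑-cong xs λ x → compl (p x)) (sym (length≡∑1 xs)))
  where
  compl : ∀ b → ⟦ not b ⟧ + ⟦ b ⟧ ≡ 1
  compl true  = refl
  compl false = refl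

∈-filterᵇ⁺ : ∀ (p : X → Bool) {x xs} → x ∈ xs → p x ≡ true → x ∈ filterᵇ p xs
∈-filterᵇ⁺ p m eq = ∈-filter⁺ (T? ∘ p) m (Equivalence.from T-≡ eq)

∈-filterᵇ⁻ : ∀ (p : X → Bool) {x xs} → x ∈ filterᵇ p xs → x ∈ xs × p x ≡ true
∈-filterᵇ⁻ p m with ∈-filter⁻ (T? ∘ p) m
... | m′ , t = m′ , Equivalence.to T-≡ t

∧-true : ∀ {a b} → a ∧ b ≡ true → a ≡ true × b ≡ true
∧-true {true} {true} refl = refl , refl

false≢true : ∀ {b} → b ≡ false → b ≡ true → ⊥
false≢true refl ()

not-true : ∀ {a} → not a ≡ true → a ≡ false
not-true {false} refl = refl

module _ {n : ℕ} where

  _==_ : Fin n → Fin n → Bool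
  u == v = ⌊ u Fin.≟ v ⌋

  ==-sound : ∀ {u v} → u == v ≡ true → u ≡ v
  ==-sound {u} {v} h with u Fin.≟ v
  ... | yes e = e

  ==-refl : ∀ u → u == u ≡ true
  ==-refl u with u Fin.≟ u
  ... | yes _ = refl
  ... | no ¬e = contradiction refl ¬e

  elem : Fin n → List (Fin n) → Bool
  elem v []       = false
  elem v (y ∷ ys) = (v == y) ∨ elem v ys

  elem-complete : ∀ {v ys} → v ∈ ys → elem v ys ≡ true
  elem-complete {v} (here refl) rewrite ==-refl v = refl
  elem-complete {v} {y ∷ _} (there m) with v == y
  ... | true  = refl
  ... | false = elem-complete m

  -- Absence of repetitions, in the form that double counting uses.
  Distinct : List (Fin n) → Set
  Distinct xs = ∀ y → count xs (_== y) ≤ 1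

  distinct-filter : ∀ xs p → Distinct xs → Distinct (filterᵇ p xs)
  distinct-filter xs p d y = ≤-trans (≤-reflexive (∑-filter xs p _))
    (≤-trans (∑-mono xs λ x _ → ⟦⟧*≤ (p x)) (d y))

  ∑-count-== : ∀ xs → Distinct xs → ∀ ys → (∑[ v ← xs ] ∑[ y ← ys ] ⟦ v == y ⟧) ≤ length ys
  ∑-count-== xs d ys = begin
    (∑[ v ← xs ] ∑[ y ← ys ] ⟦ v == y ⟧)  ≡⟨ ∑-swap xs ys _ ⟩
    (∑[ y ← ys ] count xs (_== y))        ≤⟨ ∑-mono ys (λ y _ → d y) ⟩
    (∑[ y ← ys ] 1)                       ≡⟨ length≡∑1 ys ⟨
    length ys                             ∎
    where open ≤-Reasoning

  -- `ys` may repeat entries, as balls do. Matching pairs of positions are counted instead, and each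
  -- position of `ys` matches at most one entry of `xs`.
  count-elem : ∀ xs → Distinct xs → ∀ ys → count xs (λ v → elem v ys) ≤ length ys
  count-elem xs d ys = ≤-trans (∑-mono xs λ v _ → union v ys) (∑-count-== xs d ys)
    where
    ∨≤ : ∀ a b → ⟦ a ∨ b ⟧ ≤ ⟦ a ⟧ + ⟦ b ⟧
    ∨≤ true  b = s≤s z≤n
    ∨≤ false b = ≤-refl
    union : ∀ v ys → ⟦ elem v ys ⟧ ≤ (∑[ y ← ys ] ⟦ v == y ⟧)
    union v []       = z≤n
    union v (y ∷ ys) = ≤-trans (∨≤ (v == y) (elem v ys)) (+-monoʳ-≤ ⟦ v == y ⟧ (union v ys))

  -- Edge lists, balls and short cycles.

  Edges : Set
  Edges = List (Fin n × Fin n)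

  at : Bool → Fin n → List (Fin n)
  at true  v = v ∷ []
  at false v = []

  length-at : ∀ b v → length (at b v) ≡ ⟦ b ⟧
  length-at true  v = refl
  length-at false v = refl

  nbrs : Edges → Fin n → List (Fin n)
  nbrs []            w = []
  nbrs ((x , y) ∷ E) w = at (w == x) y ++ (at (w == y) x ++ nbrs E w)

  deg : Edges → Fin n → ℕ
  deg E w = length (nbrs E w)

  deg-∷ : ∀ x y E w → deg ((x , y) ∷ E) w ≡ ⟦ w == x ⟧ + (⟦ w == y ⟧ + deg E w)
  deg-∷ x y E w = trans (length-++ (at (w == x) y)) (cong₂ _+_ (length-at (w == x) y)
    (trans (length-++ (at (w == y) x)) (cong (_+ deg E w) (length-at (w == y) x))))

  -- The handshake lemma; only an inequality, as `xs` need not contain both ends of every edge.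
  ∑-deg : ∀ xs → Distinct xs → ∀ E → sumOver xs (deg E) ≤ 2 * length E
  ∑-deg xs d []            = ≤-reflexive (trans (∑-const xs 0) (*-zeroʳ (length xs)))
  ∑-deg xs d ((x , y) ∷ E) = begin
    sumOver xs (deg ((x , y) ∷ E))                             ≡⟨ ∑-cong xs (deg-∷ x y E) ⟩
    (∑[ w ← xs ] (⟦ w == x ⟧ + (⟦ w == y ⟧ + deg E w)))        ≡⟨ ∑-+ xs _ _ ⟩
    count xs (_== x) + (∑[ w ← xs ] (⟦ w == y ⟧ + deg E w))    ≡⟨ cong (count xs (_== x) +_) (∑-+ xs _ _) ⟩
    count xs (_== x) + (count xs (_== y) + sumOver xs (deg E)) ≤⟨ +-mono-≤ (d x) (+-mono-≤ (d y) (∑-deg xs d E)) ⟩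
    1 + (1 + 2 * length E)                                     ≡⟨ *-suc 2 (length E) ⟨
    2 * suc (length E)                                         ∎
    where open ≤-Reasoning

  Joined : Edges → Fin n → Fin n → Set
  Joined E u v = (u , v) ∈ E ⊎ (v , u) ∈ E

  Joined-sym : ∀ {E u v} → Joined E u v → Joined E v u
  Joined-sym (inj₁ m) = inj₂ m
  Joined-sym (inj₂ m) = inj₁ m

  ∈-nbrs : ∀ E {u v} → Joined E u v → v ∈ nbrs E u
  ∈-nbrs ((x , y) ∷ E) {u} {v} (inj₁ (here refl)) rewrite ==-refl u = here refl
  ∈-nbrs ((x , y) ∷ E) {u} {v} (inj₂ (here refl)) rewrite ==-refl u = ∈-++⁺ʳ (at (u == x) y) (here refl)
  ∈-nbrs ((x , y) ∷ E) {u} {v} (inj₁ (there m)) = ∈-++⁺ʳ (at (u == x) y) (∈-++⁺ʳ (at (u == y) x) (∈-nbrs E (inj₁ m)))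
  ∈-nbrs ((x , y) ∷ E) {u} {v} (inj₂ (there m)) = ∈-++⁺ʳ (at (u == x) y) (∈-++⁺ʳ (at (u == y) x) (∈-nbrs E (inj₂ m)))

  -- A list with one entry per walk of length at most `j`, so vertices may repeat; only its length
  -- and its members matter.
  ball : Edges → ℕ → Fin n → List (Fin n)
  ball E zero    u = u ∷ []
  ball E (suc j) u = u ∷ concatMap (ball E j) (nbrs E u)

  length-concatMap : ∀ (f : Fin n → List (Fin n)) b → (∀ v → length (f v) ≤ b) → ∀ vs → length (concatMap f vs) ≤ length vs * b
  length-concatMap f b h []       = z≤n
  length-concatMap f b h (v ∷ vs) = ≤-trans (≤-reflexive (length-++ (f v))) (+-mono-≤ (h v) (length-concatMap f b h vs))

  length-ball : ∀ E b → (∀ v → deg E v ≤ b) → ∀ j u → length (ball E j u) ≤ suc b ^ j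
  length-ball E b h zero    u = ≤-refl
  length-ball E b h (suc j) u = +-mono-≤ (m^n>0 (suc b) j)
    (≤-trans (length-concatMap (ball E j) (suc b ^ j) (length-ball E b h j) (nbrs E u)) (*-monoˡ-≤ (suc b ^ j) (h u)))

  ∈-concatMap : ∀ (f : Fin n → List (Fin n)) {v w vs} → v ∈ vs → w ∈ f v → w ∈ concatMap f vs
  ∈-concatMap f {v} (here refl) m = ∈-++⁺ˡ m
  ∈-concatMap f {vs = v′ ∷ _} (there h) m = ∈-++⁺ʳ (f v′) (∈-concatMap f h m)

  data Walk (E : Edges) : ℕ → Fin n → Fin n → Set where
    done : ∀ {u} → Walk E 0 u u
    step : ∀ {j u v w} → Joined E u v → Walk E j v w → Walk E (suc j) u w

  walk⇒ball : ∀ {E j u v} r → Walk E j u v → j ≤ r → v ∈ ball E r u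
  walk⇒ball zero    done       _       = here refl
  walk⇒ball (suc r) done       _       = here refl
  walk⇒ball {E} (suc r) (step a w) (s≤s h) = there (∈-concatMap (ball E r) (∈-nbrs E a) (walk⇒ball r w h))

  -- An edge list is a history with the newest edge at its head. Each edge is tested only against
  -- those before it, so later additions never disturb the condition.
  data FarEdges (r : ℕ) : Edges → Set where
    []  : FarEdges r []
    _∷_ : ∀ {u v E} → elem v (ball E r u) ≡ false → FarEdges r E → FarEdges r ((u , v) ∷ E)

  module _ {E : Edges} (g : ℕ → Fin n) where

    walk-up : ∀ t s → (∀ i → i < t → Joined E (g (s + i)) (g (suc (s + i)))) → Walk E t (g s) (g (s + t))
    walk-up zero    s h = subst (λ i → Walk E 0 (g s) (g i)) (sym (+-identityʳ s)) done
    walk-up (suc t) s h = step (subst (λ i → Joined E (g i) (g (suc i))) (+-identityʳ s) (h 0 (s≤s z≤n)))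
      (subst (λ i → Walk E t (g (suc s)) (g i)) (sym (+-suc s t))
        (walk-up t (suc s) λ i l → subst (λ i → Joined E (g i) (g (suc i))) (+-suc s i) (h (suc i) (s≤s l))))

    walk-down : ∀ t s → (∀ i → i < t → Joined E (g (s + i)) (g (suc (s + i)))) → Walk E t (g (s + t)) (g s)
    walk-down zero    s h = subst (λ i → Walk E 0 (g i) (g s)) (sym (+-identityʳ s)) done
    walk-down (suc t) s h = subst (λ i → Walk E (suc t) (g i) (g s)) (sym (+-suc s t))
      (step (Joined-sym {E} (h t ≤-refl)) (walk-down t s λ i l → h i (m≤n⇒m≤1+n l)))

  -- A closed walk g 0, g 1, …, g L = g 0 around a cycle, continued periodically.
  record Cyclic (E : Edges) (L : ℕ) (g : ℕ → Fin n) : Set where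
    field
      edge     : ∀ j → Joined E (g j) (g (suc j))
      periodic : ∀ j → g (j + L) ≡ g j
      distinct : ∀ i j → i < j → j < i + L → g i ≢ g j

  Joined-∷⁻ : ∀ {x y E u v} → Joined ((x , y) ∷ E) u v → Joined E u v ⊎ ((u ≡ x × v ≡ y) ⊎ (u ≡ y × v ≡ x))
  Joined-∷⁻ (inj₁ (here refl)) = inj₂ (inj₁ (refl , refl))
  Joined-∷⁻ (inj₂ (here refl)) = inj₂ (inj₂ (refl , refl))
  Joined-∷⁻ (inj₁ (there m))   = inj₁ (inj₁ m)
  Joined-∷⁻ (inj₂ (there m))   = inj₁ (inj₂ m)

  -- The rest of a cycle through the newest edge would be a walk between its ends.
  no-short-cycle : ∀ {r E m g} → FarEdges r E → 2 ≤ m → m ≤ r → Cyclic E (suc m) g → ⊥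
  no-short-cycle {g = g} [] 2≤m m≤r cyc with Cyclic.edge cyc 0
  ... | inj₁ ()
  ... | inj₂ ()
  no-short-cycle {r} {(x , y) ∷ E} {m} {g} (far ∷ fars) 2≤m m≤r cyc = no-short-cycle fars 2≤m m≤r record
    { edge = λ j → [ (λ a → a) , (λ e → ⊥-elim (closing j e)) ]′ (Joined-∷⁻ (edge j)); periodic = periodic; distinct = distinct }
    where
    open Cyclic cyc
    Newest : ℕ → Set
    Newest j = (g j ≡ x × g (suc j) ≡ y) ⊎ (g j ≡ y × g (suc j) ≡ x)
    start-differs : ∀ j i → i < m → g j ≢ g (suc j + i)
    start-differs j i l = distinct j (suc j + i) (s≤s (m≤m+n j i)) (subst (_< j + suc m) (+-suc j i) (+-monoʳ-< j (s≤s l)))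
    -- Traversing the newest edge a second time, backwards, forces two coincidences. For i = 0 the
    -- one between `g j` and `g (j + 2)` fails since the cycle has length at least 3; for larger i
    -- the first one already fails.
    not-reversed : ∀ j i → i < m → g (suc j) ≡ g (suc j + i) → g j ≢ g (suc (suc j + i))
    not-reversed j zero    l _ = subst (λ k → g j ≢ g k) (+-suc (suc j) 0) (start-differs j 1 2≤m)
    not-reversed j (suc i) l e _ = distinct (suc j) (suc j + suc i) (s≤s (subst (j <_) (sym (+-suc j i)) (s≤s (m≤m+n j i))))
      (s≤s (+-monoʳ-< j (m≤n⇒m≤1+n l))) e
    once : ∀ j i → i < m → Newest j → Newest (suc j + i) → ⊥
    once j i l (inj₁ (a , b)) (inj₁ (c , d)) = start-differs j i l (trans a (sym c))
    once j i l (inj₂ (a , b)) (inj₂ (c , d)) = start-differs j i l (trans a (sym c))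
    once j i l (inj₁ (a , b)) (inj₂ (c , d)) = not-reversed j i l (trans b (sym c)) (trans a (sym d))
    once j i l (inj₂ (a , b)) (inj₁ (c , d)) = not-reversed j i l (trans b (sym c)) (trans a (sym d))
    others : ∀ j → Newest j → ∀ i → i < m → Joined E (g (suc j + i)) (g (suc (suc j + i)))
    others j new i l = [ (λ a → a) , (λ new′ → ⊥-elim (once j i l new new′)) ]′ (Joined-∷⁻ (edge (suc j + i)))
    back : ∀ j → g (suc j + m) ≡ g j
    back j = trans (cong g (sym (+-suc j m))) (periodic j)
    near : Walk E m x y → ⊥
    near w = false≢true far (elem-complete (walk⇒ball r w m≤r))
    -- The other m steps lead from g (j + 1) round to g j. They are read forwards or backwards so
    -- that the walk starts at x, the centre of the ball in `far`.
    closing : ∀ j → Newest j → ⊥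
    closing j new@(inj₁ (a , b)) = near (subst₂ (Walk E m) (trans (back j) a) b (walk-down g m (suc j) (others j new)))
    closing j new@(inj₂ (a , b)) = near (subst₂ (Walk E m) b (trans (back j) a) (walk-up g m (suc j) (others j new)))

module _ {n : ℕ} where

  module _ {m : ℕ} {E : Edges} (c : Fin (suc m) → Fin n) (inj : Injective _≡_ _≡_ c)
           (path : ∀ i → Joined E (c (inject₁ i)) (c (fsuc i))) (close : Joined E (c (last m)) (c fzero)) where

    -- Reading indices modulo m + 1 turns the closing edge into an ordinary step, so that a cycle
    -- can be entered at any of its edges.
    around : ℕ → Fin n
    around j = c (j mod suc m)

    private
      at-residue : ∀ {j} i → j % suc m ≡ toℕ i → around j ≡ c i
      at-residue {j} i e = cong c (Fin.toℕ-injective (trans (Fin.toℕ-fromℕ< (m%n<n j (suc m))) e))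

      suc-residue : ∀ j → suc j % suc m ≡ suc (j % suc m) % suc m
      suc-residue j = trans (cong (λ k → suc k % suc m) (m≡m%n+[m/n]*n j (suc m))) ([m+kn]%n≡m%n (suc (j % suc m)) (j div suc m) (suc m))

      around-distinct : ∀ i j → i < j → j < i + suc m → around i ≢ around j
      -- Equal vertices have equal residues, so i and j differ by a multiple of L; comparing
      -- quotients gives j ≤ i or i + L ≤ j.
      around-distinct i j i<j j<i+L e = [ (λ le → <⇒≱ i<j (quotient≤ le)) , (λ lt → <⇒≱ j<i+L (quotient> lt)) ]′ (≤-<-connex (j div suc m) (i div suc m))
        where
        L = suc m
        res : i % L ≡ j % L
        res = trans (sym (Fin.toℕ-fromℕ< (m%n<n i L))) (trans (cong toℕ (inj e)) (Fin.toℕ-fromℕ< (m%n<n j L)))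
        open ≤-Reasoning
        quotient≤ : j div L ≤ i div L → j ≤ i
        quotient≤ le = begin
          j                    ≡⟨ m≡m%n+[m/n]*n j L ⟩
          j % L + j div L * L    ≤⟨ +-mono-≤ (≤-reflexive (sym res)) (*-monoˡ-≤ L le) ⟩
          i % L + i div L * L    ≡⟨ m≡m%n+[m/n]*n i L ⟨
          i                    ∎
        quotient> : i div L < j div L → i + L ≤ j
        quotient> lt = begin
          i + L                      ≡⟨ cong (_+ L) (m≡m%n+[m/n]*n i L) ⟩
          i % L + i div L * L + L      ≡⟨ +-assoc (i % L) (i div L * L) L ⟩
          i % L + (i div L * L + L)    ≡⟨ cong₂ _+_ res (+-comm (i div L * L) L) ⟩
          j % L + suc (i div L) * L    ≤⟨ +-monoʳ-≤ (j % L) (*-monoˡ-≤ L lt) ⟩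
          j % L + j div L * L          ≡⟨ m≡m%n+[m/n]*n j L ⟨
          j                          ∎

    cyclic : Cyclic E (suc m) around
    cyclic = record { edge = edge ; periodic = λ j → cong c (Fin.fromℕ<-cong _ _ ([m+n]%n≡m%n j (suc m)) _ _) ; distinct = around-distinct }
      where
      edge : ∀ j → Joined E (around j) (around (suc j))
      edge j with j % suc m <? m
      ... | yes q<m = subst₂ (Joined E)
        (sym (at-residue {j} (inject₁ i) (sym (trans (Fin.toℕ-inject₁ i) i≡))))
        (sym (at-residue {suc j} (fsuc i) (trans (suc-residue j) (trans (m<n⇒m%n≡m (s≤s q<m)) (cong suc (sym i≡)))))) (path i)
        where
        i = fromℕ< q<m
        i≡ = Fin.toℕ-fromℕ< q<m
      ... | no q≮m = subst₂ (Joined E)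
        (sym (at-residue {j} (last m) (trans q≡m (sym (Fin.toℕ-fromℕ m)))))
        (sym (at-residue {suc j} fzero (trans (suc-residue j) (trans (cong (λ q → suc q % suc m) q≡m) (n%n≡0 (suc m)))))) close
        where
        q≡m : j % suc m ≡ m
        q≡m = ≤-antisym (≤-pred (m%n<n j (suc m))) (≮⇒≥ q≮m)

  -- Vertex sets as Boolean functions.

  Mask : Set
  Mask = Fin n → Bool

  _[_↦_] : Mask → Fin n → Bool → Mask
  (S [ x ↦ b ]) v with v Fin.≟ x
  ... | yes _ = b
  ... | no  _ = S v

  masks : List (Fin n) → List Mask
  masks []       = (λ _ → false) ∷ []
  masks (x ∷ xs) = map (_[ x ↦ true ]) (masks xs) ++ map (_[ x ↦ false ]) (masks xs)

  length-masks : ∀ xs → length (masks xs) ≡ 2 ^ length xs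
  length-masks []       = refl
  length-masks (x ∷ xs) = trans (length-++ (map (_[ x ↦ true ]) (masks xs)))
    (cong₂ _+_ (trans (length-map _ (masks xs)) (length-masks xs))
      (trans (length-map _ (masks xs)) (trans (length-masks xs) (sym (+-identityʳ (2 ^ length xs))))))

  -- Masks are functions, so a given set need not literally occur in the enumeration; a listed mask
  -- agreeing with it on `xs` takes its place.
  restrict : ∀ xs (p : Mask) → ∃[ S ] S ∈ masks xs × (∀ {v} → v ∈ xs → S v ≡ p v)
  restrict []       p = (λ _ → false) , here refl , λ ()
  restrict (x ∷ xs) p with restrict xs p
  ... | S , S∈ , agree = S [ x ↦ p x ] , mem (p x) , agree′
    where
    mem : ∀ b → (S [ x ↦ b ]) ∈ masks (x ∷ xs)
    mem true  = ∈-++⁺ˡ (∈-map⁺ (_[ x ↦ true ]) S∈)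
    mem false = ∈-++⁺ʳ (map (_[ x ↦ true ]) (masks xs)) (∈-map⁺ (_[ x ↦ false ]) S∈)
    agree′ : ∀ {v} → v ∈ x ∷ xs → (S [ x ↦ p x ]) v ≡ p v
    agree′ {v} m with v Fin.≟ x
    ... | yes refl = refl
    agree′ {v} (here v≡x) | no v≢x = contradiction v≡x v≢x
    agree′ {v} (there m)  | no v≢x = agree m

-- Greedy sparsification

*-^ : ∀ m n o → (m * n) ^ o ≡ m ^ o * n ^ o
*-^ m n zero    = refl
*-^ m n (suc o) = trans (cong (m * n *_) (*-^ m n o)) (interchange m n (m ^ o) (n ^ o))
  where
  interchange : ∀ a b c d → a * b * (c * d) ≡ a * c * (b * d)
  interchange = solve-∀

bernoulli : ∀ q m → q ^ suc m + suc m * q ^ m ≤ suc q ^ suc m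
bernoulli q zero    = ≤-reflexive (lemma q)
  where
  lemma : ∀ q → q * 1 + (1 + 0) ≡ (1 + q) * 1
  lemma = solve-∀
bernoulli q (suc m) = begin
  q * (q * q ^ m) + (q * q ^ m + suc m * (q * q ^ m))                          ≤⟨ m≤m+n _ (suc m * q ^ m) ⟩
  q * (q * q ^ m) + (q * q ^ m + suc m * (q * q ^ m)) + suc m * q ^ m          ≡⟨ lemma q m (q ^ m) ⟩
  suc q * (q ^ suc m + suc m * q ^ m)                                          ≤⟨ *-monoʳ-≤ (suc q) (bernoulli q m) ⟩
  suc q * suc q ^ suc m                                                        ∎
  where
  open ≤-Reasoning
  lemma : ∀ q m p → q * (q * p) + (q * p + (1 + m) * (q * p)) + (1 + m) * p ≡ (1 + q) * (q * p + (1 + m) * p)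
  lemma = solve-∀

-- With Q = q + 1, Bernoulli's inequality gives (1 - 1/Q)^Q ≤ 1/2. Then x + 1 blocks of Q steps
-- bring 2^x below 1, the extra block giving strictness.
decay : ∀ q x → 1 ≤ q → 2 ^ x * q ^ (suc q * suc x) < suc q ^ (suc q * suc x)
decay q x 1≤q = begin-strict
  2 ^ x * q ^ (suc q * suc x)          <⟨ *-monoˡ-< (q ^ (suc q * suc x)) {{m^n≢0 q (suc q * suc x) {{>-nonZero 1≤q}}}} (^-monoʳ-< 2 ≤-refl (n<1+n x)) ⟩
  2 ^ suc x * q ^ (suc q * suc x)      ≡⟨ cong (2 ^ suc x *_) (^-*-assoc q (suc q) (suc x)) ⟨
  2 ^ suc x * (q ^ suc q) ^ suc x      ≡⟨ *-^ 2 (q ^ suc q) (suc x) ⟨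
  (2 * q ^ suc q) ^ suc x              ≤⟨ ^-monoˡ-≤ (suc x) double ⟩
  (suc q ^ suc q) ^ suc x              ≡⟨ ^-*-assoc (suc q) (suc q) (suc x) ⟩
  suc q ^ (suc q * suc x)              ∎
  where
  open ≤-Reasoning
  double : 2 * q ^ suc q ≤ suc q ^ suc q
  double = begin
    2 * q ^ suc q                 ≡⟨ cong (q ^ suc q +_) (+-identityʳ (q ^ suc q)) ⟩
    q ^ suc q + q ^ suc q         ≤⟨ +-monoʳ-≤ (q ^ suc q) (*-monoˡ-≤ (q ^ q) (n≤1+n q)) ⟩
    q ^ suc q + suc q * q ^ q     ≤⟨ bernoulli q q ⟩
    suc q ^ suc q                 ∎

-- The hypothesis on `total` says that f + 1 rounds, each removing a share of at least 1 / (q + 1),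
-- leave less than one element; one round is spent here. Both the family of sets and the vertices
-- being peeled are exhausted this way.
shrink : ∀ q f {rest part total} → rest + part ≡ total → total ≤ suc q * part →
  total * q ^ suc f < suc q ^ suc f → rest * q ^ f < suc q ^ f
shrink q f {rest} {part} {total} split large h = *-cancelˡ-< (suc q) (rest * q ^ f) (suc q ^ f) (begin-strict
  suc q * (rest * q ^ f)    ≡⟨ *-assoc (suc q) rest (q ^ f) ⟨
  suc q * rest * q ^ f      ≤⟨ *-monoˡ-≤ (q ^ f) few ⟩
  q * total * q ^ f         ≡⟨ lemma q total (q ^ f) ⟩
  total * q ^ suc f         <⟨ h ⟩
  suc q ^ suc f             ∎)
  where
  open ≤-Reasoning
  lemma : ∀ q t p → q * t * p ≡ t * (q * p)
  lemma = solve-∀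
  few : suc q * rest ≤ q * total
  few = +-cancelʳ-≤ total (suc q * rest) (q * total) (begin
    suc q * rest + total              ≤⟨ +-monoʳ-≤ (suc q * rest) large ⟩
    suc q * rest + suc q * part       ≡⟨ *-distribˡ-+ (suc q) rest part ⟨
    suc q * (rest + part)             ≡⟨ cong (suc q *_) split ⟩
    suc q * total                     ≡⟨ +-comm total (q * total) ⟩
    q * total + total                 ∎)

pairs : ∀ {X : Set} → List X → (X → X → ℕ) → ℕ
pairs A h = ∑[ u ← A ] ∑[ v ← A ] h u v

pairs-+ : ∀ {X : Set} (A : List X) (f g : X → X → ℕ) → pairs A (λ u v → f u v + g u v) ≡ pairs A f + pairs A g
pairs-+ A f g = trans (∑-cong A λ u → ∑-+ A (f u) (g u)) (∑-+ A (λ u → sumOver A (f u)) (λ u → sumOver A (g u)))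

pairs-mono : ∀ {X : Set} (A : List X) {f g : X → X → ℕ} → (∀ u v → f u v ≤ g u v) → pairs A f ≤ pairs A g
pairs-mono A h = ∑-mono A λ u _ → ∑-mono A λ v _ → h u v

-- Ordered pairs are counted, so this is the degree sum inside `S`; hence the factor 2 when average
-- degree is compared with Δ′ / 2.
spanned : (Fin n → Fin n → Bool) → List (Fin n) → Mask → ℕ
spanned a A S = pairs A (λ u v → ⟦ S u ⟧ * (⟦ S v ⟧ * ⟦ a u v ⟧))

Hits : Edges → Mask {n} → Set
Hits E S = ∃[ u ] ∃[ v ] (u , v) ∈ E × S u ≡ true × S v ≡ true

-- 𝓢 holds the large vertex sets spanning no edge of E yet. An edge is ok if both ends have
-- degree below b in E and they are at distance greater than r, so that adding it keeps all
-- cycles longer than r. By averaging, some ok edge lies in at least 1 / Q of the sets in 𝓢.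
module Sparsify (a : Fin n → Fin n → Bool) (a-sym : ∀ u v → a u v ≡ a v u) (A : List (Fin n)) (distinct : Distinct A)
  (r k K Δ′ q b : ℕ) (Q≡ : suc q ≡ 8 * (k * K)) (b≡ : b ≡ 64 * (k * K) * suc q) (1≤k : 1 ≤ k) (1≤K : 1 ≤ K) (1≤Δ′ : 1 ≤ Δ′) (nonempty : 1 ≤ length A)
  (deg≤ : ∀ u → u ∈ A → count A (a u) ≤ Δ′ * K)
  (dense : ∀ S → S ∈ masks A → length A ≤ k * count A S → count A S * Δ′ ≤ 2 * spanned a A S) where

  private
    Q β N M : ℕ
    Q = suc q
    β = suc (suc b) ^ r
    N = length A
    M = Q * suc N

  module _ (8kβ≤Δ′ : 8 * (k * β) ≤ Δ′) where

    full : Edges → Fin n → Bool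
    full E v = b ≤ᵇ deg E v

    ok : Edges → Fin n → Fin n → Bool
    ok E u v = a u v ∧ (not (full E u) ∧ (not (full E v) ∧ not (elem v (ball E r u))))

    -- A union bound over the three reasons for which an edge is forbidden. The error terms no
    -- longer mention `S`, so they can be summed over all of `A`.
    ok-split : ∀ s t a f g c → ⟦ s ⟧ * (⟦ t ⟧ * ⟦ a ⟧) ≤
      ⟦ s ⟧ * (⟦ t ⟧ * ⟦ a ∧ (not f ∧ (not g ∧ not c)) ⟧) + (⟦ f ⟧ * ⟦ a ⟧ + (⟦ g ⟧ * ⟦ a ⟧ + ⟦ c ⟧))
    ok-split false t     a     f     g     c     = z≤n
    ok-split true  false a     f     g     c     = z≤n
    ok-split true  true  false f     g     c     = z≤n
    ok-split true  true  true  true  g     c     = s≤s z≤n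
    ok-split true  true  true  false true  c     = s≤s z≤n
    ok-split true  true  true  false false true  = s≤s z≤n
    ok-split true  true  true  false false false = s≤s z≤n

    -- Density gives 4NΔ′ ≤ 8k times the pairs spanned by S. Pairs at full vertices and pairs at
    -- short distance each account for at most NΔ′ of this, so NΔ′ ≤ 4kt remains. With Q = 8kK the
    -- result exceeds N Δ′ K, which bounds the degree sum of `A`; the `suc` is for strict averaging.
    ok-spanned-large : ∀ E → length E ≤ M → (∀ v → deg E v ≤ suc b) → ∀ S → S ∈ masks A → N ≤ k * count A S →
      suc (N * (Δ′ * K)) ≤ Q * spanned (ok E) A S
    ok-spanned-large E E≤M deg≤b S S∈ big = begin
      suc (N * (Δ′ * K))          ≤⟨ +-monoˡ-≤ (N * (Δ′ * K)) (*-mono-≤ nonempty (*-mono-≤ 1≤Δ′ 1≤K)) ⟩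
      N * (Δ′ * K) + N * (Δ′ * K) ≡⟨ lemma₁ N Δ′ K ⟩
      2 * K * (N * Δ′)            ≤⟨ *-monoʳ-≤ (2 * K) NΔ′≤ ⟩
      2 * K * (4 * (k * t))       ≡⟨ lemma₂ k K t ⟩
      8 * (k * K) * t             ≡⟨ cong (_* t) Q≡ ⟨
      Q * t                       ∎
      where
      open ≤-Reasoning
      t F : ℕ
      t = spanned (ok E) A S
      F = count A (full E)
      Δ = Δ′ * K
      lemma₁ : ∀ N D K → N * (D * K) + N * (D * K) ≡ 2 * K * (N * D)
      lemma₁ = solve-∀
      lemma₂ : ∀ k K t → 2 * K * (4 * (k * t)) ≡ 8 * (k * K) * t
      lemma₂ = solve-∀
      at-full : (∑[ u ← A ] ⟦ full E u ⟧ * count A (a u)) ≤ F * Δ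
      at-full = begin
        (∑[ u ← A ] ⟦ full E u ⟧ * count A (a u)) ≤⟨ ∑-mono A (λ u u∈ → *-monoʳ-≤ ⟦ full E u ⟧ (deg≤ u u∈)) ⟩
        (∑[ u ← A ] ⟦ full E u ⟧ * Δ)             ≡⟨ ∑-cong A (λ u → *-comm ⟦ full E u ⟧ Δ) ⟩
        (∑[ u ← A ] Δ * ⟦ full E u ⟧)             ≡⟨ ∑-*ˡ A Δ (λ u → ⟦ full E u ⟧) ⟩
        Δ * F                                     ≡⟨ *-comm Δ F ⟩
        F * Δ                                     ∎
      full₁ : pairs A (λ u v → ⟦ full E u ⟧ * ⟦ a u v ⟧) ≤ F * Δ
      full₁ = ≤-trans (≤-reflexive (∑-cong A λ u → ∑-*ˡ A ⟦ full E u ⟧ (λ v → ⟦ a u v ⟧))) at-full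
      full₂ : pairs A (λ u v → ⟦ full E v ⟧ * ⟦ a u v ⟧) ≤ F * Δ
      full₂ = ≤-trans (≤-reflexive (trans (∑-swap A A (λ u v → ⟦ full E v ⟧ * ⟦ a u v ⟧))
        (∑-cong A λ v → trans (∑-*ˡ A ⟦ full E v ⟧ (λ u → ⟦ a u v ⟧)) (cong (⟦ full E v ⟧ *_) (∑-cong A λ u → cong ⟦_⟧ (a-sym u v)))))) at-full
      close : pairs A (λ u v → ⟦ elem v (ball E r u) ⟧) ≤ N * β
      close = ≤-trans (∑-mono A λ u _ → ≤-trans (count-elem A distinct (ball E r u)) (length-ball E (suc b) deg≤b r u)) (≤-reflexive (∑-const A β))
      spanned≤ : spanned a A S ≤ t + (F * Δ + (F * Δ + N * β))
      spanned≤ = begin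
        spanned a A S
          ≤⟨ pairs-mono A (λ u v → ok-split (S u) (S v) (a u v) (full E u) (full E v) (elem v (ball E r u))) ⟩
        pairs A (λ u v → ⟦ S u ⟧ * (⟦ S v ⟧ * ⟦ ok E u v ⟧) + (⟦ full E u ⟧ * ⟦ a u v ⟧ + (⟦ full E v ⟧ * ⟦ a u v ⟧ + ⟦ elem v (ball E r u) ⟧)))
          ≡⟨ trans (pairs-+ A _ _) (cong (t +_) (trans (pairs-+ A _ _) (cong (pairs A (λ u v → ⟦ full E u ⟧ * ⟦ a u v ⟧) +_) (pairs-+ A _ _)))) ⟩
        t + (pairs A (λ u v → ⟦ full E u ⟧ * ⟦ a u v ⟧) + (pairs A (λ u v → ⟦ full E v ⟧ * ⟦ a u v ⟧) + pairs A (λ u v → ⟦ elem v (ball E r u) ⟧)))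
          ≤⟨ +-monoʳ-≤ t (+-mono-≤ full₁ (+-mono-≤ full₂ close)) ⟩
        t + (F * Δ + (F * Δ + N * β)) ∎
      few-full : F * b ≤ 2 * M
      few-full = begin
        F * b                                 ≡⟨ *-comm F b ⟩
        b * F                                 ≡⟨ ∑-*ˡ A b (λ v → ⟦ full E v ⟧) ⟨
        (∑[ v ← A ] b * ⟦ full E v ⟧)         ≤⟨ ∑-mono A (λ v _ → threshold v) ⟩
        sumOver A (deg E)                     ≤⟨ ∑-deg A distinct E ⟩
        2 * length E                          ≤⟨ *-monoʳ-≤ 2 E≤M ⟩
        2 * M                                 ∎
        where
        threshold : ∀ v → b * ⟦ full E v ⟧ ≤ deg E v
        threshold v with full E v in eq
        ... | true  = ≤-trans (≤-reflexive (*-identityʳ b)) (≤ᵇ⇒≤ b (deg E v) (Equivalence.from T-≡ eq))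
        ... | false = ≤-trans (≤-reflexive (*-zeroʳ b)) z≤n
      -- This fixes the constant in b = 64kKQ: the degree sum gives F b ≤ 2M = 2Q(N + 1) ≤ 4QN.
      16kKF≤N : 16 * (k * (F * K)) ≤ N
      16kKF≤N = *-cancelˡ-≤ (4 * Q) (begin
        4 * Q * (16 * (k * (F * K)))  ≡⟨ lemma Q k F K ⟩
        F * (64 * (k * K) * Q)        ≡⟨ cong (F *_) b≡ ⟨
        F * b                         ≤⟨ few-full ⟩
        2 * (Q * (1 + N))             ≤⟨ *-monoʳ-≤ 2 (*-monoʳ-≤ Q (+-monoˡ-≤ N nonempty)) ⟩
        2 * (Q * (N + N))             ≡⟨ lemma′ Q N ⟩
        4 * Q * N                     ∎)
        where
        lemma : ∀ Q k F K → 4 * Q * (16 * (k * (F * K))) ≡ F * (64 * (k * K) * Q)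
        lemma = solve-∀
        lemma′ : ∀ Q N → 2 * (Q * (N + N)) ≡ 4 * Q * N
        lemma′ = solve-∀
      NΔ′≤ : N * Δ′ ≤ 4 * (k * t)
      NΔ′≤ = *-cancelˡ-≤ 2 (+-cancelʳ-≤ (N * Δ′ + N * Δ′) (2 * (N * Δ′)) (2 * (4 * (k * t))) (begin
        2 * (N * Δ′) + (N * Δ′ + N * Δ′)                            ≡⟨ lemma₃ (N * Δ′) ⟩
        4 * (N * Δ′)                                                ≤⟨ *-monoʳ-≤ 4 (*-monoˡ-≤ Δ′ big) ⟩
        4 * (k * count A S * Δ′)                                    ≡⟨ cong (4 *_) (*-assoc k (count A S) Δ′) ⟩
        4 * (k * (count A S * Δ′))                                  ≤⟨ *-monoʳ-≤ 4 (*-monoʳ-≤ k (≤-trans (dense S S∈ big) (*-monoʳ-≤ 2 spanned≤))) ⟩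
        4 * (k * (2 * (t + (F * Δ + (F * Δ + N * β)))))             ≡⟨ lemma₄ k t F Δ′ K N β ⟩
        2 * (4 * (k * t)) + (16 * (k * (F * K)) * Δ′ + N * (8 * (k * β))) ≤⟨ +-monoʳ-≤ (2 * (4 * (k * t))) (+-mono-≤ (*-monoˡ-≤ Δ′ 16kKF≤N) (*-monoʳ-≤ N 8kβ≤Δ′)) ⟩
        2 * (4 * (k * t)) + (N * Δ′ + N * Δ′)                       ∎))
        where
        lemma₃ : ∀ x → 2 * x + (x + x) ≡ 4 * x
        lemma₃ = solve-∀
        lemma₄ : ∀ k t F D K N β → 4 * (k * (2 * (t + (F * (D * K) + (F * (D * K) + N * β))))) ≡ 2 * (4 * (k * t)) + (16 * (k * (F * K)) * D + N * (8 * (k * β)))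
        lemma₄ = solve-∀

    Popular : Edges → List Mask → Fin n × Fin n → Set
    Popular E 𝓢 (u , v) = u ∈ A × v ∈ A × ok E u v ≡ true × length 𝓢 ≤ Q * count 𝓢 (λ S → S u ∧ S v)

    module _ (E : Edges {n}) (E≤M : length E ≤ M) (deg≤b : ∀ v → deg E v ≤ suc b) (𝓢 : List (Mask {n})) (1≤𝓢 : 1 ≤ length 𝓢)
             (large : ∀ S → S ∈ 𝓢 → S ∈ masks A × N ≤ k * count A S) where

      private
        hit : Bool → Fin n → Fin n → Mask → ℕ
        hit o u v S = ⟦ S u ⟧ * (⟦ S v ⟧ * ⟦ o ⟧)

      -- Incidences between the sets of 𝓢 and the ok pairs are counted twice. The left side weighs
      -- every edge of `A` by the size of 𝓢, so a pair with strict inequality is hit by a share of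
      -- at least 1 / Q.
      weighted : pairs A (λ u v → length 𝓢 * ⟦ a u v ⟧) < pairs A (λ u v → Q * (sumOver 𝓢 (hit (ok E u v) u v)))
      weighted = begin-strict
        pairs A (λ u v → length 𝓢 * ⟦ a u v ⟧)              ≡⟨ ∑-cong A (λ u → ∑-*ˡ A (length 𝓢) (λ v → ⟦ a u v ⟧)) ⟩
        (∑[ u ← A ] length 𝓢 * count A (a u))               ≤⟨ ∑-mono A (λ u u∈ → *-monoʳ-≤ (length 𝓢) (deg≤ u u∈)) ⟩
        (∑[ u ← A ] length 𝓢 * (Δ′ * K))                    ≡⟨ ∑-const A (length 𝓢 * (Δ′ * K)) ⟩
        N * (length 𝓢 * (Δ′ * K))                           ≡⟨ lemma N (length 𝓢) (Δ′ * K) ⟩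
        length 𝓢 * (N * (Δ′ * K))                           <⟨ *-monoʳ-< (length 𝓢) {{>-nonZero 1≤𝓢}} (n<1+n (N * (Δ′ * K))) ⟩
        length 𝓢 * suc (N * (Δ′ * K))                       ≡⟨ ∑-const 𝓢 (suc (N * (Δ′ * K))) ⟨
        (∑[ S ← 𝓢 ] suc (N * (Δ′ * K)))                     ≤⟨ ∑-mono 𝓢 (λ S S∈ → ok-spanned-large E E≤M deg≤b S (proj₁ (large S S∈)) (proj₂ (large S S∈))) ⟩
        (∑[ S ← 𝓢 ] Q * spanned (ok E) A S)                 ≡⟨ ∑-*ˡ 𝓢 Q (spanned (ok E) A) ⟩
        Q * (∑[ S ← 𝓢 ] spanned (ok E) A S)                 ≡⟨ cong (Q *_) (∑-swap 𝓢 A (λ S u → ∑[ v ← A ] hit (ok E u v) u v S)) ⟩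
        Q * (∑[ u ← A ] ∑[ S ← 𝓢 ] ∑[ v ← A ] hit (ok E u v) u v S)
          ≡⟨ cong (Q *_) (∑-cong A λ u → ∑-swap 𝓢 A (λ S v → hit (ok E u v) u v S)) ⟩
        Q * pairs A (λ u v → sumOver 𝓢 (hit (ok E u v) u v))
          ≡⟨ ∑-*ˡ A Q (λ u → ∑[ v ← A ] sumOver 𝓢 (hit (ok E u v) u v)) ⟨
        (∑[ u ← A ] Q * (∑[ v ← A ] sumOver 𝓢 (hit (ok E u v) u v)))
          ≡⟨ ∑-cong A (λ u → ∑-*ˡ A Q (λ v → sumOver 𝓢 (hit (ok E u v) u v))) ⟨
        pairs A (λ u v → Q * sumOver 𝓢 (hit (ok E u v) u v)) ∎
        where
        open ≤-Reasoning
        lemma : ∀ x y z → x * (y * z) ≡ y * (x * z)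
        lemma x y z = trans (sym (*-assoc x y z)) (trans (cong (_* z) (*-comm x y)) (*-assoc y x z))

      -- A pair that is not ok has right side 0, which the strict inequality excludes; an ok pair is
      -- an edge, so its weight on the left is the full size of 𝓢.
      hit-count : ∀ u v x y → (y ≡ true → x ≡ true) → length 𝓢 * ⟦ x ⟧ < Q * sumOver 𝓢 (hit y u v) →
        y ≡ true × length 𝓢 ≤ Q * count 𝓢 (λ S → S u ∧ S v)
      hit-count u v x false imp lt = contradiction z≤n (<⇒≱ (subst (length 𝓢 * ⟦ x ⟧ <_) Q*0 lt))
        where
        none : sumOver 𝓢 (hit false u v) ≡ 0
        none = trans (∑-cong 𝓢 λ S → trans (cong (⟦ S u ⟧ *_) (*-zeroʳ ⟦ S v ⟧)) (*-zeroʳ ⟦ S u ⟧))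
          (trans (∑-const 𝓢 0) (*-zeroʳ (length 𝓢)))
        Q*0 : Q * sumOver 𝓢 (hit false u v) ≡ 0
        Q*0 = trans (cong (Q *_) none) (*-zeroʳ Q)
      hit-count u v x true imp lt rewrite imp refl = refl , ≤-trans (≤-reflexive (sym (*-identityʳ (length 𝓢))))
        (≤-trans (<⇒≤ lt) (≤-reflexive (cong (Q *_) (∑-cong 𝓢 λ S → trans (cong (⟦ S u ⟧ *_) (*-identityʳ ⟦ S v ⟧)) (sym (⟦∧⟧ (S u) (S v)))))))

      popular-edge : ∃ (Popular E 𝓢)
      popular-edge =
        let u , u∈ , lt  = ∑-< A (λ u → ∑[ v ← A ] Q * sumOver 𝓢 (hit (ok E u v) u v)) (λ u → ∑[ v ← A ] length 𝓢 * ⟦ a u v ⟧) weighted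
            v , v∈ , lt′ = ∑-< A (λ v → Q * sumOver 𝓢 (hit (ok E u v) u v)) (λ v → length 𝓢 * ⟦ a u v ⟧) lt
            o , c        = hit-count u v (a u v) (ok E u v) (λ h → proj₁ (∧-true h)) lt′
        in (u , v) , u∈ , v∈ , o , c

    -- `f` counts the steps left. At f = 0 the inequality `few` makes 𝓢 empty, and as soon as 𝓢 is
    -- empty `covering` becomes the desired conclusion.
    record Invariant (f : ℕ) (E : Edges) (𝓢 : List Mask) : Set where
      field
        steps    : f + length E ≤ M
        deg≤b    : ∀ v → deg E v ≤ suc b
        far      : FarEdges r E
        inside   : ∀ {u v} → (u , v) ∈ E → a u v ≡ true × u ∈ A × v ∈ A
        large    : ∀ S → S ∈ 𝓢 → S ∈ masks A × N ≤ k * count A S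
        covering : ∀ S → S ∈ masks A → N ≤ k * count A S → S ∈ 𝓢 ⊎ Hits E S
        few      : length 𝓢 * q ^ f < Q ^ f

    Sparse : Set
    Sparse = ∃[ E ] FarEdges r E × (∀ {u v} → (u , v) ∈ E → a u v ≡ true × u ∈ A × v ∈ A) ×
      (∀ S → S ∈ masks A → N ≤ k * count A S → Hits E S)

    not-full : ∀ E v → not (full E v) ≡ true → deg E v < b
    not-full E v h = ≰⇒> λ le → false≢true (not-true h) (Equivalence.to T-≡ (≤⇒≤ᵇ le))

    -- A degree below `b` could rise by 2 if the two ends coincided, a case not separated here;
    -- hence the cap `suc b`.
    deg-new : ∀ (E : Edges {n}) {u v} → deg E u < b → deg E v < b → (∀ w → deg E w ≤ suc b) → ∀ w → deg ((u , v) ∷ E) w ≤ suc b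
    deg-new E {u} {v} hu hv h w rewrite deg-∷ u v E w with w == u in e | w == v in e′
    ... | true  | x     rewrite ==-sound {n} {u = w} e  = s≤s (≤-trans (+-monoˡ-≤ (deg E u) (⟦⟧≤1 x)) hu)
      where
      ⟦⟧≤1 : ∀ x → ⟦ x ⟧ ≤ 1
      ⟦⟧≤1 true  = ≤-refl
      ⟦⟧≤1 false = z≤n
    ... | false | true  rewrite ==-sound {n} {u = w} e′ = m≤n⇒m≤1+n hv
    ... | false | false = h w

    next : ∀ {f E 𝓢 u v} → Invariant (suc f) E 𝓢 → Popular E 𝓢 (u , v) →
      Invariant f ((u , v) ∷ E) (filterᵇ (λ S → not (S u ∧ S v)) 𝓢)
    next {f} {E} {𝓢} {u} {v} inv (u∈ , v∈ , o , pop) with ∧-true {a u v} o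
    ... | auv , o′ with ∧-true {not (full E u)} o′
    ... | fu , o″ with ∧-true {not (full E v)} o″
    ... | fv , c = record
      { steps    = ≤-trans (≤-reflexive (+-suc f (length E))) steps
      ; deg≤b    = deg-new E (not-full E u fu) (not-full E v fv) deg≤b
      ; far      = not-true c ∷ far
      ; inside   = λ { (here refl) → auv , u∈ , v∈ ; (there m) → inside m }
      ; large    = λ S S∈ → large S (proj₁ (∈-filterᵇ⁻ missed S∈))
      ; covering = covering′
      ; few      = shrink q f (trans (cong (_+ count 𝓢 hit) (length-filter 𝓢 missed)) (count-not 𝓢 hit)) pop few
      }
      where
      open Invariant inv
      hit missed : Mask → Bool
      hit S = S u ∧ S v
      missed S = not (hit S)
      covering′ : ∀ S → S ∈ masks A → N ≤ k * count A S → S ∈ filterᵇ missed 𝓢 ⊎ Hits ((u , v) ∷ E) S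
      covering′ S S∈ big with covering S S∈ big
      ... | inj₂ (x , y , m , h) = inj₂ (x , y , there m , h)
      ... | inj₁ S∈𝓢 with hit S in e
      ...   | true  = inj₂ (u , v , here refl , ∧-true e)
      ...   | false = inj₁ (∈-filterᵇ⁺ missed S∈𝓢 (cong not e))

    run : ∀ f E 𝓢 → Invariant f E 𝓢 → Sparse
    run f E [] inv = E , far , inside , λ S S∈ big → [ (λ ()) , (λ h → h) ]′ (covering S S∈ big)
      where open Invariant inv
    run zero E (S ∷ 𝓢) inv = contradiction (Invariant.few inv) (≤⇒≯ (s≤s z≤n))
    run (suc f) E 𝓢@(_ ∷ _) inv = run f _ _ (next inv (proj₂ (popular-edge E (≤-trans (m≤n+m (length E) (suc f)) steps) deg≤b 𝓢 (s≤s z≤n) large)))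
      where open Invariant inv

    sparse : Sparse
    sparse = run M [] 𝓢 record
      { steps    = ≤-reflexive (+-identityʳ M)
      ; deg≤b    = λ _ → z≤n
      ; far      = []
      ; inside   = λ ()
      ; large    = λ S S∈ → let m , t = ∈-filterᵇ⁻ large? S∈ in m , ≤ᵇ⇒≤ N (k * count A S) (Equivalence.from T-≡ t)
      ; covering = λ S S∈ big → inj₁ (∈-filterᵇ⁺ large? S∈ (Equivalence.to T-≡ (≤⇒≤ᵇ big)))
      ; few      = ≤-<-trans (*-monoˡ-≤ (q ^ M) 𝓢≤) (decay q N 1≤q)
      }
      where
      large? : Mask → Bool
      large? S = N ≤ᵇ k * count A S
      𝓢 = filterᵇ large? (masks A)
      𝓢≤ : length 𝓢 ≤ 2 ^ N
      𝓢≤ = begin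
        length 𝓢                                                  ≡⟨ length-filter (masks A) large? ⟩
        count (masks A) large?                                    ≤⟨ m≤n+m _ (count (masks A) (not ∘ large?)) ⟩
        count (masks A) (not ∘ large?) + count (masks A) large?   ≡⟨ count-not (masks A) large? ⟩
        length (masks A)                                          ≡⟨ length-masks A ⟩
        2 ^ N                                                     ∎
        where open ≤-Reasoning
      1≤q : 1 ≤ q
      1≤q = ≤-pred (≤-trans (*-mono-≤ (s≤s (s≤s (z≤n {6}))) (*-mono-≤ 1≤k 1≤K)) (≤-reflexive (sym Q≡)))

-- Colourings

≡ᵇ-refl : ∀ m → (m ≡ᵇ m) ≡ true
≡ᵇ-refl m = Equivalence.to T-≡ (≡⇒≡ᵇ m m refl)

≡ᵇ-sound : ∀ {m n} → (m ≡ᵇ n) ≡ true → m ≡ n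
≡ᵇ-sound {m} {n} h = ≡ᵇ⇒≡ m n (Equivalence.from T-≡ h)

-- The pigeonhole principle by averaging. Comparing with `pred N` supplies the strictness that `∑-<`
-- needs, and the strict inequality it returns is N ≤ the desired product.
popular-value : ∀ {X : Set} (A : List X) (c : X → ℕ) j k → 1 ≤ length A → (∀ {v} → v ∈ A → c v < j) → j ≤ k →
  ∃[ i ] length A ≤ k * count A (λ v → c v ≡ᵇ i)
popular-value A c j k nonempty c<j j≤k =
  let i , _ , lt = ∑-< (upTo j) (λ i → k * count A (λ v → c v ≡ᵇ i)) (λ _ → pred N) total
  in i , ≤-trans (≤-reflexive (sym (suc-pred N {{>-nonZero nonempty}}))) lt
  where
  N = length A
  open ≤-Reasoning
  covered : N ≤ (∑[ i ← upTo j ] count A (λ v → c v ≡ᵇ i))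
  covered = begin
    N                                                  ≡⟨ length≡∑1 A ⟩
    (∑[ v ← A ] 1)                                     ≤⟨ ∑-mono A (λ v v∈ → ≤-trans (≤-reflexive (cong ⟦_⟧ (sym (≡ᵇ-refl (c v))))) (term≤∑ (λ i → ⟦ c v ≡ᵇ i ⟧) (∈-upTo⁺ (c<j v∈)))) ⟩
    (∑[ v ← A ] ∑[ i ← upTo j ] ⟦ c v ≡ᵇ i ⟧)          ≡⟨ ∑-swap A (upTo j) (λ v i → ⟦ c v ≡ᵇ i ⟧) ⟩
    (∑[ i ← upTo j ] count A (λ v → c v ≡ᵇ i))         ∎
  total : (∑[ i ← upTo j ] pred N) < (∑[ i ← upTo j ] k * count A (λ v → c v ≡ᵇ i))
  total = begin-strict
    (∑[ i ← upTo j ] pred N)                             ≡⟨ ∑-const (upTo j) (pred N) ⟩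
    length (upTo j) * pred N                             ≡⟨ cong (_* pred N) (length-upTo j) ⟩
    j * pred N                                           ≤⟨ *-monoˡ-≤ (pred N) j≤k ⟩
    k * pred N                                           <⟨ *-monoʳ-< k {{>-nonZero 1≤k}} (≤-reflexive (suc-pred N {{>-nonZero nonempty}})) ⟩
    k * N                                                ≤⟨ *-monoʳ-≤ k covered ⟩
    k * (∑[ i ← upTo j ] count A (λ v → c v ≡ᵇ i))       ≡⟨ ∑-*ˡ (upTo j) k (λ i → count A (λ v → c v ≡ᵇ i)) ⟨
    (∑[ i ← upTo j ] k * count A (λ v → c v ≡ᵇ i))       ∎
    where
    1≤k : 1 ≤ k
    1≤k = some A nonempty c<j
      where
      some : ∀ A → 1 ≤ length A → (∀ {v} → v ∈ A → c v < j) → 1 ≤ k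
      some (x ∷ _) _ h = ≤-trans (s≤s z≤n) (≤-trans (h (here refl)) j≤k)

-- If all of 0, ..., `length L` occurred, their positions would inject a set of size `length L` + 1
-- into one of size `length L`.
fresh : ∀ (L : List ℕ) → ∃[ i ] i ≤ length L × ¬ (i ∈ L)
fresh L with anyUpTo? (λ i → ¬? (i ∈? L)) (suc (length L))
  where open DecMembership _≟_ using (_∈?_)
... | yes (i , s≤s i≤ , i∉) = i , i≤ , i∉
... | no all = contradiction (Fin.injective⇒≤ {f = λ i → index (mem i)} inj) (<⇒≱ ≤-refl)
  where
  open DecMembership _≟_ using (_∈?_)
  mem : ∀ (i : Fin (suc (length L))) → toℕ i ∈ L
  mem i = decidable-stable (toℕ i ∈? L) λ i∉ → all (toℕ i , Fin.toℕ<n i , i∉)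
  inj : ∀ {i j} → index (mem i) ≡ index (mem j) → i ≡ j
  inj {i} {j} e = Fin.toℕ-injective (trans (lookup-index (mem i)) (trans (cong (lookup L) e) (sym (lookup-index (mem j)))))

girth≥ : ∀ (H : Graph n) r → (∀ ℓ → HasCycle H ℓ → r ≤ ℓ) → [ r ] ≤⁺ girth H
girth≥ H r h with GraphDecidability.hasSomeCycle? H
... | yes (ℓ , c) with least (GraphDecidability.hasCycle? H) ℓ c
...   | m , cyc , _ = finite≤ (h m cyc)
girth≥ H r h | no _ = _ ≤⊤⁺

χ≥ : ∀ (H : Graph n) k → (∀ j → Colourable H j → k ≤ j) → k ≤ χ H
χ≥ H k h = h (χ H) (proj₁ (proj₂ (least (GraphDecidability.colourable? H) _ (GraphDecidability.n-colourable H))))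

χ≤ : ∀ (H : Graph n) j → Colourable H j → χ H ≤ j
χ≤ H = proj₂ (proj₂ (least (GraphDecidability.colourable? H) _ (GraphDecidability.n-colourable H)))

module _ {n : ℕ} (G : Graph n) where

  adjacent : Fin n → Fin n → Bool
  adjacent u v = ⌊ adj? G u v ⌋

  adjacent-sound : ∀ {u v} → adjacent u v ≡ true → Adj G u v
  adjacent-sound h = toWitness (Equivalence.from T-≡ h)

  adjacent-complete : ∀ {u v} → Adj G u v → adjacent u v ≡ true
  adjacent-complete h = Equivalence.to T-≡ (fromWitness h)

  adjacent-sym : ∀ u v → adjacent u v ≡ adjacent v u
  adjacent-sym u v with adj? G u v | adj? G v u
  ... | yes _ | yes _ = refl
  ... | no _  | no _  = refl
  ... | yes p | no ¬p = contradiction (symm G p) ¬p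
  ... | no ¬p | yes p = contradiction (symm G p) ¬p

  ColourableOn : List (Fin n) → ℕ → Set
  ColourableOn A q = Σ (Fin n → ℕ) λ c → (∀ {v} → v ∈ A → c v < q) ×
    (∀ {u v} → u ∈ A → v ∈ A → Adj G u v → c u ≢ c v)

  colourable-mono : ∀ {A p q} → p ≤ q → ColourableOn A p → ColourableOn A q
  colourable-mono p≤q (c , b , proper) = c , (λ v∈ → ≤-trans (b v∈) p≤q) , proper

  greedy : ∀ Δ A → (∀ u → u ∈ A → count A (adjacent u) ≤ Δ) → ColourableOn A (suc Δ)
  greedy Δ [] h = (λ _ → 0) , (λ ()) , (λ ())
  greedy Δ (x ∷ A) h with greedy Δ A (λ u u∈ → ≤-trans (m≤n+m (count A (adjacent u)) ⟦ adjacent u x ⟧) (h u (there u∈)))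
  ... | c , bound , proper with fresh (map c (filterᵇ (adjacent x) A))
  ...   | i , i≤ , i∉ = colour , bound′ , proper′
    where
    colour : Fin n → ℕ
    colour v with v Fin.≟ x
    ... | yes _ = i
    ... | no  _ = c v
    i<sucΔ : i < suc Δ
    i<sucΔ = s≤s (begin
      i                                              ≤⟨ i≤ ⟩
      length (map c (filterᵇ (adjacent x) A))        ≡⟨ length-map c (filterᵇ (adjacent x) A) ⟩
      length (filterᵇ (adjacent x) A)                ≡⟨ length-filter A (adjacent x) ⟩
      count A (adjacent x)                           ≤⟨ m≤n+m _ ⟦ adjacent x x ⟧ ⟩
      count (x ∷ A) (adjacent x)                     ≤⟨ h x (here refl) ⟩
      Δ                                              ∎)
      where open ≤-Reasoning
    tail : ∀ {v} → v ∈ x ∷ A → v ≢ x → v ∈ A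
    tail (here e)  v≢x = contradiction e v≢x
    tail (there m) v≢x = m
    bound′ : ∀ {v} → v ∈ x ∷ A → colour v < suc Δ
    bound′ {v} v∈ with v Fin.≟ x
    ... | yes _  = i<sucΔ
    ... | no v≢x = bound (tail v∈ v≢x)
    differs : ∀ {v} → v ∈ A → Adj G x v → i ≢ c v
    differs v∈ xv refl = i∉ (∈-map⁺ c (∈-filterᵇ⁺ (adjacent x) v∈ (adjacent-complete xv)))
    proper′ : ∀ {u v} → u ∈ x ∷ A → v ∈ x ∷ A → Adj G u v → colour u ≢ colour v
    proper′ {u} {v} u∈ v∈ uv with u Fin.≟ x | v Fin.≟ x
    ... | yes refl | yes refl = contradiction uv (irrefl G refl)
    ... | yes refl | no v≢x   = differs (tail v∈ v≢x) uv
    ... | no u≢x   | yes refl = differs (tail u∈ u≢x) (symm G uv) ∘ sym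
    ... | no u≢x   | no v≢x   = proper (tail u∈ u≢x) (tail v∈ v≢x) uv

  glue : ∀ p {A q s} → ColourableOn (filterᵇ p A) q → ColourableOn (filterᵇ (not ∘ p) A) s → ColourableOn A (q + s)
  glue p {A} {q} {s} (c , bound , proper) (c′ , bound′ , proper′) = colour , colour< , colour≢
    where
    colour : Fin n → ℕ
    colour v with p v
    ... | true  = c v
    ... | false = q + c′ v
    chosen : ∀ {v} → v ∈ A → p v ≡ true → v ∈ filterᵇ p A
    chosen = ∈-filterᵇ⁺ p
    left-over : ∀ {v} → v ∈ A → p v ≡ false → v ∈ filterᵇ (not ∘ p) A
    left-over v∈ e = ∈-filterᵇ⁺ (not ∘ p) v∈ (cong not e)
    colour< : ∀ {v} → v ∈ A → colour v < q + s
    colour< {v} v∈ with p v in e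
    ... | true  = ≤-trans (bound (chosen v∈ e)) (m≤m+n q s)
    ... | false = +-monoʳ-< q (bound′ (left-over v∈ e))
    apart : ∀ {x} y → x < q → x ≢ q + y
    apart y x<q e = <⇒≱ x<q (≤-trans (m≤m+n q y) (≤-reflexive (sym e)))
    colour≢ : ∀ {u v} → u ∈ A → v ∈ A → Adj G u v → colour u ≢ colour v
    colour≢ {u} {v} u∈ v∈ uv with p u in e | p v in e′
    ... | true  | true  = proper (chosen u∈ e) (chosen v∈ e′) uv
    ... | true  | false = apart (c′ v) (bound (chosen u∈ e))
    ... | false | true  = apart (c′ u) (bound (chosen v∈ e′)) ∘ sym
    ... | false | false = proper′ (left-over u∈ e) (left-over v∈ e′) uv ∘ +-cancelˡ-≡ q (c′ u) (c′ v)

  Target : ℕ → ℕ → Set₁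
  Target r k = ∃[ H ] H ⊆ᴳ G × [ r ] ≤⁺ girth H × k ≤ χ H

  module _ {r k : ℕ} (A : List (Fin n)) (nonempty : 1 ≤ length A) (A⊆G : ∀ {v} → v ∈ A → v Subset.∈ vertices G)
           (E : Edges) (far : FarEdges r E) (inside : ∀ {u v} → (u , v) ∈ E → adjacent u v ≡ true × u ∈ A × v ∈ A)
           (hits : ∀ S → S ∈ masks A → length A ≤ k * count A S → Hits E S) where

    joined⇒Adj : ∀ {u v} → Joined E u v → Adj G u v
    joined⇒Adj (inj₁ m) = adjacent-sound (proj₁ (inside m))
    joined⇒Adj (inj₂ m) = symm G (adjacent-sound (proj₁ (inside m)))

    edge-graph : Graph n
    edge-graph = record
      { vertices = vertices G
      ; Adj      = Joined E
      ; adj?     = λ u v → ((u , v) ∈? E) ⊎-dec ((v , u) ∈? E)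
      ; symm     = Joined-sym {E = E}
      ; irrefl   = λ e uv → irrefl G e (joined⇒Adj uv)
      ; incident = λ uv → incident G (joined⇒Adj uv)
      }
      where
      open DecMembership (≡-dec Fin._≟_ Fin._≟_) using (_∈?_)

    -- With fewer than k colours some class fills a share 1 / k of `A`. Its mask is hit by an edge
    -- of `E`, which is then monochromatic.
    edge-graph-target : Target r k
    edge-graph-target = edge-graph , ((λ v∈ → v∈) , joined⇒Adj) , girth≥ edge-graph r long , χ≥ edge-graph k many-colours
      where
      long : ∀ ℓ → HasCycle edge-graph ℓ → r ≤ ℓ
      long (suc m) (2≤m , c , inj , path , close) with ≤-<-connex r m
      ... | inj₁ r≤m = m≤n⇒m≤1+n r≤m
      ... | inj₂ m<r = ⊥-elim (no-short-cycle far 2≤m (<⇒≤ m<r) (cyclic c inj path close))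
      many-colours : ∀ j → Colourable edge-graph j → k ≤ j
      many-colours j (c , bound , proper) = ≮⇒≥ λ j<k →
        let i , big            = popular-value A c j k nonempty (λ v∈ → bound _ (A⊆G v∈)) (<⇒≤ j<k)
            S , S∈ , agree     = restrict A (λ v → c v ≡ᵇ i)
            big′               = ≤-trans big (*-monoʳ-≤ k (∑-mono A λ v v∈ → ≤-reflexive (cong ⟦_⟧ (sym (agree v∈)))))
            u , v , uv∈ , Su , Sv = hits S S∈ big′
            _ , u∈ , v∈        = inside uv∈
        in proper (inj₁ uv∈) (trans (≡ᵇ-sound (trans (sym (agree u∈)) Su)) (sym (≡ᵇ-sound (trans (sym (agree v∈)) Sv))))

-- Descent on the maximum degree

count≤length : ∀ {X : Set} (A : List X) p → count A p ≤ length A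
count≤length A p = ≤-trans (m≤n+m _ (count A (not ∘ p))) (≤-reflexive (count-not A p))

module _ {n : ℕ} (G : Graph n) where

  Bounded : List (Fin n) → ℕ → Set
  Bounded A Δ = ∀ u → u ∈ A → count A (adjacent G u) ≤ Δ

  -- `N₀` stays the same through the whole descent, so one number of peeling steps serves every
  -- level.
  record Piece (A : List (Fin n)) (Δ N₀ : ℕ) : Set where
    field
      distinct : Distinct A
      A⊆G      : ∀ {v} → v ∈ A → v Subset.∈ vertices G
      bounded  : Bounded A Δ
      size     : length A ≤ N₀

  filter-piece : ∀ {A Δ N₀} Δ′ p → Piece A Δ N₀ → Bounded (filterᵇ p A) Δ′ → Piece (filterᵇ p A) Δ′ N₀
  filter-piece {A} Δ′ p piece bnd = record
    { distinct = distinct-filter A p distinct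
    ; A⊆G      = λ v∈ → A⊆G (proj₁ (∈-filterᵇ⁻ p v∈))
    ; bounded  = bnd
    ; size     = ≤-trans (≤-trans (≤-reflexive (length-filter A p)) (count≤length A p)) size
    }
    where open Piece piece

  filter-bounded : ∀ {A Δ} p → Bounded A Δ → Bounded (filterᵇ p A) Δ
  filter-bounded {A} p h u u∈ = ≤-trans (≤-reflexive (∑-filter A p _)) (≤-trans (∑-mono A λ v _ → ⟦⟧*≤ (p v)) (h u (proj₁ (∈-filterᵇ⁻ p {xs = A} u∈))))

  module LowDegree (A : List (Fin n)) (S : Mask) (Δ : ℕ) (few : 2 * spanned (adjacent G) A S < count A S * Δ) where

    degree : Fin n → ℕ
    degree u = count A (λ v → S v ∧ adjacent G u v)

    low : Mask
    low v = S v ∧ (degree v ≤ᵇ Δ)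

    low-bounded : Bounded (filterᵇ low A) Δ
    low-bounded u u∈ = begin
      count (filterᵇ low A) (adjacent G u)          ≡⟨ ∑-filter A low _ ⟩
      (∑[ v ← A ] ⟦ low v ⟧ * ⟦ adjacent G u v ⟧)   ≤⟨ ∑-mono A (λ v _ → weaken (S v) (degree v ≤ᵇ Δ) (adjacent G u v)) ⟩
      degree u                                      ≤⟨ ≤ᵇ⇒≤ (degree u) Δ (Equivalence.from T-≡ (proj₂ (∧-true {S u} (proj₂ (∈-filterᵇ⁻ low {xs = A} u∈))))) ⟩
      Δ                                             ∎
      where
      open ≤-Reasoning
      weaken : ∀ s t a → ⟦ s ∧ t ⟧ * ⟦ a ⟧ ≤ ⟦ s ∧ a ⟧
      weaken false t     a     = z≤n
      weaken true  false a     = z≤n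
      weaken true  true  a     = ≤-reflexive (*-identityˡ ⟦ a ⟧)

    -- Markov's inequality: by `few` the average degree inside `S` is below Δ / 2, so the vertices
    -- of degree above Δ are outnumbered by `low`.
    low-large : count A S ≤ 2 * count A low
    low-large = begin
      count A S                         ≡⟨ split ⟩
      count A low + count A high        ≤⟨ +-monoʳ-≤ (count A low) (<⇒≤ high<low) ⟩
      count A low + count A low         ≡⟨ cong (count A low +_) (+-identityʳ (count A low)) ⟨
      2 * count A low                   ∎
      where
      open ≤-Reasoning
      high : Mask
      high v = S v ∧ not (degree v ≤ᵇ Δ)
      split : count A S ≡ count A low + count A high
      split = trans (∑-cong A λ v → parts (S v) (degree v ≤ᵇ Δ)) (∑-+ A (λ v → ⟦ low v ⟧) (λ v → ⟦ high v ⟧))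
        where
        parts : ∀ s t → ⟦ s ⟧ ≡ ⟦ s ∧ t ⟧ + ⟦ s ∧ not t ⟧
        parts false t     = refl
        parts true  true  = refl
        parts true  false = refl
      pointwise : ∀ u → Δ * ⟦ high u ⟧ ≤ (∑[ v ← A ] ⟦ S u ⟧ * (⟦ S v ⟧ * ⟦ adjacent G u v ⟧))
      pointwise u with S u | degree u ≤ᵇ Δ in e
      ... | false | _     = ≤-trans (≤-reflexive (*-zeroʳ Δ)) z≤n
      ... | true  | true  = ≤-trans (≤-reflexive (*-zeroʳ Δ)) z≤n
      ... | true  | false = begin
        Δ * 1                                                   ≡⟨ *-identityʳ Δ ⟩
        Δ                                                       ≤⟨ <⇒≤ (≰⇒> λ le → false≢true e (Equivalence.to T-≡ (≤⇒≤ᵇ le))) ⟩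
        degree u                                                ≡⟨ ∑-cong A (λ v → trans (⟦∧⟧ (S v) (adjacent G u v)) (sym (*-identityˡ _))) ⟩
        (∑[ v ← A ] 1 * (⟦ S v ⟧ * ⟦ adjacent G u v ⟧))         ∎
      high<low : count A high < count A low
      high<low = *-cancelʳ-< Δ (count A high) (count A low) (+-cancelˡ-< (count A high * Δ) _ _ (begin-strict
        count A high * Δ + count A high * Δ      ≡⟨ double (count A high) Δ ⟩
        2 * (Δ * count A high)                   ≡⟨ cong (2 *_) (∑-*ˡ A Δ (λ v → ⟦ high v ⟧)) ⟨
        2 * (∑[ u ← A ] Δ * ⟦ high u ⟧)          ≤⟨ *-monoʳ-≤ 2 (∑-mono A λ u _ → pointwise u) ⟩
        2 * spanned (adjacent G) A S             <⟨ few ⟩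
        count A S * Δ                            ≡⟨ cong (_* Δ) split ⟩
        (count A low + count A high) * Δ         ≡⟨ distrib (count A low) (count A high) Δ ⟩
        count A high * Δ + count A low * Δ       ∎))
        where
        double : ∀ h Δ → h * Δ + h * Δ ≡ 2 * (Δ * h)
        double = solve-∀
        distrib : ∀ l h Δ → (l + h) * Δ ≡ h * Δ + l * Δ
        distrib = solve-∀

  module _ (r k K Δ′ N₀ c p q b : ℕ) (1≤k : 1 ≤ k) (1≤K : 1 ≤ K) (1≤Δ′ : 1 ≤ Δ′) (p≡ : suc p ≡ 2 * k)
           (q≡ : suc q ≡ 8 * (k * K)) (b≡ : b ≡ 64 * (k * K) * suc q) (Δ′-large : 8 * (k * suc (suc b) ^ r) ≤ Δ′)
           (smaller : ∀ B → Piece B Δ′ N₀ → Target G r k ⊎ ColourableOn G B c) where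

    -- `f` bounds the number of pieces still to come. Each takes a share of at least 1 / (2k) of
    -- what is left and receives `c` colours of its own.
    peel : ∀ f A → Piece A (Δ′ * K) N₀ → length A * p ^ f < suc p ^ f → Target G r k ⊎ ColourableOn G A (f * c)
    peel f       []        piece h = inj₂ ((λ _ → 0) , (λ ()) , (λ ()))
    peel zero    (_ ∷ _)   piece h = contradiction h (≤⇒≯ (s≤s z≤n))
    -- The search through the finitely many masks decides the dichotomy: finding no large sparse set
    -- is exactly the density hypothesis of the sparsification.
    peel (suc f) A@(_ ∷ _) piece h with any? bad? (masks A)
      where
      bad? : ∀ S → _
      bad? S = (length A ≤? k * count A S) ×-dec (2 * spanned (adjacent G) A S <? count A S * Δ′)
    ... | no none = inj₁ (edge-graph-target G A (s≤s z≤n) A⊆G (proj₁ sp) (proj₁ (proj₂ sp)) (proj₁ (proj₂ (proj₂ sp))) (proj₂ (proj₂ (proj₂ sp))))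
      where
      open Piece piece
      dense : ∀ S → S ∈ masks A → length A ≤ k * count A S → count A S * Δ′ ≤ 2 * spanned (adjacent G) A S
      dense S S∈ big = ≮⇒≥ λ few → none (lose S∈ (big , few))
      sp = Sparsify.sparse (adjacent G) (adjacent-sym G) A distinct r k K Δ′ q b q≡ b≡ 1≤k 1≤K 1≤Δ′ (s≤s z≤n) bounded dense Δ′-large
    ... | yes found with satisfied found
    ...   | S , big , few = [ inj₁ , (λ col → [ inj₁ , (λ col′ → inj₂ (glue G low col col′)) ]′ rest) ]′ (smaller (filterᵇ low A) (filter-piece Δ′ low piece low-bounded))
      where
      open Piece piece
      open LowDegree A S Δ′ few
      large : length A ≤ suc p * count A low
      large = begin
        length A                        ≤⟨ big ⟩
        k * count A S                   ≤⟨ *-monoʳ-≤ k low-large ⟩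
        k * (2 * count A low)           ≡⟨ trans (sym (*-assoc k 2 (count A low))) (cong (_* count A low) (trans (*-comm k 2) (sym p≡))) ⟩
        suc p * count A low             ∎
        where open ≤-Reasoning
      rest = peel f (filterᵇ (not ∘ low) A) (filter-piece (Δ′ * K) (not ∘ low) piece (filter-bounded (not ∘ low) bounded))
        (shrink p f {rest = length (filterᵇ (not ∘ low) A)} (trans (cong (_+ count A low) (length-filter A (not ∘ low))) (count-not A low)) large h)

  module _ (r k w N₀ p q b P : ℕ) (1≤k : 1 ≤ k) (1≤w : 1 ≤ w) (p≡ : suc p ≡ 2 * k)
           (q≡ : suc q ≡ 8 * (k * 2 ^ w)) (b≡ : b ≡ 64 * (k * 2 ^ w) * suc q) (514k²≤ : 514 * (k * k) ≤ 2 ^ w)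
           (fuel : N₀ * p ^ P < suc p ^ P) where

    -- Degree bounds are powers of K = 2^w, one factor per round. The lowest is K^(3r + 1), which b
    -- + 2 ≤ K³ and 8k ≤ K make large enough for the sparsification.
    level : ℕ → ℕ
    level j = 2 ^ ((3 * r + 1 + j) * w)

    Δ-large : ∀ j → 8 * (k * suc (suc b) ^ r) ≤ level j
    Δ-large j = begin
      8 * (k * suc (suc b) ^ r)             ≡⟨ *-assoc 8 k (suc (suc b) ^ r) ⟨
      8 * k * suc (suc b) ^ r               ≤⟨ *-mono-≤ 8k≤ (^-monoˡ-≤ r b+2≤) ⟩
      2 ^ w * (2 ^ (w * 3)) ^ r             ≡⟨ cong (2 ^ w *_) (^-*-assoc 2 (w * 3) r) ⟩
      2 ^ w * 2 ^ (w * 3 * r)               ≡⟨ ^-distribˡ-+-* 2 w (w * 3 * r) ⟨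
      2 ^ (w + w * 3 * r)                   ≤⟨ ^-monoʳ-≤ 2 (≤-trans (≤-reflexive (exponents w r)) (*-monoˡ-≤ w (m≤m+n (3 * r + 1) j))) ⟩
      2 ^ ((3 * r + 1 + j) * w)             ∎
      where
      open ≤-Reasoning
      exponents : ∀ w r → w + w * 3 * r ≡ (3 * r + 1) * w
      exponents = solve-∀
      8k≤ : 8 * k ≤ 2 ^ w
      8k≤ = ≤-trans (*-mono-≤ (m≤m+n 8 506) (≤-trans (≤-reflexive (sym (*-identityʳ k))) (*-monoʳ-≤ k 1≤k))) 514k²≤
      1≤kK : 1 ≤ k * 2 ^ w
      1≤kK = *-mono-≤ 1≤k (m^n>0 2 w)
      -- The constant 514 is 64 · 8 = 512 from `b` plus 2: the sum is at most 514 k² K², and 514 k²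
      -- ≤ K.
      b+2≤ : suc (suc b) ≤ 2 ^ (w * 3)
      b+2≤ = begin
        2 + b                                               ≤⟨ +-monoˡ-≤ b (*-monoʳ-≤ 2 (*-mono-≤ 1≤kK 1≤kK)) ⟩
        2 * (k * 2 ^ w * (k * 2 ^ w)) + b                   ≡⟨ cong (2 * (k * 2 ^ w * (k * 2 ^ w)) +_) (trans b≡ (cong (64 * (k * 2 ^ w) *_) q≡)) ⟩
        2 * (k * 2 ^ w * (k * 2 ^ w)) + 64 * (k * 2 ^ w) * (8 * (k * 2 ^ w)) ≡⟨ collect k (2 ^ w) ⟩
        514 * (k * k) * (2 ^ w * (2 ^ w * 1))               ≤⟨ *-monoˡ-≤ (2 ^ w * (2 ^ w * 1)) 514k²≤ ⟩
        (2 ^ w) ^ 3                                         ≡⟨ ^-*-assoc 2 w 3 ⟩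
        2 ^ (w * 3)                                         ∎
        where
        collect : ∀ k K → 2 * (k * K * (k * K)) + 64 * (k * K) * (8 * (k * K)) ≡ 514 * (k * k) * (K * (K * 1))
        collect = solve-∀

    -- At the lowest level greedy colouring takes K^(3r + 1) + 1 ≤ K^(3r + 2) colours. Every level
    -- above multiplies the count by the `P` pieces of one peeling.
    descend : ∀ j A → Piece A (level j) N₀ → Target G r k ⊎ ColourableOn G A (P ^ j * 2 ^ ((3 * r + 2) * w))
    descend zero A piece = inj₂ (colourable-mono G {A} colours (greedy G (level 0) A (Piece.bounded piece)))
      where
      open ≤-Reasoning
      colours : suc (level 0) ≤ P ^ 0 * 2 ^ ((3 * r + 2) * w)
      colours = begin
        1 + 2 ^ ((3 * r + 1 + 0) * w)             ≤⟨ +-mono-≤ (m^n>0 2 ((3 * r + 1 + 0) * w)) (m≤m+n (level 0) 0) ⟩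
        2 ^ suc ((3 * r + 1 + 0) * w)             ≤⟨ ^-monoʳ-≤ 2 (≤-trans (+-monoˡ-≤ ((3 * r + 1 + 0) * w) 1≤w) (≤-reflexive (exponents r w))) ⟩
        2 ^ ((3 * r + 2) * w)                     ≡⟨ *-identityˡ (2 ^ ((3 * r + 2) * w)) ⟨
        1 * 2 ^ ((3 * r + 2) * w)                 ∎
        where
        exponents : ∀ r w → w + (3 * r + 1 + 0) * w ≡ (3 * r + 2) * w
        exponents = solve-∀
    descend (suc j) A piece = subst (λ c → Target G r k ⊎ ColourableOn G A c) (sym (*-assoc P (P ^ j) (2 ^ ((3 * r + 2) * w))))
      (peel r k (2 ^ w) (level j) N₀ (P ^ j * 2 ^ ((3 * r + 2) * w)) p q b 1≤k (m^n>0 2 w) (m^n>0 2 ((3 * r + 1 + j) * w)) p≡ q≡ b≡ (Δ-large j) (descend j)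
        P A (subst (λ Δ → Piece A Δ N₀) levels piece) (≤-<-trans (*-monoˡ-≤ (p ^ P) (Piece.size piece)) fuel))
      where
      levels : level (suc j) ≡ level j * 2 ^ w
      levels = trans (cong (2 ^_) (exponents r j w)) (^-distribˡ-+-* 2 ((3 * r + 1 + j) * w) w)
        where
        exponents : ∀ r j w → (3 * r + 1 + (1 + j)) * w ≡ (3 * r + 1 + j) * w + w
        exponents = solve-∀

  -- From a graph to its non-isolated vertices.

  unique⇒distinct : ∀ {xs : List (Fin n)} → Unique xs → Distinct xs
  unique⇒distinct []       y = z≤n
  unique⇒distinct {x ∷ xs} (x∉ ∷ u) y with x Fin.≟ y
  ... | yes refl = ≤-reflexive (cong suc (absent xs x∉))
    where
    absent : ∀ xs → All (x ≢_) xs → count xs (_== x) ≡ 0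
    absent []       []        = refl
    absent (z ∷ zs) (x≢z ∷ h) with z Fin.≟ x
    ... | yes e = contradiction (sym e) x≢z
    ... | no _  = absent zs h
  ... | no _ = unique⇒distinct u y

  edges : Edges
  edges = filter (λ (u , v) → (u Fin.<? v) ×-dec adj? G u v) (cartesianProduct (allFin n) (allFin n))

  adjacent⇒joined : ∀ {u v} → Adj G u v → Joined edges u v
  adjacent⇒joined {u} {v} uv with Fin.<-cmp u v
  ... | tri< u<v _ _   = inj₁ (∈-filter⁺ (λ (u , v) → (u Fin.<? v) ×-dec adj? G u v) (∈-cartesianProduct⁺ (∈-allFin u) (∈-allFin v)) (u<v , uv))
  ... | tri≈ _ u≡v _   = contradiction uv (irrefl G u≡v)
  ... | tri> _ _ v<u   = inj₂ (∈-filter⁺ (λ (u , v) → (u Fin.<? v) ×-dec adj? G u v) (∈-cartesianProduct⁺ (∈-allFin v) (∈-allFin u)) (v<u , symm G uv))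

  hasNeighbour : Fin n → Bool
  hasNeighbour v = ⌊ Fin.any? (adj? G v) ⌋

  -- Edges do not bound the number of all vertices, but each vertex kept here contributes to the
  -- degree sum, so there are at most 2e(G) of them.
  nonisolated : List (Fin n)
  nonisolated = filterᵇ hasNeighbour (allFin n)

  ∈-nonisolated⁺ : ∀ {u v} → Adj G u v → u ∈ nonisolated
  ∈-nonisolated⁺ {u} {v} uv = ∈-filterᵇ⁺ hasNeighbour (∈-allFin u) (Equivalence.to T-≡ (fromWitness (v , uv)))

  ∈-nonisolated⁻ : ∀ {u} → u ∈ nonisolated → ∃[ v ] Adj G u v
  ∈-nonisolated⁻ u∈ = toWitness (Equivalence.from T-≡ (proj₂ (∈-filterᵇ⁻ hasNeighbour {xs = allFin n} u∈)))

  nonisolated-distinct : Distinct nonisolated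
  nonisolated-distinct = distinct-filter (allFin n) hasNeighbour (unique⇒distinct (allFin⁺ n))

  nonisolated≤2e : length nonisolated ≤ 2 * e G
  nonisolated≤2e = begin
    length nonisolated               ≡⟨ length≡∑1 nonisolated ⟩
    (∑[ v ← nonisolated ] 1)         ≤⟨ ∑-mono nonisolated (λ v v∈ → positive (∈-nbrs edges (adjacent⇒joined (proj₂ (∈-nonisolated⁻ v∈))))) ⟩
    sumOver nonisolated (deg edges)  ≤⟨ ∑-deg nonisolated nonisolated-distinct edges ⟩
    2 * e G                          ∎
    where
    open ≤-Reasoning
    positive : ∀ {w} {L : List (Fin n)} → w ∈ L → 1 ≤ length L
    positive (here _)  = s≤s z≤n
    positive (there _) = s≤s z≤n

  -- The omitted vertices lie on no edge and all take colour 0, hence the requirement 1 ≤ q.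
  nonisolated-colouring : ∀ {q} → 1 ≤ q → ColourableOn G nonisolated q → Colourable G q
  nonisolated-colouring {q} 1≤q (c , bound , proper) = colour , (λ v _ → colour< v) , λ {u} {v} uv eq →
    proper (∈-nonisolated⁺ uv) (∈-nonisolated⁺ (symm G uv)) uv (trans (sym (colour≡ uv)) (trans eq (colour≡ (symm G uv))))
    where
    colour : Fin n → ℕ
    colour v with hasNeighbour v
    ... | true  = c v
    ... | false = 0
    colour< : ∀ v → colour v < q
    colour< v with hasNeighbour v in eq
    ... | true  = bound (∈-filterᵇ⁺ hasNeighbour (∈-allFin v) eq)
    ... | false = 1≤q
    colour≡ : ∀ {u v} → Adj G u v → colour u ≡ c u
    colour≡ {u} {v} uv with hasNeighbour u in eq
    ... | true  = refl
    ... | false = ⊥-elim (false≢true eq (Equivalence.to T-≡ (fromWitness (v , uv))))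

  -- `level J` is at least 2^x and so bounds every degree at the start. By `decay`, P = 2k(x + 1)
  -- pieces exhaust any set of at most 2^x vertices. Without a target the descent would colour G
  -- with fewer than χ(G) colours.
  high-girth-subgraph : ∀ r k w J x → 1 ≤ k → 1 ≤ w → 514 * (k * k) ≤ 2 ^ w → 2 * e G ≤ 2 ^ x → x ≤ (3 * r + 1 + J) * w →
    (2 * k * suc x) ^ J * 2 ^ ((3 * r + 2) * w) < χ G → Target G r k
  high-girth-subgraph r k w J x 1≤k 1≤w 514k²≤ 2e≤ x≤ χ-large =
    [ (λ t → t) , (λ col → contradiction (χ≤ G _ (nonisolated-colouring (*-mono-≤ (m^n>0 P {{>-nonZero 1≤P}} J) (m^n>0 2 ((3 * r + 2) * w))) col)) (<⇒≱ χ-large)) ]′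
    (descend r k w (2 * e G) p q b P 1≤k 1≤w p≡ q≡ refl 514k²≤ fuel J nonisolated record
      { distinct = nonisolated-distinct
      ; A⊆G      = λ v∈ → incident G (proj₂ (∈-nonisolated⁻ v∈))
      ; bounded  = λ u _ → ≤-trans (count≤length nonisolated (adjacent G u)) (≤-trans nonisolated≤2e (≤-trans 2e≤ (^-monoʳ-≤ 2 x≤)))
      ; size     = nonisolated≤2e
      })
    where
    P p q b : ℕ
    P = 2 * k * suc x
    p = pred (2 * k)
    q = pred (8 * (k * 2 ^ w))
    b = 64 * (k * 2 ^ w) * suc q
    p≡ : suc p ≡ 2 * k
    p≡ = suc-pred (2 * k) {{>-nonZero (*-mono-≤ (s≤s (z≤n {1})) 1≤k)}}
    q≡ : suc q ≡ 8 * (k * 2 ^ w)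
    q≡ = suc-pred (8 * (k * 2 ^ w)) {{>-nonZero (*-mono-≤ (s≤s (z≤n {7})) (*-mono-≤ 1≤k (m^n>0 2 w)))}}
    1≤P : 1 ≤ P
    1≤P = *-mono-≤ (*-mono-≤ (s≤s (z≤n {1})) 1≤k) (s≤s (z≤n {x}))
    fuel : 2 * e G * p ^ P < suc p ^ P
    fuel = ≤-<-trans (*-monoˡ-≤ (p ^ P) 2e≤) (subst (λ P → 2 ^ x * p ^ P < suc p ^ P) (cong (_* suc x) p≡)
      (decay p x (≤-pred (≤-trans (*-monoʳ-≤ 2 1≤k) (≤-reflexive (sym p≡))))))

-- Choice of parameters

n<2^n : ∀ n → n < 2 ^ n
n<2^n zero    = s≤s z≤n
n<2^n (suc n) = +-mono-≤ (m^n>0 2 n) (≤-trans (n<2^n n) (m≤m+n (2 ^ n) 0))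

-- With m = d + 1 and q the quotient of t by m, t ≤ m (q + 1) ≤ m 2^q, so t^m ≤ m^m 2^t. The surplus
-- factor t of t^m over t^d absorbs c m^m.
exp-dominates : ∀ c d t → c * suc d ^ suc d ≤ t → c * t ^ d ≤ 2 ^ t
exp-dominates c d t large = *-cancelˡ-≤ (m ^ m) {{m^n≢0 m m}} (begin
  m ^ m * (c * t ^ d)         ≡⟨ lemma (m ^ m) c (t ^ d) ⟩
  c * m ^ m * t ^ d           ≤⟨ *-monoˡ-≤ (t ^ d) large ⟩
  t ^ m                       ≤⟨ ^-monoˡ-≤ m t≤ ⟩
  (m * suc q) ^ m             ≡⟨ *-^ m (suc q) m ⟩
  m ^ m * suc q ^ m           ≤⟨ *-monoʳ-≤ (m ^ m) (^-monoˡ-≤ m (n<2^n q)) ⟩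
  m ^ m * (2 ^ q) ^ m         ≡⟨ cong (m ^ m *_) (^-*-assoc 2 q m) ⟩
  m ^ m * 2 ^ (q * m)         ≤⟨ *-monoʳ-≤ (m ^ m) (^-monoʳ-≤ 2 (≤-trans (m≤n+m (q * m) (t % m)) (≤-reflexive (sym (m≡m%n+[m/n]*n t m))))) ⟩
  m ^ m * 2 ^ t               ∎)
  where
  open ≤-Reasoning
  m = suc d
  q = t div m
  lemma : ∀ a c p → a * (c * p) ≡ c * a * p
  lemma = solve-∀
  t≤ : t ≤ m * suc q
  t≤ = begin
    t                     ≡⟨ m≡m%n+[m/n]*n t m ⟩
    t % m + q * m         ≤⟨ +-monoˡ-≤ (q * m) (<⇒≤ (m%n<n t m)) ⟩
    m + q * m             ≡⟨ *-comm (suc q) m ⟩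
    m * suc q             ∎

crossing : ∀ (g : ℕ → ℕ) x t s → g t ≤ x → x < g (s + t) → ∃[ u ] t ≤ u × g u ≤ x × x < g (suc u)
crossing g x t zero    lo hi = contradiction hi (≤⇒≯ lo)
crossing g x t (suc s) lo hi with g (suc t) ≤? x
... | no  h = t , ≤-refl , lo , ≰⇒> h
... | yes h with crossing g x (suc t) s h (subst (λ k → x < g k) (sym (+-suc s t)) hi)
...   | u , t<u , rest = u , <⇒≤ t<u , rest

module Scale (r k c : ℕ) (1≤k : 1 ≤ k) where

  -- `R` budgets the exponent of χ in units of w = t⁴: 3r + 2 for the greedy base, one for the
  -- losses of the rounds, one for strictness. `C` turns 2c(2T)⁷ with T = R(t + 1) ≤ 2Rt into C t⁷,
  -- its summand 2 covering the doubling and the `suc`; D t⁷ bounds the number of pieces per round.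
  -- The summands of `t₀` serve `514k²≤` and `exp-dominates`.
  R C D t₀ : ℕ
  R  = 3 * r + 4
  C  = c * (4 * R) ^ 7 * 2 + 2
  D  = 2 * k * suc C
  t₀ = suc (514 * (k * k) + D ^ C * suc (7 * C) ^ suc (7 * C))

  threshold : ℕ → ℕ
  threshold t = 2 ^ (R * t ^ 4)

  1≤R : 1 ≤ R
  1≤R = ≤-trans (s≤s z≤n) (m≤n+m 4 (3 * r))

  threshold-unbounded : ∀ x → x < threshold (x + t₀)
  threshold-unbounded x = ≤-trans (n<2^n x) (^-monoʳ-≤ 2 (begin
    x                        ≤⟨ m≤m+n x t₀ ⟩
    x + t₀                   ≡⟨ *-identityʳ (x + t₀) ⟨
    (x + t₀) ^ 1             ≤⟨ ^-monoʳ-≤ (x + t₀) {{>-nonZero (≤-trans (s≤s z≤n) (m≤n+m t₀ x))}} (s≤s (z≤n {3})) ⟩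
    (x + t₀) ^ 4             ≤⟨ m≤n*m ((x + t₀) ^ 4) R {{>-nonZero 1≤R}} ⟩
    R * (x + t₀) ^ 4         ∎))
    where open ≤-Reasoning

  module _ (t : ℕ) (t₀≤t : t₀ ≤ t) where

    open ≤-Reasoning

    1≤t : 1 ≤ t
    1≤t = ≤-trans (s≤s z≤n) t₀≤t

    t≢0 : NonZero t
    t≢0 = >-nonZero 1≤t

    w depth x T M : ℕ
    w = t ^ 4
    depth = C * t ^ 3
    x = C * t ^ 7
    T = R * suc t
    M = c * (2 * T) ^ 7 * 2

    1≤w : 1 ≤ w
    1≤w = m^n>0 t {{t≢0}} 4

    514k²≤ : 514 * (k * k) ≤ 2 ^ w
    514k²≤ = begin
      514 * (k * k)        ≤⟨ ≤-trans (m≤m+n _ _) (≤-trans (n≤1+n _) t₀≤t) ⟩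
      t                    ≡⟨ *-identityʳ t ⟨
      t ^ 1                ≤⟨ ^-monoʳ-≤ t {{t≢0}} (s≤s (z≤n {3})) ⟩
      w                    ≤⟨ <⇒≤ (n<2^n w) ⟩
      2 ^ w                ∎

    x≤ : x ≤ (3 * r + 1 + depth) * w
    x≤ = begin
      C * t ^ 7                       ≡⟨ cong (C *_) (^-distribˡ-+-* t 3 4) ⟩
      C * (t ^ 3 * t ^ 4)             ≡⟨ *-assoc C (t ^ 3) (t ^ 4) ⟨
      depth * w                           ≤⟨ *-monoˡ-≤ w (m≤n+m depth (3 * r + 1)) ⟩
      (3 * r + 1 + depth) * w             ∎

    T-large : ∀ {χ} → χ < threshold (suc t) → χ ≤ 2 ^ (T ^ 4)
    T-large lt = ≤-trans (<⇒≤ lt) (^-monoʳ-≤ 2 (begin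
      R * suc t ^ 4          ≡⟨ cong (_* suc t ^ 4) (*-identityʳ R) ⟨
      R ^ 1 * suc t ^ 4      ≤⟨ *-monoˡ-≤ (suc t ^ 4) (^-monoʳ-≤ R {{>-nonZero 1≤R}} (s≤s (z≤n {3}))) ⟩
      R ^ 4 * suc t ^ 4      ≡⟨ *-^ R (suc t) 4 ⟨
      T ^ 4                  ∎))

    2e≤ : ∀ {m} → m ≤ suc (2 ^ M) → 2 * m ≤ 2 ^ x
    2e≤ {m} h = begin
      2 * m                            ≤⟨ *-monoʳ-≤ 2 h ⟩
      2 * suc (2 ^ M)                  ≤⟨ *-monoʳ-≤ 2 (+-mono-≤ (m^n>0 2 M) (m≤m+n (2 ^ M) 0)) ⟩
      2 ^ (2 + M)                      ≤⟨ ^-monoʳ-≤ 2 exponent ⟩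
      2 ^ x                            ∎
      where
      regroup : ∀ c a p → c * (a * p) * 2 + 2 * p ≡ (c * a * 2 + 2) * p
      regroup = solve-∀
      reorder : ∀ R t → 2 * (R * (t + t)) ≡ 4 * R * t
      reorder = solve-∀
      exponent : 2 + M ≤ x
      exponent = begin
        2 + M                                        ≡⟨ +-comm 2 M ⟩
        M + 2                                        ≤⟨ +-mono-≤ (*-monoˡ-≤ 2 (*-monoʳ-≤ c (^-monoˡ-≤ 7 2T≤))) (*-monoʳ-≤ 2 (m^n>0 t {{t≢0}} 7)) ⟩
        c * (4 * R * t) ^ 7 * 2 + 2 * t ^ 7          ≡⟨ cong (λ z → c * z * 2 + 2 * t ^ 7) (*-^ (4 * R) t 7) ⟩
        c * ((4 * R) ^ 7 * t ^ 7) * 2 + 2 * t ^ 7    ≡⟨ regroup c ((4 * R) ^ 7) (t ^ 7) ⟩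
        x                                            ∎
        where
        2T≤ : 2 * T ≤ 4 * R * t
        2T≤ = ≤-trans (*-monoʳ-≤ 2 (*-monoʳ-≤ R (+-monoˡ-≤ t 1≤t))) (≤-reflexive (reorder R t))

    -- The C t³ rounds are grouped into t³ blocks of C. One block costs a polynomial in t, hence at
    -- most 2^t, and all blocks together at most 2^(t⁴).
    loss≤ : (2 * k * suc x) ^ depth ≤ 2 ^ w
    loss≤ = begin
      (2 * k * suc x) ^ (C * t ^ 3)        ≡⟨ ^-*-assoc (2 * k * suc x) C (t ^ 3) ⟨
      ((2 * k * suc x) ^ C) ^ t ^ 3        ≤⟨ ^-monoˡ-≤ (t ^ 3) per-block ⟩
      (2 ^ t) ^ t ^ 3                      ≡⟨ ^-*-assoc 2 t (t ^ 3) ⟩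
      2 ^ w                                ∎
      where
      per-block : (2 * k * suc x) ^ C ≤ 2 ^ t
      per-block = begin
        (2 * k * suc x) ^ C                ≤⟨ ^-monoˡ-≤ C (*-monoʳ-≤ (2 * k) (+-monoˡ-≤ x (m^n>0 t {{t≢0}} 7))) ⟩
        (2 * k * (suc C * t ^ 7)) ^ C      ≡⟨ cong (_^ C) (*-assoc (2 * k) (suc C) (t ^ 7)) ⟨
        (D * t ^ 7) ^ C                    ≡⟨ *-^ D (t ^ 7) C ⟩
        D ^ C * (t ^ 7) ^ C                ≡⟨ cong (D ^ C *_) (^-*-assoc t 7 C) ⟩
        D ^ C * t ^ (7 * C)                ≤⟨ exp-dominates (D ^ C) (7 * C) t (≤-trans (m≤n+m _ (514 * (k * k))) (≤-trans (n≤1+n _) t₀≤t)) ⟩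
        2 ^ t                              ∎

    few-colours : ∀ {χ} → threshold t ≤ χ → (2 * k * suc x) ^ depth * 2 ^ ((3 * r + 2) * w) < χ
    few-colours {χ} le = begin-strict
      (2 * k * suc x) ^ depth * 2 ^ ((3 * r + 2) * w)   ≤⟨ *-monoˡ-≤ (2 ^ ((3 * r + 2) * w)) loss≤ ⟩
      2 ^ w * 2 ^ ((3 * r + 2) * w)                 ≡⟨ ^-distribˡ-+-* 2 w ((3 * r + 2) * w) ⟨
      2 ^ (w + (3 * r + 2) * w)                     <⟨ ^-monoʳ-< 2 ≤-refl (m<m+n (w + (3 * r + 2) * w) 1≤w) ⟩
      2 ^ (w + (3 * r + 2) * w + w)                 ≡⟨ cong (2 ^_) (exponents r w) ⟩
      2 ^ (R * t ^ 4)                               ≤⟨ le ⟩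
      χ                                             ∎
      where
      exponents : ∀ r w → w + (3 * r + 2) * w + w ≡ (3 * r + 4) * w
      exponents = solve-∀

    3≤threshold : 3 ≤ threshold t
    3≤threshold = ≤-trans (s≤s (s≤s (s≤s (z≤n {1})))) (^-monoʳ-≤ 2 {2} (*-mono-≤ {2} {R} {1} (≤-trans (s≤s (s≤s z≤n)) (m≤n+m 4 (3 * r))) 1≤w))

open Estimates using (edge-bound)
open import Data.Integer using (+_)
open import Data.Rational using (_/_)

corollary10p41 : (r k : ℕ) → 4 ≤ r → 2 ≤ k →
    (a C₀ : ℝ) → fromℕ 1 <ᴿ a → a <ᴿ fromℚ (+ 3 / 2) → fromℕ 0 <ᴿ C₀ →
    ∃[ χ₀ ] ∀ {n : ℕ} (G : Graph n) → χ₀ ≤ χ G → (2≤χ : 2 ≤ χ G) →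
    fromℕ (e G) ≤ᴿ exp (C₀ *ᴿ log-pow (χ G) 2≤χ a) →
    ∃[ H ] H ⊆ᴳ G × [ r ] ≤⁺ girth H × k ≤ χ H
corollary10p41 r k 4≤r 2≤k a C₀ 1<a a<3/2 0<C₀ = threshold t₀ , λ G χ-large 2≤χ few-edges →
  -- χ lies between consecutive thresholds: the lower one pays for the colours, the upper one gives
  -- χ ≤ 2^(T⁴) for the edge bound. As `threshold` outgrows its argument, χ(G) search steps are
  -- enough.
  let t , t₀≤t , lower , upper = crossing threshold (χ G) t₀ (χ G) χ-large (threshold-unbounded (χ G))
      e≤ = bound (e G) (χ G) (T t t₀≤t) 2≤χ (≤-trans (3≤threshold t t₀≤t) lower) (*-mono-≤ 1≤R (s≤s (z≤n {t}))) (T-large t t₀≤t upper) few-edges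
  in high-girth-subgraph G r k (w t t₀≤t) (depth t t₀≤t) (x t t₀≤t) 1≤k (1≤w t t₀≤t) (514k²≤ t t₀≤t) (2e≤ t t₀≤t e≤) (x≤ t t₀≤t) (few-colours t t₀≤t lower)
  where
  c = proj₁ (edge-bound a C₀ 1<a a<3/2 0<C₀)
  bound = proj₂ (edge-bound a C₀ 1<a a<3/2 0<C₀)
  1≤k : 1 ≤ k
  1≤k = ≤-trans (s≤s z≤n) 2≤k
  open Scale r k c 1≤k
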